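{- Let $q$ be an odd prime power and write $q-1=\ell\cdot m$, where $\ell$ is an odd prime with $\ell\nmid m$. Let $\beta:\mathrm{GL}_2(q)\to \mathrm{GL}(V_{m,0})$ be the irreducible principal series representation $V_{m,0}$ described in the context. Call two subsets $S_1,S_2\subseteq \mathrm{GL}_2(q)$ cross-$1$-intersecting (with respect to $\beta$) if $\dim\{v\in V_{m,0}: \beta(g_1)v=\beta(g_2)v\}\ge 1$ for every $(g_1,g_2)\in S_1\times S_2$. Then $$\max_{(S_1,S_2)}\sqrt{|S_1|\cdot|S_2|}=\frac{|\mathrm{GL}_2(q)|}{\ell},$$ where the maximum is over all pairs $(S_1,S_2)$ of cross-$1$-intersecting subsets of $\mathrm{GL}_2(q)$.
   Context: $\mathrm{GL}_2(q)$ is the group of invertible $2\times 2$ matrices over the finite field $\mathbb{F}_q$. Fix a generator $\varepsilon$ of $\mathbb{F}_q^\times$ and let $\mu_m:\mathbb{F}_q^\times\to\mathbb{C}^\times$ be the character $\mu_m(\varepsilon^j)=\exp(2\pi\sqrt{ -1}\, m j/(q-1))$. Then $V_{m,0}$ is the complex vector space of functions $f:\mathrm{GL}_2(q)\to\mathbb{C}$ satisfying $f\left(\begin{pmatrix}a&b\\0&d\end{pmatrix}x\right)=\mu_m(a)f(x)$ for all invertible upper triangular matrices and all $x\in\mathrm{GL}_2(q)$, with $\mathrm{GL}_2(q)$ acting by right translation: $(\beta(g)f)(x)=f(xg)$. -}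

module Defs where

open import Level using (0ℓ)
open import Data.Nat using (ℕ; zero; suc; _<_) renaming (_*_ to _*ℕ_)
open import Data.Bool using (Bool; true; false)
open import Data.Product using (Σ; ∃; _×_; _,_; proj₁; proj₂)
open import Data.List using (List; []; _∷_; length; concatMap; map; mapMaybe)
open import Data.Maybe using (Maybe; just; nothing)
open import Data.Empty using (⊥)
open import Relation.Nullary using (¬_; Dec; yes; no)
open import Relation.Nullary.Decidable using (False)
open import Relation.Binary.PropositionalEquality using (_≡_; _≢_)
open import Algebra.Structures using (IsCommutativeRing)
open import Algebra.Bundles using (CommutativeRing)
open import Relation.Nullary.Decidable using (fromWitnessFalse; toWitnessFalse)
open import Relation.Binary.PropositionalEquality using (refl; sym; trans; cong; module ≡-Reasoning)
open import Data.Empty using (⊥-elim)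
open import Tactic.RingSolver.Core.AlmostCommutativeRing using (AlmostCommutativeRing; fromCommutativeRing)
open import Tactic.RingSolver using (solve-∀)
open import Data.List.Relation.Unary.Unique.Propositional using (Unique)
open import Data.List.Membership.Propositional using (_∈_)

pow : {A : Set} → (A → A → A) → A → A → ℕ → A
pow _*_ one x zero    = one
pow _*_ one x (suc n) = x * pow _*_ one x n

natToRing : {A : Set} → (A → A → A) → A → A → ℕ → A
natToRing _+_ zer one zero    = zer
natToRing _+_ zer one (suc n) = one + natToRing _+_ zer one n

record FiniteField : Set₁ where
  field
    Carrier : Set
    _+_ _*_ : Carrier → Carrier → Carrier
    -_      : Carrier → Carrier
    0# 1#   : Carrier
    isCommutativeRing : IsCommutativeRing _≡_ _+_ _*_ -_ 0# 1#
    0≢1     : 0# ≢ 1#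
    inverse : ∀ x → x ≢ 0# → ∃ λ y → x * y ≡ 1#
    _≟_     : (x y : Carrier) → Dec (x ≡ y)
    elems   : List Carrier
    elems-unique   : Unique elems
    elems-complete : ∀ x → x ∈ elems

  _^_ : Carrier → ℕ → Carrier
  _^_ = pow _*_ 1#

  order : ℕ
  order = length elems

  IsGenerator : Carrier → Set
  IsGenerator ε = ε ≢ 0# × (∀ x → x ≢ 0# → ∃ λ j → ε ^ j ≡ x)

-- A field of characteristic zero (stand-in for ℂ), with a
-- setoid equality.
record CharZeroField : Set₁ where
  field
    Carrier : Set
    _≈_     : Carrier → Carrier → Set
    _+_ _*_ : Carrier → Carrier → Carrier
    -_      : Carrier → Carrier
    0# 1#   : Carrier
    isCommutativeRing : IsCommutativeRing _≈_ _+_ _*_ -_ 0# 1#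
    0≉1     : ¬ (0# ≈ 1#)
    inverse : ∀ x → ¬ (x ≈ 0#) → ∃ λ y → (x * y) ≈ 1#
    charZero : ∀ n → ¬ (natToRing _+_ 0# 1# (suc n) ≈ 0#)

  _^_ : Carrier → ℕ → Carrier
  _^_ = pow _*_ 1#

  IsPrimitiveRoot : Carrier → ℕ → Set
  IsPrimitiveRoot ζ n = ((ζ ^ n) ≈ 1#) × (∀ k → 0 < k → k < n → ¬ ((ζ ^ k) ≈ 1#))

module GL2 (F : FiniteField) where
  open FiniteField F

  record Mat : Set where
    constructor mat
    field a b c d : Carrier
  open Mat public

  CRing : CommutativeRing 0ℓ 0ℓ
  CRing = record { isCommutativeRing = isCommutativeRing }

  ACR : AlmostCommutativeRing 0ℓ 0ℓ
  ACR = fromCommutativeRing CRing (λ _ → nothing)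

  open IsCommutativeRing isCommutativeRing using (*-assoc; *-comm; zeroʳ; zeroˡ; *-identityʳ; *-identityˡ)

  module DL where
    open AlmostCommutativeRing ACR using () renaming (_+_ to _⊕_; _*_ to _⊛_; -_ to ⊝_)
    det-lemma' : ∀ a b c d a' b' c' d' →
      (((a ⊛ a') ⊕ (b ⊛ c')) ⊛ ((c ⊛ b') ⊕ (d ⊛ d'))) ⊕ (((a ⊛ d) ⊛ (b' ⊛ c')) ⊕ ((b ⊛ c) ⊛ (a' ⊛ d')))
        ≡ (((a ⊛ b') ⊕ (b ⊛ d')) ⊛ ((c ⊛ a') ⊕ (d ⊛ c'))) ⊕ (((a ⊛ d) ⊛ (a' ⊛ d')) ⊕ ((b ⊛ c) ⊛ (b' ⊛ c')))
    det-lemma' = solve-∀ ACR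

  module DL2 where
    open AlmostCommutativeRing ACR using () renaming (_+_ to _⊕_; _*_ to _⊛_)
    l1 : ∀ w v t s → (((w ⊕ v) ⊛ t) ⊕ (v ⊛ s)) ≡ ((w ⊛ t) ⊕ ((v ⊛ t) ⊕ (v ⊛ s)))
    l1 = solve-∀ ACR
    l2 : ∀ w v t s → (((w ⊕ v) ⊛ s) ⊕ (v ⊛ t)) ≡ ((w ⊛ s) ⊕ ((v ⊛ t) ⊕ (v ⊛ s)))
    l2 = solve-∀ ACR

  _·M_ : Mat → Mat → Mat
  M ·M N = mat ((a M * a N) + (b M * c N)) ((a M * b N) + (b M * d N))
               ((c M * a N) + (d M * c N)) ((c M * b N) + (d M * d N))

  open import Algebra.Properties.AbelianGroup (CommutativeRing.+-abelianGroup CRing)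
    using (x∙y⁻¹≈ε⇒x≈y; ∙-cancelʳ)
  open IsCommutativeRing isCommutativeRing using (+-assoc; -‿inverseˡ; +-identityʳ)

  key : ∀ u v s t → u ≢ v → (u * t) + (v * s) ≡ (u * s) + (v * t) → t ≡ s
  key u v s t u≢v E = wt≡ws⇒ (∙-cancelʳ _ _ _ E')
    where
    open ≡-Reasoning
    w = u + (- v)
    w+v : w + v ≡ u
    w+v = trans (+-assoc u (- v) v) (trans (cong (u +_) (-‿inverseˡ v)) (+-identityʳ u))
    w≢0 : w ≢ 0#
    w≢0 e = u≢v (x∙y⁻¹≈ε⇒x≈y u v e)
    E' : (w * t) + ((v * t) + (v * s)) ≡ (w * s) + ((v * t) + (v * s))
    E' = begin
      (w * t) + ((v * t) + (v * s)) ≡⟨ sym (DL2.l1 w v t s) ⟩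
      ((w + v) * t) + (v * s)        ≡⟨ cong (λ z → (z * t) + (v * s)) w+v ⟩
      (u * t) + (v * s)              ≡⟨ E ⟩
      (u * s) + (v * t)              ≡⟨ cong (λ z → (z * s) + (v * t)) (sym w+v) ⟩
      ((w + v) * s) + (v * t)        ≡⟨ DL2.l2 w v t s ⟩
      (w * s) + ((v * t) + (v * s))  ∎
    wt≡ws⇒ : w * t ≡ w * s → t ≡ s
    wt≡ws⇒ e with inverse w w≢0
    ... | (w' , ww'≡1) = begin
      t              ≡⟨ sym (*-identityˡ t) ⟩
      1# * t         ≡⟨ cong (_* t) (sym ww'≡1) ⟩
      (w * w') * t   ≡⟨ cong (_* t) (*-comm w w') ⟩
      (w' * w) * t   ≡⟨ *-assoc w' w t ⟩
      w' * (w * t)   ≡⟨ cong (w' *_) e ⟩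
      w' * (w * s)   ≡⟨ sym (*-assoc w' w s) ⟩
      (w' * w) * s   ≡⟨ cong (_* s) (*-comm w' w) ⟩
      (w * w') * s   ≡⟨ cong (_* s) ww'≡1 ⟩
      1# * s         ≡⟨ *-identityˡ s ⟩
      s ∎

  Invertible : Mat → Set
  Invertible M = False ((a M * d M) ≟ (b M * c M))

  closed : ∀ M N → (a M * d M) ≢ (b M * c M) → (a N * d N) ≢ (b N * c N)
         → (a (M ·M N) * d (M ·M N)) ≢ (b (M ·M N) * c (M ·M N))
  closed (mat a b c d) (mat a' b' c' d') m n e =
    n (key (a * d) (b * c) (b' * c') (a' * d') m
        (sym (∙-cancelˡ _ _ _ (trans (DL.det-lemma' a b c d a' b' c' d') (cong (_+ (((a * d) * (a' * d')) + ((b * c) * (b' * c')))) (sym e))))))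
    where open import Algebra.Properties.AbelianGroup (CommutativeRing.+-abelianGroup CRing) using (∙-cancelˡ)

  -- GL₂(q): matrices with nonzero determinant (proof-irrelevant witness)
  GL : Set
  GL = Σ Mat Invertible

  _·_ : GL → GL → GL
  (M , p) · (N , r) = (M ·M N) , det-ok
    where
    det-ok : Invertible (M ·M N)
    det-ok = fromWitnessFalse (closed M N (toWitnessFalse p) (toWitnessFalse r))


  allMat : List Mat
  allMat = concatMap (λ x → concatMap (λ y → concatMap (λ z → map (λ w → mat x y z w)
             elems) elems) elems) elems

  toGL : Mat → Maybe GL
  toGL M with (a M * d M) ≟ (b M * c M)
  ... | yes _ = nothing
  ... | no p  = just (M , fromWitnessFalse p)

  allGL : List GL
  allGL = mapMaybe toGL allMat

  orderGL : ℕ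
  orderGL = length allGL

  Subset : Set
  Subset = GL → Bool

  countIn : Subset → List GL → ℕ
  countIn S []       = 0
  countIn S (g ∷ gs) with S g
  ... | true  = suc (countIn S gs)
  ... | false = countIn S gs

  ∣_∣ : Subset → ℕ
  ∣ S ∣ = countIn S allGL

-- The principal series representation V_{m,0} with coefficients in K:
-- ε is the fixed generator of F^×, ζ the primitive (q-1)-th root of unity
-- exp(2πi/(q-1)), so that μ_m(ε^j) = ζ^(m j).
module PrincipalSeries (F : FiniteField) (K : CharZeroField)
                       (ε : FiniteField.Carrier F) (ζ : CharZeroField.Carrier K)
                       (m : ℕ) where
  open GL2 F public
  private
    module F = FiniteField F
    module K = CharZeroField K

  -- f ∈ V_{m,0}:  f (u x) = μ_m(a) f(x)  for all upper triangular u = (a b ; 0 d)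
  InV : (GL → K.Carrier) → Set
  InV f = ∀ (u : GL) (j : ℕ) → c (proj₁ u) ≡ F.0# → a (proj₁ u) ≡ F._^_ ε j →
          ∀ (x : GL) → f (u · x) K.≈ (K._^_ ζ (m *ℕ j) K.* f x)

  β : GL → (GL → K.Carrier) → (GL → K.Carrier)
  β g f x = f (x · g)

  FixDim≥1 : GL → GL → Set
  FixDim≥1 g₁ g₂ = Σ (GL → K.Carrier) λ f →
    InV f × (∃ λ x → ¬ (f x K.≈ K.0#)) × (∀ x → β g₁ f x K.≈ β g₂ f x)

  CrossIntersecting : Subset → Subset → Set
  CrossIntersecting S₁ S₂ = ∀ g₁ g₂ → S₁ g₁ ≡ true → S₂ g₂ ≡ true → FixDim≥1 g₁ g₂

{-# OPTIONS --safe #-}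

-- Let M = {c | c ^ m = 1} and G' = {x | det x ∈ M}, and let η = ε ^ m, an element of order ℓ.  As ℓ is
-- odd and prime to m, GL₂ is the direct product of the scalars ⟨η⟩ and G', and η acts on V_{m,0} as a
-- primitive ℓ-th root of unity.
--
-- The pair (G' , G') is cross-intersecting: every g ∈ G' fixes the average over ⟨g⟩ of a translate of the
-- function supported on the Borel subgroup.  This average is nonzero if the translate is chosen along a
-- cyclic vector of g: a power of g in the Borel subgroup is then a scalar s with s² ∈ M, hence s ∈ M.
--
-- Conversely, if x , y ∈ G' agree on a nonzero vector then x⁻¹y has order dividing qm, which is prime to ℓ, so
-- η ^ i x and η ^ j y do not intersect for i ≠ j.  Let F(x), H(x) be the number of i with η ^ i x in S₁, S₂.
-- Then F(x) = 0 or H(y) = 0 or F(x) = H(y) = 1 whenever x , y ∈ G' agree on a nonzero vector.  The operator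
-- with kernel T(x , y) = #{v ≠ 0 | xv = yv} has row sums n = |G'| and norm at most n / (ℓ - 1) on functions of
-- sum zero, because it factors through the incidences xv = w and these are controlled by the Plancherel
-- identity for the Radon transform on the affine plane.  A Hoffman-type argument then gives ΣF · ΣH ≤ n².
module Submission where

open import Defs

-- Agreement on a nonzero vector is only a sufficient condition for the fibres to be tied together,
-- but weighting pairs by the number of such vectors turns the spectrum into a matter of counting
-- vectors, without the characters of GL₂. With κ = q·|M| the norm bound obtained is κ(2q - 1),
-- while n = κ(q² - 1). As q and ℓ are odd, m is even, so q ≥ 2ℓ + 1, and this yields (ℓ - 1)(2q -
-- 1) ≤ q² - 1.
--
-- The counts F, H are not indicators: they range over 0, ..., ℓ. The local inequality is therefore
-- 2st(ℓ - 1)F(x)H(y) ≤ s²F(x)(ℓ - F(x)) + t²H(y)(ℓ - H(y)), which is sharp at the extremal values F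
-- = H = 1, s = t. Its terms -F², -H² absorb the second moments produced by the norm bound n / (ℓ -
-- 1), so that only ΣF and ΣH survive.
--
-- All estimates stay in ℤ. Projections are multiplied by n, and Cauchy-Schwarz is replaced by AM-GM
-- with two free integers s, t; the discriminant is taken only at the end.

module CrossIntersection where
  open import Level using (0ℓ)
  open import Algebra.Bundles using (CommutativeMonoid; CommutativeRing; RawRing)
  open import Algebra.Solver.Ring.AlmostCommutativeRing using (_-Raw-AlmostCommutative⟶_; fromCommutativeRing)
  open import Data.Bool using (Bool; true; false)
  open import Data.Bool.Properties using (T-irrelevant)
  open import Data.Empty using (⊥; ⊥-elim)
  open import Data.Fin as Fin using (Fin; toℕ; fromℕ<)
  import Data.Fin.Properties as FinP
  open import Data.Integer as ℤ using (ℤ; +_; -[1+_]; _+_; _*_; _-_; -_; _≤_; _<_; 0ℤ; 1ℤ; +≤+)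
  import Data.Integer.Properties as ℤP
  open import Data.Integer.Tactic.RingSolver using (solve-∀)
  open import Data.List using (List; []; _∷_; _++_; length; concatMap; map; allFin; foldr; lookup; mapMaybe)
  open import Data.List.Properties using (length-tabulate)
  open import Data.List.Membership.Propositional using (_∈_)
  open import Data.List.Membership.Propositional.Properties using (∈-allFin; ∈-concatMap⁺; ∈-map⁺)
  open import Data.List.Membership.Propositional.Properties.WithK using (unique∧set⇒bag)
  open import Data.List.Relation.Binary.BagAndSetEquality using (∼bag⇒↭)
  open import Data.List.Relation.Binary.Permutation.Propositional using (_↭_; ↭⇒↭ₛ)
  open import Data.List.Relation.Binary.Permutation.Setoid.Properties using (foldr-commMonoid)
  open import Data.List.Relation.Unary.All using (All; []; _∷_)
  open import Data.List.Relation.Unary.AllPairs using ([]; _∷_)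
  open import Data.List.Relation.Unary.Any as Any using (here; there)
  open import Data.List.Relation.Unary.Any.Properties using (lookup-index)
  open import Data.List.Relation.Unary.Unique.Propositional using (Unique)
  open import Data.List.Relation.Unary.Unique.Propositional.Properties using (allFin⁺; map⁺)
  open import Data.Maybe using (Maybe; just; nothing)
  open import Data.Nat as ℕ using (ℕ; zero; suc; NonZero)
  import Data.Nat.Properties as ℕP
  open import Data.Nat.DivMod using (_%_; _/_; m≡m%n+[m/n]*n; m%n<n)
  open import Data.Nat.Divisibility using (_∣_; _∣?_; divides; ∣⇒≤; m∣m*n; n∣m*n; *-cancelʳ-∣; *-monoˡ-∣; ∣m+n∣m⇒∣n; ∣n⇒∣m*n; m%n≡0⇒n∣m; n∣m⇒m%n≡0)
  open import Data.Nat.Primality using (Prime; euclidsLemma; prime[2]; prime⇒nonTrivial; prime⇒nonZero)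
  open import Data.Nat.Solver using (module +-*-Solver)
  open import Data.Product using (_×_; _,_; proj₁; proj₂; ∃)
  open import Data.Sum using (_⊎_; inj₁; inj₂)
  open import Function.Bundles using (mk⇔)
  open import Relation.Nullary using (¬_; Dec; yes; no)
  open import Relation.Nullary.Decidable using (fromWitnessFalse; toWitnessFalse; isYes)
  open import Relation.Binary.PropositionalEquality using (_≡_; _≢_; refl; sym; trans; cong; cong₂; subst; subst₂; module ≡-Reasoning)

  -- Finite sums

  private variable
    Ω Ω′ : Set

  ∑ : List Ω → (Ω → ℤ) → ℤ
  ∑ []       f = 0ℤ
  ∑ (x ∷ xs) f = f x + ∑ xs f

  ∑-cong : ∀ (xs : List Ω) {f g : Ω → ℤ} → (∀ x → f x ≡ g x) → ∑ xs f ≡ ∑ xs g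
  ∑-cong []       e = refl
  ∑-cong (x ∷ xs) e = cong₂ _+_ (e x) (∑-cong xs e)

  ∑-0 : ∀ (xs : List Ω) → ∑ xs (λ _ → 0ℤ) ≡ 0ℤ
  ∑-0 []       = refl
  ∑-0 (x ∷ xs) = trans (ℤP.+-identityˡ _) (∑-0 xs)

  ∑-zero : ∀ (xs : List Ω) {f : Ω → ℤ} → (∀ x → f x ≡ 0ℤ) → ∑ xs f ≡ 0ℤ
  ∑-zero xs e = trans (∑-cong xs e) (∑-0 xs)

  ∑-+ : ∀ (xs : List Ω) (f g : Ω → ℤ) → ∑ xs (λ x → f x + g x) ≡ ∑ xs f + ∑ xs g
  ∑-+ []       f g = refl
  ∑-+ (x ∷ xs) f g = trans (cong (_+_ (f x + g x)) (∑-+ xs f g)) (interchange (f x) (g x) _ _)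
    where
    interchange : ∀ a b c d → (a + b) + (c + d) ≡ (a + c) + (b + d)
    interchange = solve-∀

  ∑-*ˡ : ∀ (xs : List Ω) c (f : Ω → ℤ) → ∑ xs (λ x → c * f x) ≡ c * ∑ xs f
  ∑-*ˡ []       c f = sym (ℤP.*-zeroʳ c)
  ∑-*ˡ (x ∷ xs) c f = trans (cong (_+_ (c * f x)) (∑-*ˡ xs c f)) (sym (ℤP.*-distribˡ-+ c (f x) _))

  ∑-*ʳ : ∀ (xs : List Ω) c (f : Ω → ℤ) → ∑ xs (λ x → f x * c) ≡ ∑ xs f * c
  ∑-*ʳ xs c f = trans (∑-cong xs (λ x → ℤP.*-comm (f x) c)) (trans (∑-*ˡ xs c f) (ℤP.*-comm c _))

  ∑-neg : ∀ (xs : List Ω) (f : Ω → ℤ) → ∑ xs (λ x → - f x) ≡ - ∑ xs f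
  ∑-neg []       f = refl
  ∑-neg (x ∷ xs) f = trans (cong (_+_ (- f x)) (∑-neg xs f)) (sym (ℤP.neg-distrib-+ (f x) (∑ xs f)))

  ∑-const : ∀ (xs : List Ω) c → ∑ xs (λ _ → c) ≡ + length xs * c
  ∑-const []       c = refl
  ∑-const (x ∷ xs) c = trans (cong (_+_ c) (∑-const xs c)) (sym (ℤP.suc-* (+ length xs) c))

  ∑-swap : ∀ (xs : List Ω) (ys : List Ω′) (f : Ω → Ω′ → ℤ) →
           ∑ xs (λ x → ∑ ys (f x)) ≡ ∑ ys (λ y → ∑ xs (λ x → f x y))
  ∑-swap []       ys f = sym (∑-0 ys)
  ∑-swap (x ∷ xs) ys f = trans (cong (_+_ (∑ ys (f x))) (∑-swap xs ys f)) (sym (∑-+ ys (f x) _))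

  ∑-*-∑ : ∀ (xs : List Ω) (ys : List Ω′) (f : Ω → ℤ) (g : Ω′ → ℤ) →
          ∑ xs f * ∑ ys g ≡ ∑ xs (λ x → ∑ ys (λ y → f x * g y))
  ∑-*-∑ xs ys f g = trans (sym (∑-*ʳ xs (∑ ys g) f)) (∑-cong xs (λ x → sym (∑-*ˡ ys (f x) g)))

  ∑-mono : ∀ (xs : List Ω) {f g : Ω → ℤ} → (∀ x → f x ≤ g x) → ∑ xs f ≤ ∑ xs g
  ∑-mono []       e = ℤP.≤-refl
  ∑-mono (x ∷ xs) e = ℤP.+-mono-≤ (e x) (∑-mono xs e)

  ∑-nonneg : ∀ (xs : List Ω) {f : Ω → ℤ} → (∀ x → 0ℤ ≤ f x) → 0ℤ ≤ ∑ xs f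
  ∑-nonneg xs e = ℤP.≤-trans (ℤP.≤-reflexive (sym (∑-0 xs))) (∑-mono xs e)

  ∑-++ : ∀ (xs ys : List Ω) (f : Ω → ℤ) → ∑ (xs ++ ys) f ≡ ∑ xs f + ∑ ys f
  ∑-++ []       ys f = sym (ℤP.+-identityˡ _)
  ∑-++ (x ∷ xs) ys f = trans (cong (_+_ (f x)) (∑-++ xs ys f)) (sym (ℤP.+-assoc (f x) _ _))

  ∑-map : ∀ (h : Ω → Ω′) (xs : List Ω) (f : Ω′ → ℤ) → ∑ (map h xs) f ≡ ∑ xs (λ x → f (h x))
  ∑-map h []       f = refl
  ∑-map h (x ∷ xs) f = cong (_+_ (f (h x))) (∑-map h xs f)

  ∑-concatMap : ∀ (h : Ω → List Ω′) (xs : List Ω) (f : Ω′ → ℤ) →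
                ∑ (concatMap h xs) f ≡ ∑ xs (λ x → ∑ (h x) f)
  ∑-concatMap h []       f = refl
  ∑-concatMap h (x ∷ xs) f = trans (∑-++ (h x) (concatMap h xs) f) (cong (_+_ (∑ (h x) f)) (∑-concatMap h xs f))

  𝟙 : {P : Set} → Dec P → ℤ
  𝟙 (yes _) = 1ℤ
  𝟙 (no _)  = 0ℤ

  𝟙-true : {P : Set} (d : Dec P) → P → 𝟙 d ≡ 1ℤ
  𝟙-true (yes _) p = refl
  𝟙-true (no ¬p) p = ⊥-elim (¬p p)

  𝟙-false : {P : Set} (d : Dec P) → ¬ P → 𝟙 d ≡ 0ℤ
  𝟙-false (yes p) ¬p = ⊥-elim (¬p p)
  𝟙-false (no _)  ¬p = refl

  𝟙-⇔ : {P Q : Set} (d : Dec P) (d' : Dec Q) → (P → Q) → (Q → P) → 𝟙 d ≡ 𝟙 d'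
  𝟙-⇔ (yes p) d' to from = sym (𝟙-true d' (to p))
  𝟙-⇔ (no ¬p) d' to from = sym (𝟙-false d' (λ q → ¬p (from q)))

  𝟙-× : {P Q R : Set} (d : Dec P) (d' : Dec Q) (e : Dec R) →
        (R → P) → (R → Q) → (P → Q → R) → 𝟙 d * 𝟙 d' ≡ 𝟙 e
  𝟙-× (yes p) (yes q) e r₁ r₂ pr = sym (𝟙-true e (pr p q))
  𝟙-× (yes p) (no ¬q) e r₁ r₂ pr = sym (𝟙-false e (λ r → ¬q (r₂ r)))
  𝟙-× (no ¬p) d'      e r₁ r₂ pr = sym (𝟙-false e (λ r → ¬p (r₁ r)))

  𝟙-guard : {P : Set} (d : Dec P) {a b : ℤ} → (P → a ≡ b) → 𝟙 d * a ≡ 𝟙 d * b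
  𝟙-guard (yes p) e = cong (1ℤ *_) (e p)
  𝟙-guard (no _)  e = refl

  𝟙-idem : {P : Set} (d : Dec P) → 𝟙 d * 𝟙 d ≡ 𝟙 d
  𝟙-idem (yes _) = refl
  𝟙-idem (no _)  = refl

  0≤𝟙 : {P : Set} (d : Dec P) → 0ℤ ≤ 𝟙 d
  0≤𝟙 (yes _) = +≤+ ℕ.z≤n
  0≤𝟙 (no _)  = +≤+ ℕ.z≤n

  -- A duplicate-free exhaustive list, expressed through the sums over it.
  record Enum (Ω : Set) : Set where
    open ≡-Reasoning
    field
      els   : List Ω
      _≟_   : (x y : Ω) → Dec (x ≡ y)
      sift₁ : ∀ x → ∑ els (λ y → 𝟙 (y ≟ x)) ≡ 1ℤ

    sift : ∀ x (f : Ω → ℤ) → ∑ els (λ y → 𝟙 (y ≟ x) * f y) ≡ f x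
    sift x f = begin
      ∑ els (λ y → 𝟙 (y ≟ x) * f y) ≡⟨ ∑-cong els (λ y → 𝟙-guard (y ≟ x) (cong f)) ⟩
      ∑ els (λ y → 𝟙 (y ≟ x) * f x) ≡⟨ ∑-*ʳ els (f x) _ ⟩
      ∑ els (λ y → 𝟙 (y ≟ x)) * f x ≡⟨ cong (_* f x) (sift₁ x) ⟩
      1ℤ * f x ≡⟨ ℤP.*-identityˡ (f x) ⟩
      f x ∎

    sift′ : ∀ x (f : Ω → ℤ) → ∑ els (λ y → 𝟙 (x ≟ y) * f y) ≡ f x
    sift′ x f = trans (∑-cong els (λ y → cong (_* f y) (𝟙-⇔ (x ≟ y) (y ≟ x) sym sym))) (sift x f)

  -- Expanding f (σ x) by sifting over the target and exchanging the sums lets `sift` collapse the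
  -- source, so no permutation of lists is involved.
  ∑-bijection : (E : Enum Ω) (E' : Enum Ω′) (σ : Ω → Ω′) (τ : Ω′ → Ω) →
                (∀ x → τ (σ x) ≡ x) → (∀ y → σ (τ y) ≡ y) → (f : Ω′ → ℤ) →
                ∑ (Enum.els E) (λ x → f (σ x)) ≡ ∑ (Enum.els E') f
  ∑-bijection E E' σ τ τσ στ f = begin
    ∑ xs (λ x → f (σ x)) ≡⟨ ∑-cong xs (λ x → E'.sift (σ x) f) ⟨
    ∑ xs (λ x → ∑ ys (λ y → 𝟙 (y E'.≟ σ x) * f y)) ≡⟨ ∑-swap xs ys _ ⟩
    ∑ ys (λ y → ∑ xs (λ x → 𝟙 (y E'.≟ σ x) * f y)) ≡⟨ ∑-cong ys (λ y → ∑-cong xs (λ x → cong (_* f y)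
                (𝟙-⇔ (y E'.≟ σ x) (x E.≟ τ y)
                (λ e → trans (sym (τσ x)) (cong τ (sym e)))
                (λ e → trans (sym (στ y)) (cong σ (sym e)))))) ⟩
    ∑ ys (λ y → ∑ xs (λ x → 𝟙 (x E.≟ τ y) * f y)) ≡⟨ ∑-cong ys (λ y → E.sift (τ y) (λ _ → f y)) ⟩
    ∑ ys f ∎
    where
    open ≡-Reasoning
    module E = Enum E
    module E' = Enum E'
    xs = E.els
    ys = E'.els

  ∑-unique : (xs : List Ω) (_≟_ : (x y : Ω) → Dec (x ≡ y)) → Unique xs → ∀ {x} → x ∈ xs →
             ∑ xs (λ y → 𝟙 (y ≟ x)) ≡ 1ℤ
  ∑-unique (x ∷ xs) _≟_ (x∉ ∷ u) (here refl) =
    cong₂ _+_ (𝟙-true (x ≟ x) refl) (absent xs x∉)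
    where
    absent : ∀ ys → All (x ≢_) ys → ∑ ys (λ y → 𝟙 (y ≟ x)) ≡ 0ℤ
    absent []       []       = refl
    absent (y ∷ ys) (n ∷ ns) = cong₂ _+_ (𝟙-false (y ≟ x) (λ e → n (sym e))) (absent ys ns)
  ∑-unique (x ∷ xs) _≟_ (x∉ ∷ u) {z} (there z∈) =
    cong₂ _+_ (𝟙-false (x ≟ z) (λ e → clash xs x∉ z∈ e)) (∑-unique xs _≟_ u z∈)
    where
    clash : ∀ ys → All (x ≢_) ys → z ∈ ys → ¬ (x ≡ z)
    clash (y ∷ ys) (n ∷ ns) (here refl) e = n e
    clash (y ∷ ys) (n ∷ ns) (there i)   e = clash ys ns i e

  -- The plane over a finite field

  -- Coefficients are integers acting through multiples of 1#, not field elements: their arithmetic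
  -- and their equality test compute even though `F` is abstract.
  module FieldSolver (F : FiniteField) where
    open GL2 F using (CRing)
    private module R = CommutativeRing CRing
    open import Algebra.Properties.Semiring.Mult R.semiring using (×-homo-+; ×1-homo-*) renaming (_×_ to _•_)
    open R using (0#; 1#) renaming (_+_ to _⊕_; _*_ to _⊗_; -_ to ⊖_)

    private
      val : ℕ × ℕ → R.Carrier
      val (a , b) = (a • 1#) ⊕ (⊖ (b • 1#))

      open ≡-Reasoning
      open import Algebra.Properties.Ring R.ring using (-‿distribˡ-*; -‿distribʳ-*; -‿involutive; -0#≈0#)
      open import Algebra.Properties.AbelianGroup R.+-abelianGroup using (⁻¹-∙-comm)
      open import Algebra.Properties.CommutativeSemigroup (CommutativeMonoid.commutativeSemigroup R.+-commutativeMonoid) using (interchange)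

      add : ∀ a b c d → (a ⊕ c) ⊕ (⊖ (b ⊕ d)) ≡ (a ⊕ (⊖ b)) ⊕ (c ⊕ (⊖ d))
      add a b c d = trans (cong (_⊕_ (a ⊕ c)) (sym (⁻¹-∙-comm b d))) (interchange a c (⊖ b) (⊖ d))

      mul : ∀ a b c d → ((a ⊗ c) ⊕ (b ⊗ d)) ⊕ (⊖ ((a ⊗ d) ⊕ (b ⊗ c))) ≡ (a ⊕ (⊖ b)) ⊗ (c ⊕ (⊖ d))
      mul a b c d = begin
        ((a ⊗ c) ⊕ (b ⊗ d)) ⊕ (⊖ ((a ⊗ d) ⊕ (b ⊗ c))) ≡⟨ add (a ⊗ c) (a ⊗ d) (b ⊗ d) (b ⊗ c) ⟩
        ((a ⊗ c) ⊕ (⊖ (a ⊗ d))) ⊕ ((b ⊗ d) ⊕ (⊖ (b ⊗ c))) ≡⟨ cong₂ _⊕_ (minus a c d) (trans (minus b d c) (flip b c d)) ⟩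
        (a ⊗ (c ⊕ (⊖ d))) ⊕ ((⊖ b) ⊗ (c ⊕ (⊖ d))) ≡⟨ R.distribʳ _ a (⊖ b) ⟨
        (a ⊕ (⊖ b)) ⊗ (c ⊕ (⊖ d)) ∎
        where
        minus : ∀ x y z → (x ⊗ y) ⊕ (⊖ (x ⊗ z)) ≡ x ⊗ (y ⊕ (⊖ z))
        minus x y z = trans (cong (_⊕_ (x ⊗ y)) (-‿distribʳ-* x z)) (sym (R.distribˡ x y (⊖ z)))
        flip : ∀ x y z → x ⊗ (z ⊕ (⊖ y)) ≡ (⊖ x) ⊗ (y ⊕ (⊖ z))
        flip x y z = begin
          x ⊗ (z ⊕ (⊖ y)) ≡⟨ cong (x ⊗_) (neg y z) ⟩
          x ⊗ (⊖ (y ⊕ (⊖ z))) ≡⟨ -‿distribʳ-* x _ ⟨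
          ⊖ (x ⊗ (y ⊕ (⊖ z))) ≡⟨ -‿distribˡ-* x _ ⟩
          (⊖ x) ⊗ (y ⊕ (⊖ z)) ∎
          where
          neg : ∀ y z → z ⊕ (⊖ y) ≡ ⊖ (y ⊕ (⊖ z))
          neg y z = trans (R.+-comm z (⊖ y)) (trans (cong (_⊕_ (⊖ y)) (sym (-‿involutive z))) (⁻¹-∙-comm y (⊖ z)))

      -- Integers as formal differences (a , b) = a − b, reduced so that equal coefficients are identical.
      reduce : ℕ × ℕ → ℕ × ℕ
      reduce (ℕ.suc a , ℕ.suc b) = reduce (a , b)
      reduce x                   = x

      Coeff : RawRing 0ℓ 0ℓ
      Coeff = record
        { Carrier = ℕ × ℕ
        ; _≈_ = _≡_
        ; _+_ = λ (a , b) (c , d) → reduce ((a ℕ.+ c) , (b ℕ.+ d))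
        ; _*_ = λ (a , b) (c , d) → reduce ((a ℕ.* c ℕ.+ b ℕ.* d) , (a ℕ.* d ℕ.+ b ℕ.* c))
        ; -_ = λ (a , b) → b , a
        ; 0# = 0 , 0
        ; 1# = 1 , 0
        }

      -- Special-cased so that the constants 0 and 1 evaluate to 0# and 1# on the nose.
      ⟦_⟧ : ℕ × ℕ → R.Carrier
      ⟦ 0 , 0 ⟧ = 0#
      ⟦ 1 , 0 ⟧ = 1#
      ⟦ x ⟧     = val x

      ⟦⟧≡val : ∀ x → ⟦ x ⟧ ≡ val x
      ⟦⟧≡val (0 , 0)           = sym (R.-‿inverseʳ 0#)
      ⟦⟧≡val (1 , 0)           = sym (trans (cong₂ _⊕_ (R.+-identityʳ 1#) -0#≈0#) (R.+-identityʳ 1#))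
      ⟦⟧≡val (0 , ℕ.suc b)     = refl
      ⟦⟧≡val (1 , ℕ.suc b)     = refl
      ⟦⟧≡val (ℕ.suc (ℕ.suc a) , b) = refl

      cancel : ∀ x y x' y' → x ⊕ y' ≡ x' ⊕ y → x ⊕ (⊖ y) ≡ x' ⊕ (⊖ y')
      cancel x y x' y' e = begin
        x ⊕ (⊖ y) ≡⟨ R.+-identityʳ _ ⟨
        (x ⊕ (⊖ y)) ⊕ 0# ≡⟨ cong (_⊕_ (x ⊕ (⊖ y))) (R.-‿inverseʳ y') ⟨
        (x ⊕ (⊖ y)) ⊕ (y' ⊕ (⊖ y')) ≡⟨ interchange x (⊖ y) y' (⊖ y') ⟩
        (x ⊕ y') ⊕ ((⊖ y) ⊕ (⊖ y')) ≡⟨ cong (_⊕ ((⊖ y) ⊕ (⊖ y'))) e ⟩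
        (x' ⊕ y) ⊕ ((⊖ y) ⊕ (⊖ y')) ≡⟨ R.+-assoc x' y _ ⟩
        x' ⊕ (y ⊕ ((⊖ y) ⊕ (⊖ y'))) ≡⟨ cong (_⊕_ x') (R.+-assoc y (⊖ y) (⊖ y')) ⟨
        x' ⊕ ((y ⊕ (⊖ y)) ⊕ (⊖ y')) ≡⟨ cong (λ z → x' ⊕ (z ⊕ (⊖ y'))) (R.-‿inverseʳ y) ⟩
        x' ⊕ (0# ⊕ (⊖ y')) ≡⟨ cong (_⊕_ x') (R.+-identityˡ _) ⟩
        x' ⊕ (⊖ y') ∎

      ⟦reduce⟧ : ∀ x → ⟦ reduce x ⟧ ≡ val x
      ⟦reduce⟧ (ℕ.suc a , ℕ.suc b) = trans (⟦reduce⟧ (a , b)) (cancel (a • 1#) (b • 1#) (1# ⊕ (a • 1#)) (1# ⊕ (b • 1#))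
        (trans (sym (R.+-assoc (a • 1#) 1# (b • 1#))) (cong (_⊕ (b • 1#)) (R.+-comm (a • 1#) 1#))))
      ⟦reduce⟧ (ℕ.zero , b)        = ⟦⟧≡val (0 , b)
      ⟦reduce⟧ (ℕ.suc a , ℕ.zero)  = ⟦⟧≡val (ℕ.suc a , 0)

      morphism : Coeff -Raw-AlmostCommutative⟶ fromCommutativeRing CRing
      morphism = record
        { ⟦_⟧ = ⟦_⟧
        ; +-homo = λ x@(a , b) y@(c , d) → trans (⟦reduce⟧ ((a ℕ.+ c) , (b ℕ.+ d))) (trans
            (trans (cong₂ (λ x y → x ⊕ (⊖ y)) (×-homo-+ 1# a c) (×-homo-+ 1# b d)) (add (a • 1#) (b • 1#) (c • 1#) (d • 1#)))
            (sym (cong₂ _⊕_ (⟦⟧≡val x) (⟦⟧≡val y))))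
        ; *-homo = λ x@(a , b) y@(c , d) → trans (⟦reduce⟧ ((a ℕ.* c ℕ.+ b ℕ.* d) , (a ℕ.* d ℕ.+ b ℕ.* c))) (trans
            (trans (cong₂ (λ x y → x ⊕ (⊖ y)) (homo₂ a c b d) (homo₂ a d b c)) (mul (a • 1#) (b • 1#) (c • 1#) (d • 1#)))
            (sym (cong₂ _⊗_ (⟦⟧≡val x) (⟦⟧≡val y))))
        ; -‿homo = λ x@(a , b) → trans (⟦⟧≡val (b , a)) (trans
            (trans (R.+-comm _ _) (trans (cong (_⊕_ (⊖ (a • 1#))) (sym (-‿involutive _))) (⁻¹-∙-comm _ _)))
            (sym (cong ⊖_ (⟦⟧≡val x))))
        ; 0-homo = refl
        ; 1-homo = refl
        }
        where
        homo₂ : ∀ a b c d → (a ℕ.* b ℕ.+ c ℕ.* d) • 1# ≡ ((a • 1#) ⊗ (b • 1#)) ⊕ ((c • 1#) ⊗ (d • 1#))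
        homo₂ a b c d = trans (×-homo-+ 1# (a ℕ.* b) (c ℕ.* d)) (cong₂ _⊕_ (×1-homo-* a b) (×1-homo-* c d))

      _coeff≟_ : (x y : ℕ × ℕ) → Maybe (⟦ x ⟧ ≡ ⟦ y ⟧)
      x@(a , b) coeff≟ y@(c , d) with (a ℕ.+ d) ℕ.≟ (c ℕ.+ b)
      ... | yes e = just (trans (⟦⟧≡val x) (trans (cancel (a • 1#) (b • 1#) (c • 1#) (d • 1#)
                (trans (sym (×-homo-+ 1# a d)) (trans (cong (_• 1#) e) (×-homo-+ 1# c b)))) (sym (⟦⟧≡val y))))
      ... | no _  = nothing

    open import Algebra.Solver.Ring Coeff (fromCommutativeRing CRing) morphism _coeff≟_ public
      using (Polynomial; solve; _:=_; _:+_; _:*_; :-_; con)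

    :1 : ∀ {n} → Polynomial n
    :1 = con (1 , 0)

  module Plane (F : FiniteField) where
    open FiniteField F using (Carrier; 0#; 1#; elems; order; elems-unique; elems-complete; inverse; 0≢1)
      renaming (_+_ to _⊕_; _*_ to _⊗_; -_ to ⊖_; _≟_ to _≟F_) public
    open GL2 F using (CRing; Mat; mat; allMat)
    open FieldSolver F public
    module R = CommutativeRing CRing
    open ≡-Reasoning

    V : Set
    V = Carrier × Carrier

    𝟘 : V
    𝟘 = 0# , 0#

    _∙_ : V → V → Carrier
    (a , b) ∙ (c , d) = (a ⊗ c) ⊕ (b ⊗ d)

    wedge : V → V → Carrier
    wedge (a , b) (c , d) = (a ⊗ d) ⊕ (⊖ (b ⊗ c))

    rows : V → V → Mat
    rows (a , b) (c , d) = mat a b c d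

    row₁ row₂ : Mat → V
    row₁ (mat a b c d) = a , b
    row₂ (mat a b c d) = c , d

    det : Mat → Carrier
    det M = wedge (row₁ M) (row₂ M)

    _▹_ : Mat → V → V
    M ▹ v = (row₁ M ∙ v) , (row₂ M ∙ v)

    _≟V_ : (v w : V) → Dec (v ≡ w)
    (a , b) ≟V (c , d) with a ≟F c | b ≟F d
    ... | yes refl | yes refl = yes refl
    ... | no a≢c   | _        = no λ { refl → a≢c refl }
    ... | yes _    | no b≢d   = no λ { refl → b≢d refl }

    _≟M_ : (M N : Mat) → Dec (M ≡ N)
    mat a b c d ≟M mat a' b' c' d' with (a , b) ≟V (a' , b') | (c , d) ≟V (c' , d')
    ... | yes refl | yes refl = yes refl
    ... | no ≢₁    | _        = no λ { refl → ≢₁ refl }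
    ... | yes _    | no ≢₂    = no λ { refl → ≢₂ refl }

    q : ℤ
    q = + order

    Vs : List V
    Vs = concatMap (λ x → map (x ,_) elems) elems

    ∑V-expand : ∀ f → ∑ Vs f ≡ ∑ elems (λ x → ∑ elems (λ y → f (x , y)))
    ∑V-expand f = trans (∑-concatMap _ elems f) (∑-cong elems (λ x → ∑-map (x ,_) elems f))

    ∑M-expand : ∀ f → ∑ allMat f ≡ ∑ Vs (λ r → ∑ Vs (λ s → f (rows r s)))
    ∑M-expand f = begin
      ∑ allMat f
        ≡⟨ trans (∑-concatMap _ elems f) (∑-cong elems (λ x →
           trans (∑-concatMap _ elems f) (∑-cong elems (λ y →
           trans (∑-concatMap _ elems f) (∑-cong elems (λ z → ∑-map _ elems f)))))) ⟩
      ∑ elems (λ x → ∑ elems (λ y → ∑ elems (λ z → ∑ elems (λ w → f (mat x y z w)))))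
        ≡⟨ ∑-cong elems (λ x → ∑-cong elems (λ y → ∑V-expand (λ s → f (rows (x , y) s)))) ⟨
      ∑ elems (λ x → ∑ elems (λ y → ∑ Vs (λ s → f (rows (x , y) s))))
        ≡⟨ ∑V-expand _ ⟨
      ∑ Vs (λ r → ∑ Vs (λ s → f (rows r s))) ∎

    EF : Enum Carrier
    EF = record { els = elems ; _≟_ = _≟F_ ; sift₁ = λ x → ∑-unique elems _≟F_ elems-unique (elems-complete x) }

    EV : Enum V
    EV = record { els = Vs ; _≟_ = _≟V_ ; sift₁ = λ (x , y) → begin
      ∑ Vs (λ v → 𝟙 (v ≟V (x , y)))
        ≡⟨ ∑V-expand _ ⟩
      ∑ elems (λ a → ∑ elems (λ b → 𝟙 ((a , b) ≟V (x , y))))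
        ≡⟨ ∑-cong elems (λ a → ∑-cong elems (λ b →
             𝟙-× (a ≟F x) (b ≟F y) ((a , b) ≟V (x , y)) (cong proj₁) (cong proj₂) (cong₂ _,_))) ⟨
      ∑ elems (λ a → ∑ elems (λ b → 𝟙 (a ≟F x) * 𝟙 (b ≟F y)))
        ≡⟨ ∑-*-∑ elems elems _ _ ⟨
      ∑ elems (λ a → 𝟙 (a ≟F x)) * ∑ elems (λ b → 𝟙 (b ≟F y))
        ≡⟨ cong₂ _*_ (Enum.sift₁ EF x) (Enum.sift₁ EF y) ⟩
      1ℤ ∎ }

    EM : Enum Mat
    EM = record { els = allMat ; _≟_ = _≟M_ ; sift₁ = λ M → begin
      ∑ allMat (λ N → 𝟙 (N ≟M M))
        ≡⟨ ∑M-expand _ ⟩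
      ∑ Vs (λ r → ∑ Vs (λ s → 𝟙 (rows r s ≟M M)))
        ≡⟨ ∑-cong Vs (λ r → ∑-cong Vs (λ s →
             𝟙-× (r ≟V row₁ M) (s ≟V row₂ M) (rows r s ≟M M) (cong row₁) (cong row₂) (cong₂ rows))) ⟨
      ∑ Vs (λ r → ∑ Vs (λ s → 𝟙 (r ≟V row₁ M) * 𝟙 (s ≟V row₂ M)))
        ≡⟨ ∑-*-∑ Vs Vs _ _ ⟨
      ∑ Vs (λ r → 𝟙 (r ≟V row₁ M)) * ∑ Vs (λ s → 𝟙 (s ≟V row₂ M))
        ≡⟨ cong₂ _*_ (Enum.sift₁ EV (row₁ M)) (Enum.sift₁ EV (row₂ M)) ⟩
      1ℤ ∎ }

    ∑V-const : ∀ c → ∑ Vs (λ _ → c) ≡ q * q * c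
    ∑V-const c = begin
      ∑ Vs (λ _ → c) ≡⟨ ∑V-expand _ ⟩
      ∑ elems (λ _ → ∑ elems (λ _ → c)) ≡⟨ ∑-const elems _ ⟩
      q * ∑ elems (λ _ → c) ≡⟨ cong (q *_) (∑-const elems c) ⟩
      q * (q * c) ≡⟨ ℤP.*-assoc q q c ⟨
      q * q * c ∎

    unit-cancel : ∀ {u u'} x → u ⊗ u' ≡ 1# → (u ⊗ u') ⊗ x ≡ x
    unit-cancel x e = trans (cong (_⊗ x) e) (R.*-identityˡ x)

    -- For independent p, p' the map `σ` is a linear bijection of the plane; its inverse `τ` is
    -- Cramer's rule.
    ∑-basis : ∀ p p' → wedge p p' ≢ 0# → (f : V → ℤ) → ∑ Vs (λ r → f ((r ∙ p) , (r ∙ p'))) ≡ ∑ Vs f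
    ∑-basis (p , p₂) (p' , p₂') δ≢0 = ∑-bijection EV EV σ τ τσ στ
      where
      δ = wedge (p , p₂) (p' , p₂')
      κ = proj₁ (inverse δ δ≢0)
      δκ : δ ⊗ κ ≡ 1#
      δκ = proj₂ (inverse δ δ≢0)
      σ τ : V → V
      σ r = (r ∙ (p , p₂)) , (r ∙ (p' , p₂'))
      τ (s , t) = (((s ⊗ p₂') ⊕ (⊖ (t ⊗ p₂))) ⊗ κ) , (((t ⊗ p) ⊕ (⊖ (s ⊗ p'))) ⊗ κ)
      τσ : ∀ r → τ (σ r) ≡ r
      τσ (x , y) = cong₂ _,_
        (trans (solve 7 (λ x y a b c d k → (((((x :* a) :+ (y :* b)) :* d) :+ (:- (((x :* c) :+ (y :* d)) :* b))) :* k)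
                := (((a :* d) :+ (:- (b :* c))) :* k) :* x) refl x y p p₂ p' p₂' κ) (unit-cancel x δκ))
        (trans (solve 7 (λ x y a b c d k → (((((x :* c) :+ (y :* d)) :* a) :+ (:- (((x :* a) :+ (y :* b)) :* c))) :* k)
                := (((a :* d) :+ (:- (b :* c))) :* k) :* y) refl x y p p₂ p' p₂' κ) (unit-cancel y δκ))
      στ : ∀ s → σ (τ s) ≡ s
      στ (s , t) = cong₂ _,_
        (trans (solve 7 (λ s t a b c d k → ((((s :* d) :+ (:- (t :* b))) :* k) :* a) :+ ((((t :* a) :+ (:- (s :* c))) :* k) :* b)
                := (((a :* d) :+ (:- (b :* c))) :* k) :* s) refl s t p p₂ p' p₂' κ) (unit-cancel s δκ))
        (trans (solve 7 (λ s t a b c d k → ((((s :* d) :+ (:- (t :* b))) :* k) :* c) :+ ((((t :* a) :+ (:- (s :* c))) :* k) :* d)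
                := (((a :* d) :+ (:- (b :* c))) :* k) :* t) refl s t p p₂ p' p₂' κ) (unit-cancel t δκ))

    -- A matrix is determined by the images of two independent vectors, and these are arbitrary.
    -- `∑-basis` treats each row separately and yields the coordinates row by row; exchanging the
    -- two middle sums regroups them into the columns w and w'.
    ∑-columns : ∀ v v' → wedge v v' ≢ 0# → (f : V → V → ℤ) →
                ∑ allMat (λ x → f (x ▹ v) (x ▹ v')) ≡ ∑ Vs (λ w → ∑ Vs (f w))
    ∑-columns v v' δ≢0 f = begin
      ∑ allMat (λ x → f (x ▹ v) (x ▹ v'))
        ≡⟨ ∑M-expand _ ⟩
      ∑ Vs (λ r → ∑ Vs (λ r' → f ((r ∙ v) , (r' ∙ v)) ((r ∙ v') , (r' ∙ v'))))
        ≡⟨ ∑-cong Vs (λ r → ∑-basis v v' δ≢0 (λ (s' , t') → f ((r ∙ v) , s') ((r ∙ v') , t'))) ⟩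
      ∑ Vs (λ r → ∑ Vs (λ (s' , t') → f ((r ∙ v) , s') ((r ∙ v') , t')))
        ≡⟨ ∑-basis v v' δ≢0 (λ (s , t) → ∑ Vs (λ (s' , t') → f (s , s') (t , t'))) ⟩
      ∑ Vs (λ (s , t) → ∑ Vs (λ (s' , t') → f (s , s') (t , t')))
        ≡⟨ trans (∑V-expand _) (∑-cong elems (λ s → ∑-cong elems (λ t → ∑V-expand _))) ⟩
      ∑ elems (λ s → ∑ elems (λ t → ∑ elems (λ s' → ∑ elems (λ t' → f (s , s') (t , t')))))
        ≡⟨ ∑-cong elems (λ s → ∑-swap elems elems _) ⟩
      ∑ elems (λ s → ∑ elems (λ s' → ∑ elems (λ t → ∑ elems (λ t' → f (s , s') (t , t')))))
        ≡⟨ trans (∑V-expand _) (∑-cong elems (λ s → ∑-cong elems (λ t → ∑V-expand _))) ⟨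
      ∑ Vs (λ w → ∑ Vs (f w)) ∎

    wedge-▹ : ∀ x v v' → wedge (x ▹ v) (x ▹ v') ≡ det x ⊗ wedge v v'
    wedge-▹ (mat a b c d) (v , v₂) (v' , v₂') =
      solve 8 (λ a b c d v w v' w' →
        (((a :* v) :+ (b :* w)) :* ((c :* v') :+ (d :* w'))) :+ (:- (((c :* v) :+ (d :* w)) :* ((a :* v') :+ (b :* w'))))
        := ((a :* d) :+ (:- (b :* c))) :* ((v :* w') :+ (:- (w :* v')))) refl a b c d v v₂ v' v₂'

    ∙-comm : ∀ v w → v ∙ w ≡ w ∙ v
    ∙-comm (a , b) (c , d) = cong₂ _⊕_ (R.*-comm a c) (R.*-comm b d)

    ∑-▹ : ∀ x → det x ≢ 0# → (f : V → ℤ) → ∑ Vs (λ v → f (x ▹ v)) ≡ ∑ Vs f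
    ∑-▹ x δ≢0 f = trans (∑-cong Vs (λ v → cong f (cong₂ _,_ (∙-comm (row₁ x) v) (∙-comm (row₂ x) v))))
                (∑-basis (row₁ x) (row₂ x) δ≢0 f)

    ⊗-zero : ∀ x y → x ⊗ y ≡ 0# → (x ≡ 0#) ⊎ (y ≡ 0#)
    ⊗-zero x y xy≡0 with x ≟F 0#
    ... | yes x≡0 = inj₁ x≡0
    ... | no x≢0  = inj₂ (begin
      y ≡⟨ unit-cancel y (proj₂ (inverse x x≢0)) ⟨
      (x ⊗ x⁻¹) ⊗ y ≡⟨ solve 3 (λ x x⁻¹ y → (x :* x⁻¹) :* y := (x :* y) :* x⁻¹) refl x x⁻¹ y ⟩
      (x ⊗ y) ⊗ x⁻¹ ≡⟨ cong (_⊗ x⁻¹) xy≡0 ⟩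
      0# ⊗ x⁻¹ ≡⟨ R.zeroˡ x⁻¹ ⟩
      0# ∎)
      where x⁻¹ = proj₁ (inverse x x≢0)

    ⊗-≢0 : ∀ {x y} → x ≢ 0# → y ≢ 0# → x ⊗ y ≢ 0#
    ⊗-≢0 {x} {y} x≢0 y≢0 e with ⊗-zero x y e
    ... | inj₁ x≡0 = x≢0 x≡0
    ... | inj₂ y≡0 = y≢0 y≡0

    ⊗-cancelʳ : ∀ x y z → z ≢ 0# → x ⊗ z ≡ y ⊗ z → x ≡ y
    ⊗-cancelʳ x y z z≢0 e with ⊗-zero (x ⊕ (⊖ y)) z (begin
        (x ⊕ (⊖ y)) ⊗ z ≡⟨ solve 3 (λ x y z → (x :+ (:- y)) :* z := (x :* z) :+ (:- (y :* z))) refl x y z ⟩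
        (x ⊗ z) ⊕ (⊖ (y ⊗ z)) ≡⟨ cong (λ t → t ⊕ (⊖ (y ⊗ z))) e ⟩
        (y ⊗ z) ⊕ (⊖ (y ⊗ z)) ≡⟨ R.-‿inverseʳ _ ⟩
        0# ∎)
    ... | inj₁ d = x∙y⁻¹≈ε⇒x≈y x y d
      where open import Algebra.Properties.AbelianGroup R.+-abelianGroup using (x∙y⁻¹≈ε⇒x≈y)
    ... | inj₂ z≡0 = ⊥-elim (z≢0 z≡0)

    complement : ∀ p → p ≢ 𝟘 → ∃ λ p' → wedge p p' ≢ 0#
    complement (a , b) p≢0 with a ≟F 0#
    ... | no a≢0 = (0# , 1#) , λ e → a≢0 (begin
        a ≡⟨ R.*-identityʳ a ⟨
        a ⊗ 1# ≡⟨ solve 3 (λ a b o → a :* o := ((a :* o) :+ (:- (b :* (o :+ (:- o))))) ) refl a b 1# ⟩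
        (a ⊗ 1#) ⊕ (⊖ (b ⊗ (1# ⊕ (⊖ 1#)))) ≡⟨ cong (λ z → (a ⊗ 1#) ⊕ (⊖ (b ⊗ z))) (R.-‿inverseʳ 1#) ⟩
        (a ⊗ 1#) ⊕ (⊖ (b ⊗ 0#)) ≡⟨ e ⟩
        0# ∎)
    ... | yes refl = (1# , 0#) , λ e → p≢0 (cong (0# ,_) (begin
        b ≡⟨ R.*-identityʳ b ⟨
        b ⊗ 1# ≡⟨ solve 2 (λ z w → w := (z :+ (:- (z :+ (:- w))))) refl (0# ⊗ 0#) (b ⊗ 1#) ⟩
        (0# ⊗ 0#) ⊕ (⊖ (wedge (0# , b) (1# , 0#))) ≡⟨ cong (λ z → (0# ⊗ 0#) ⊕ (⊖ z)) e ⟩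
        (0# ⊗ 0#) ⊕ (⊖ 0#) ≡⟨ cong (_⊕ (⊖ 0#)) (R.zeroˡ 0#) ⟩
        0# ⊕ (⊖ 0#) ≡⟨ R.-‿inverseʳ 0# ⟩
        0# ∎))

    -- Completing p to a basis turns this line into a coordinate line.
    ∑-line : ∀ p c → p ≢ 𝟘 → ∑ Vs (λ r → 𝟙 ((r ∙ p) ≟F c)) ≡ q
    ∑-line p c p≢0 = begin
      ∑ Vs (λ r → 𝟙 ((r ∙ p) ≟F c)) ≡⟨ ∑-basis p (proj₁ (complement p p≢0)) (proj₂ (complement p p≢0)) (λ (s , _) → 𝟙 (s ≟F c)) ⟩
      ∑ Vs (λ (s , _) → 𝟙 (s ≟F c)) ≡⟨ ∑V-expand _ ⟩
      ∑ elems (λ s → ∑ elems (λ _ → 𝟙 (s ≟F c))) ≡⟨ ∑-swap elems elems _ ⟩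
      ∑ elems (λ _ → ∑ elems (λ s → 𝟙 (s ≟F c))) ≡⟨ ∑-cong elems (λ _ → Enum.sift₁ EF c) ⟩
      ∑ elems (λ _ → 1ℤ) ≡⟨ ∑-const elems 1ℤ ⟩
      q * 1ℤ ≡⟨ ℤP.*-identityʳ q ⟩
      q ∎

    ∑-scale : ∀ c → c ≢ 0# → (f : Carrier → ℤ) → ∑ elems (λ τ → f (c ⊗ τ)) ≡ ∑ elems f
    ∑-scale c c≢0 = ∑-bijection EF EF (c ⊗_) (c⁻¹ ⊗_)
      (λ x → trans (solve 3 (λ c d x → d :* (c :* x) := (c :* d) :* x) refl c c⁻¹ x) (unit-cancel x cc⁻¹))
      (λ x → trans (solve 3 (λ c d x → c :* (d :* x) := (c :* d) :* x) refl c c⁻¹ x) (unit-cancel x cc⁻¹))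
      where
      c⁻¹ = proj₁ (inverse c c≢0)
      cc⁻¹ = proj₂ (inverse c c≢0)

    wedge-𝟘 : ∀ w → wedge 𝟘 w ≡ 0#
    wedge-𝟘 (a , b) = trans (cong₂ (λ x y → x ⊕ (⊖ y)) (R.zeroˡ b) (R.zeroˡ a)) (R.-‿inverseʳ 0#)

    ▹-≢𝟘 : ∀ x v → det x ≢ 0# → v ≢ 𝟘 → x ▹ v ≢ 𝟘
    ▹-≢𝟘 x v det≢0 v≢0 e = ⊗-≢0 det≢0 (proj₂ (complement v v≢0))
      (trans (sym (wedge-▹ x v v')) (trans (cong (λ w → wedge w (x ▹ v')) e) (wedge-𝟘 (x ▹ v'))))
      where v' = proj₁ (complement v v≢0)

    ▹-𝟘 : ∀ x → x ▹ 𝟘 ≡ 𝟘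
    ▹-𝟘 x = cong₂ _,_ (dot (row₁ x)) (dot (row₂ x))
      where
      dot : ∀ r → r ∙ 𝟘 ≡ 0#
      dot (a , b) = trans (cong₂ _⊕_ (R.zeroʳ a) (R.zeroʳ b)) (R.+-identityʳ 0#)

  -- Elementary integer inequalities

  2ℤ : ℤ
  2ℤ = + 2

  *-mono-≤-0≤ : ∀ {c a b} → 0ℤ ≤ c → a ≤ b → c * a ≤ c * b
  *-mono-≤-0≤ {+ c} _ a≤b = ℤP.*-monoˡ-≤-nonNeg (+ c) a≤b

  0≤² : ∀ x → 0ℤ ≤ x * x
  0≤² (+ n)    = ℤP.≤-trans (ℤP.≤-reflexive (sym (ℤP.*-zeroʳ (+ n)))) (ℤP.*-monoˡ-≤-nonNeg (+ n) (+≤+ ℕ.z≤n))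
  0≤² -[1+ n ] = +≤+ ℕ.z≤n

  0≤-* : ∀ {a b} → 0ℤ ≤ a → 0ℤ ≤ b → 0ℤ ≤ a * b
  0≤-* {a} {b} 0≤a 0≤b = ℤP.≤-trans (ℤP.≤-reflexive (sym (ℤP.*-zeroʳ a))) (*-mono-≤-0≤ 0≤a 0≤b)

  2xy≤x²+y² : ∀ x y → 2ℤ * (x * y) ≤ x * x + y * y
  2xy≤x²+y² x y = ℤP.0≤i-j⇒j≤i (subst (0ℤ ≤_) (identity x y) (0≤² (x - y)))
    where
    identity : ∀ x y → (x - y) * (x - y) ≡ x * x + y * y - + 2 * (x * y)
    identity = solve-∀

  -- The Radon transform on the affine plane

  module Radon (F : FiniteField) where
    open Plane F
    open ≡-Reasoning

    -- The solutions r of r ∙ (p - p') = 0 form a line with q points, or the whole plane if p = p'.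
    ∑-agree : ∀ p p' → ∑ Vs (λ r → 𝟙 ((r ∙ p) ≟F (r ∙ p'))) ≡ q + (q * q - q) * 𝟙 (p ≟V p')
    ∑-agree p@(a , b) p'@(a' , b') with p ≟V p'
    ... | yes refl = trans (∑-cong Vs (λ r → 𝟙-true ((r ∙ p) ≟F (r ∙ p)) refl)) (trans (∑V-const 1ℤ) (id₁ q))
      where
      id₁ : ∀ x → x * x * 1ℤ ≡ x + (x * x - x) * 1ℤ
      id₁ = solve-∀
    ... | no p≢p' = begin
      ∑ Vs (λ r → 𝟙 ((r ∙ p) ≟F (r ∙ p'))) ≡⟨ ∑-cong Vs (λ r → 𝟙-⇔ ((r ∙ p) ≟F (r ∙ p')) ((r ∙ d) ≟F 0#)
                (λ e → trans (split r) (trans (cong (λ z → (r ∙ p) ⊕ (⊖ z)) (sym e)) (R.-‿inverseʳ _)))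
                (λ e → x∙y⁻¹≈ε⇒x≈y _ _ (trans (sym (split r)) e))) ⟩
      ∑ Vs (λ r → 𝟙 ((r ∙ d) ≟F 0#)) ≡⟨ ∑-line d 0# (λ e → p≢p' (cong₂ _,_ (x∙y⁻¹≈ε⇒x≈y a a' (cong proj₁ e)) (x∙y⁻¹≈ε⇒x≈y b b' (cong proj₂ e)))) ⟩
      q ≡⟨ id₀ q ⟩
      q + (q * q - q) * 0ℤ ∎
      where
      open import Algebra.Properties.AbelianGroup R.+-abelianGroup using (x∙y⁻¹≈ε⇒x≈y)
      id₀ : ∀ x → x ≡ x + (x * x - x) * 0ℤ
      id₀ = solve-∀
      d : V
      d = (a ⊕ (⊖ a')) , (b ⊕ (⊖ b'))
      split : ∀ r → r ∙ d ≡ (r ∙ p) ⊕ (⊖ (r ∙ p'))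
      split (x , y) = solve 6 (λ x y a b a' b' → (x :* (a :+ (:- a'))) :+ (y :* (b :+ (:- b')))
                := ((x :* a) :+ (y :* b)) :+ (:- ((x :* a') :+ (y :* b')))) refl x y a b a' b'

    -- Plancherel identity. Expanding the squares counts, for each pair v, w, the r that take equal
    -- values on both: q of them if v ≠ w, and q² if v = w. The common part q is annihilated because
    -- b has sum zero. The pairing is abstract since it is needed for `wedge` with either order of
    -- the arguments.
    radon : (π : V → V → Carrier) (j : V → V) → (∀ r v → π r v ≡ r ∙ j v) → (∀ {u v} → j u ≡ j v → u ≡ v) →
            (b : V → ℤ) → ∑ Vs b ≡ 0ℤ →
            ∑ Vs (λ r → ∑ elems (λ τ → ∑ Vs (λ v → 𝟙 (π r v ≟F τ) * b v) * ∑ Vs (λ v → 𝟙 (π r v ≟F τ) * b v)))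
            ≡ (q * q - q) * ∑ Vs (λ v → b v * b v)
    radon π j π≡ j-inj b ∑b≡0 = begin
      ∑ Vs (λ r → ∑ elems (λ τ → ∑ Vs (λ v → 𝟙 (π r v ≟F τ) * b v) * ∑ Vs (λ v → 𝟙 (π r v ≟F τ) * b v)))
        ≡⟨ ∑-cong Vs (λ r → level r) ⟩
      ∑ Vs (λ r → ∑ Vs (λ v → ∑ Vs (λ w → 𝟙 (π r w ≟F π r v) * (b v * b w))))
        ≡⟨ trans (∑-swap Vs Vs _) (∑-cong Vs (λ v → ∑-swap Vs Vs _)) ⟩
      ∑ Vs (λ v → ∑ Vs (λ w → ∑ Vs (λ r → 𝟙 (π r w ≟F π r v) * (b v * b w))))
        ≡⟨ ∑-cong Vs (λ v → ∑-cong Vs (λ w → trans (∑-*ʳ Vs (b v * b w) _) (cong (_* (b v * b w)) (agree v w)))) ⟩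
      ∑ Vs (λ v → ∑ Vs (λ w → (q + (q * q - q) * 𝟙 (w ≟V v)) * (b v * b w)))
        ≡⟨ ∑-cong Vs (λ v → trans (∑-cong Vs (λ w → rearrange q (q * q - q) (𝟙 (w ≟V v)) (b v) (b w)))
                (trans (∑-+ Vs _ _) (cong₂ _+_ (∑-*ˡ Vs (q * b v) b) (trans (∑-*ˡ Vs (q * q - q) (λ w → 𝟙 (w ≟V v) * (b v * b w))) (cong ((q * q - q) *_) (Enum.sift EV v (λ w → b v * b w))))))) ⟩
      ∑ Vs (λ v → q * b v * ∑ Vs b + (q * q - q) * (b v * b v))
        ≡⟨ ∑-cong Vs (λ v → trans (cong (λ z → q * b v * z + (q * q - q) * (b v * b v)) ∑b≡0) (drop (q * b v) _)) ⟩
      ∑ Vs (λ v → (q * q - q) * (b v * b v))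
        ≡⟨ ∑-*ˡ Vs (q * q - q) (λ v → b v * b v) ⟩
      (q * q - q) * ∑ Vs (λ v → b v * b v) ∎
      where
      drop : ∀ x y → x * 0ℤ + y ≡ y
      drop = solve-∀
      rearrange : ∀ q c i x y → (q + c * i) * (x * y) ≡ (q * x) * y + c * (i * (x * y))
      rearrange = solve-∀
      regroup : ∀ i x k y → (i * x) * (k * y) ≡ i * (k * (x * y))
      regroup = solve-∀
      agree : ∀ v w → ∑ Vs (λ r → 𝟙 (π r w ≟F π r v)) ≡ q + (q * q - q) * 𝟙 (w ≟V v)
      agree v w = begin
        ∑ Vs (λ r → 𝟙 (π r w ≟F π r v)) ≡⟨ ∑-cong Vs (λ r → cong₂ (λ x y → 𝟙 (x ≟F y)) (π≡ r w) (π≡ r v)) ⟩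
        ∑ Vs (λ r → 𝟙 ((r ∙ j w) ≟F (r ∙ j v))) ≡⟨ ∑-agree (j w) (j v) ⟩
        q + (q * q - q) * 𝟙 (j w ≟V j v) ≡⟨ cong (λ z → q + (q * q - q) * z) (𝟙-⇔ (j w ≟V j v) (w ≟V v) j-inj (cong j)) ⟩
        q + (q * q - q) * 𝟙 (w ≟V v) ∎
      level : ∀ r → ∑ elems (λ τ → ∑ Vs (λ v → 𝟙 (π r v ≟F τ) * b v) * ∑ Vs (λ v → 𝟙 (π r v ≟F τ) * b v))
                ≡ ∑ Vs (λ v → ∑ Vs (λ w → 𝟙 (π r w ≟F π r v) * (b v * b w)))
      level r = begin
        ∑ elems (λ τ → ∑ Vs (λ v → 𝟙 (π r v ≟F τ) * b v) * ∑ Vs (λ w → 𝟙 (π r w ≟F τ) * b w))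
          ≡⟨ ∑-cong elems (λ τ → trans (∑-*-∑ Vs Vs _ _) (∑-cong Vs (λ v → ∑-cong Vs (λ w → regroup (𝟙 (π r v ≟F τ)) (b v) (𝟙 (π r w ≟F τ)) (b w))))) ⟩
        ∑ elems (λ τ → ∑ Vs (λ v → ∑ Vs (λ w → 𝟙 (π r v ≟F τ) * (𝟙 (π r w ≟F τ) * (b v * b w)))))
          ≡⟨ trans (∑-swap elems Vs _) (∑-cong Vs (λ v → ∑-swap elems Vs _)) ⟩
        ∑ Vs (λ v → ∑ Vs (λ w → ∑ elems (λ τ → 𝟙 (π r v ≟F τ) * (𝟙 (π r w ≟F τ) * (b v * b w)))))
          ≡⟨ ∑-cong Vs (λ v → ∑-cong Vs (λ w → Enum.sift′ EF (π r v) (λ τ → 𝟙 (π r w ≟F τ) * (b v * b w)))) ⟩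
        ∑ Vs (λ v → ∑ Vs (λ w → 𝟙 (π r w ≟F π r v) * (b v * b w))) ∎

    rot rot′ : V → V
    rot  (a , b) = (⊖ b) , a
    rot′ (a , b) = b , (⊖ a)

    open import Algebra.Properties.AbelianGroup R.+-abelianGroup using (⁻¹-injective)

    rot-injective : ∀ {u v} → rot u ≡ rot v → u ≡ v
    rot-injective e = cong₂ _,_ (cong proj₂ e) (⁻¹-injective (cong proj₁ e))

    rot′-injective : ∀ {u v} → rot′ u ≡ rot′ v → u ≡ v
    rot′-injective e = cong₂ _,_ (⁻¹-injective (cong proj₂ e)) (cong proj₁ e)

    wedge-rot : ∀ r v → wedge v r ≡ r ∙ rot v
    wedge-rot (x , y) (a , b) = solve 4 (λ x y a b → (a :* y) :+ (:- (b :* x)) := (x :* (:- b)) :+ (y :* a)) refl x y a b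

    wedge-rot′ : ∀ r v → wedge r v ≡ r ∙ rot′ v
    wedge-rot′ (x , y) (a , b) = solve 4 (λ x y a b → (x :* b) :+ (:- (y :* a)) := (x :* b) :+ (y :* (:- a))) refl x y a b

    rot-≢𝟘 : ∀ {v} → v ≢ 𝟘 → rot v ≢ 𝟘
    rot-≢𝟘 v≢0 e = v≢0 (rot-injective (trans e (cong (_, 0#) (sym -0#≈0#))))
      where open import Algebra.Properties.Ring R.ring using (-0#≈0#)

  -- The operator on functions on {x | det x ∈ P}

  module Spectral (F : FiniteField)
                (P : FiniteField.Carrier F → Set)
                (P? : (c : FiniteField.Carrier F) → Dec (P c))
                (P≢0 : (c : FiniteField.Carrier F) → P c → c ≢ FiniteField.0# F) where
    open Plane F
    open Radon F
    open GL2 F using (Mat; allMat)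
    open ≡-Reasoning

    μ : Carrier → ℤ
    μ c = 𝟙 (P? c)

    χ : Mat → ℤ
    χ x = μ (det x)

    -- `κ` will be the number of x with det x ∈ P that carry a given nonzero vector to a given
    -- nonzero vector.
    ∣P∣ n κ : ℤ
    ∣P∣ = ∑ elems μ
    n   = ∑ allMat χ
    κ   = q * ∣P∣

    u : V → ℤ
    u v = 1ℤ - 𝟙 (v ≟V 𝟘)

    u-nonzero : ∀ {v} → v ≢ 𝟘 → u v ≡ 1ℤ
    u-nonzero {v} v≢0 = cong (λ z → 1ℤ - z) (𝟙-false (v ≟V 𝟘) v≢0)

    u-guard : ∀ v {a b : ℤ} → (v ≢ 𝟘 → a ≡ b) → u v * a ≡ u v * b
    u-guard v e with v ≟V 𝟘
    ... | yes _  = refl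
    ... | no v≢0 = cong (1ℤ *_) (e v≢0)

    ∑u : ∑ Vs u ≡ q * q - 1ℤ
    ∑u = begin
      ∑ Vs u ≡⟨ ∑-+ Vs (λ _ → 1ℤ) (λ v → - 𝟙 (v ≟V 𝟘)) ⟩
      ∑ Vs (λ _ → 1ℤ) + ∑ Vs (λ v → - 𝟙 (v ≟V 𝟘)) ≡⟨ cong₂ _+_ (trans (∑V-const 1ℤ) (ℤP.*-identityʳ (q * q)))
                (trans (∑-neg Vs (λ v → 𝟙 (v ≟V 𝟘))) (cong -_ (Enum.sift₁ EV 𝟘))) ⟩
      q * q - 1ℤ ∎

    -- x multiplies areas by det x, so the determinant can be read off the images of v and v'. A
    -- condition on x thereby becomes one on a pair of columns.
    χ-split : ∀ x v v' → wedge v v' ≢ 0# →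
              χ x ≡ ∑ elems (λ c → 𝟙 (wedge (x ▹ v) (x ▹ v') ≟F (c ⊗ wedge v v')) * μ c)
    χ-split x v v' δ≢0 = sym (trans
      (∑-cong elems (λ c → cong (_* μ c) (𝟙-⇔ (wedge (x ▹ v) (x ▹ v') ≟F (c ⊗ wedge v v')) (det x ≟F c)
        (λ e → ⊗-cancelʳ (det x) c (wedge v v') δ≢0 (trans (sym (wedge-▹ x v v')) e))
        (λ e → trans (wedge-▹ x v v') (cong (_⊗ wedge v v') e)))))
      (Enum.sift′ EF (det x) μ))

    ∑χ-columns : ∀ v v' → wedge v v' ≢ 0# → (f : V → V → ℤ) →
      ∑ allMat (λ x → χ x * f (x ▹ v) (x ▹ v'))
      ≡ ∑ elems (λ c → μ c * ∑ Vs (λ w → ∑ Vs (λ w' → 𝟙 (wedge w w' ≟F (c ⊗ wedge v v')) * f w w')))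
    ∑χ-columns v v' δ≢0 f = begin
      ∑ allMat (λ x → χ x * f (x ▹ v) (x ▹ v'))
        ≡⟨ ∑-cong allMat (λ x → trans (cong (_* f (x ▹ v) (x ▹ v')) (χ-split x v v' δ≢0))
             (trans (sym (∑-*ʳ elems (f (x ▹ v) (x ▹ v')) (λ c → 𝟙 (wedge (x ▹ v) (x ▹ v') ≟F (c ⊗ wedge v v')) * μ c)))
                (∑-cong elems (λ c → regroup (𝟙 (wedge (x ▹ v) (x ▹ v') ≟F (c ⊗ wedge v v'))) (μ c) (f (x ▹ v) (x ▹ v')))))) ⟩
      ∑ allMat (λ x → ∑ elems (λ c → μ c * (𝟙 (wedge (x ▹ v) (x ▹ v') ≟F (c ⊗ wedge v v')) * f (x ▹ v) (x ▹ v'))))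
        ≡⟨ ∑-swap allMat elems _ ⟩
      ∑ elems (λ c → ∑ allMat (λ x → μ c * (𝟙 (wedge (x ▹ v) (x ▹ v') ≟F (c ⊗ wedge v v')) * f (x ▹ v) (x ▹ v'))))
        ≡⟨ ∑-cong elems (λ c → trans (∑-*ˡ allMat (μ c) (λ x → 𝟙 (wedge (x ▹ v) (x ▹ v') ≟F (c ⊗ wedge v v')) * f (x ▹ v) (x ▹ v')))
             (cong (μ c *_) (∑-columns v v' δ≢0 (λ w w' → 𝟙 (wedge w w' ≟F (c ⊗ wedge v v')) * f w w')))) ⟩
      ∑ elems (λ c → μ c * ∑ Vs (λ w → ∑ Vs (λ w' → 𝟙 (wedge w w' ≟F (c ⊗ wedge v v')) * f w w'))) ∎
      where
      regroup : ∀ i m y → (i * m) * y ≡ m * (i * y)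
      regroup = solve-∀

    -- After completing v to a basis with area δ, each w ≠ 0 and c ∈ P leave for the second column
    -- the q points of the line wedge w w' = c δ. For w = 𝟘 there are none, since c δ ≠ 0; hence the
    -- factor u w.
    ∑χ-column : ∀ v → v ≢ 𝟘 → (g : V → ℤ) → ∑ allMat (λ x → χ x * g (x ▹ v)) ≡ κ * ∑ Vs (λ w → u w * g w)
    ∑χ-column v v≢0 g with complement v v≢0
    ... | v' , δ≢0 = begin
      ∑ allMat (λ x → χ x * g (x ▹ v))
        ≡⟨ ∑χ-columns v v' δ≢0 (λ w _ → g w) ⟩
      ∑ elems (λ c → μ c * ∑ Vs (λ w → ∑ Vs (λ w' → 𝟙 (wedge w w' ≟F (c ⊗ δ)) * g w)))
        ≡⟨ ∑-cong elems (λ c → 𝟙-guard (P? c) (λ Pc → trans (∑-cong Vs (λ w → trans (∑-*ʳ Vs (g w) (λ w' → 𝟙 (wedge w w' ≟F (c ⊗ δ))))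
             (trans (cong (_* g w) (line c Pc w)) (regroup₀ (u w) q (g w))))) (∑-*ˡ Vs q (λ w → u w * g w)))) ⟩
      ∑ elems (λ c → μ c * (q * ∑ Vs (λ w → u w * g w)))
        ≡⟨ ∑-*ʳ elems (q * ∑ Vs (λ w → u w * g w)) μ ⟩
      ∣P∣ * (q * ∑ Vs (λ w → u w * g w))
        ≡⟨ regroup ∣P∣ q (∑ Vs (λ w → u w * g w)) ⟩
      q * (∣P∣ * ∑ Vs (λ w → u w * g w))
        ≡⟨ ℤP.*-assoc q ∣P∣ (∑ Vs (λ w → u w * g w)) ⟨
      κ * ∑ Vs (λ w → u w * g w) ∎
      where
      δ = wedge v v'
      regroup₀ : ∀ a b c → (a * b) * c ≡ b * (a * c)
      regroup₀ = solve-∀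
      regroup : ∀ a b c → a * (b * c) ≡ b * (a * c)
      regroup = solve-∀
      line : ∀ c → P c → ∀ w → ∑ Vs (λ w' → 𝟙 (wedge w w' ≟F (c ⊗ δ))) ≡ u w * q
      line c Pc w with w ≟V 𝟘
      ... | yes refl = ∑-zero Vs (λ w' → 𝟙-false (wedge 𝟘 w' ≟F (c ⊗ δ)) (λ e → ⊗-≢0 (P≢0 c Pc) δ≢0 (trans (sym e) (wedge-𝟘 w'))))
      ... | no w≢0   = begin
        ∑ Vs (λ w' → 𝟙 (wedge w w' ≟F (c ⊗ δ))) ≡⟨ ∑-cong Vs (λ w' → cong (λ z → 𝟙 (z ≟F (c ⊗ δ))) (wedge-rot w' w)) ⟩
        ∑ Vs (λ w' → 𝟙 ((w' ∙ rot w) ≟F (c ⊗ δ))) ≡⟨ ∑-line (rot w) (c ⊗ δ) (rot-≢𝟘 w≢0) ⟩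
        q ≡⟨ ℤP.*-identityˡ q ⟨
        1ℤ * q ∎

    n≡ : n ≡ (q * q - 1ℤ) * κ
    n≡ = begin
      ∑ allMat χ ≡⟨ ∑-cong allMat (λ x → ℤP.*-identityʳ (χ x)) ⟨
      ∑ allMat (λ x → χ x * 1ℤ) ≡⟨ ∑χ-column (1# , 0#) (λ e → 0≢1 (sym (cong proj₁ e))) (λ _ → 1ℤ) ⟩
      κ * ∑ Vs (λ w → u w * 1ℤ) ≡⟨ cong (κ *_) (trans (∑-cong Vs (λ w → ℤP.*-identityʳ (u w))) ∑u) ⟩
      κ * (q * q - 1ℤ) ≡⟨ ℤP.*-comm κ (q * q - 1ℤ) ⟩
      (q * q - 1ℤ) * κ ∎

    T : Mat → Mat → ℤ
    T x y = ∑ Vs (λ v → u v * 𝟙 ((x ▹ v) ≟V (y ▹ v)))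

    T-sym : ∀ x y → T x y ≡ T y x
    T-sym x y = ∑-cong Vs (λ v → cong (u v *_) (𝟙-⇔ ((x ▹ v) ≟V (y ▹ v)) ((y ▹ v) ≟V (x ▹ v)) sym sym))

    -- Each of the q² - 1 nonzero v contributes the `κ` matrices y with y v = x v.
    T-row : ∀ x → P (det x) → ∑ allMat (λ y → χ y * T x y) ≡ n
    T-row x Px = begin
      ∑ allMat (λ y → χ y * T x y)
        ≡⟨ ∑-cong allMat (λ y → trans (sym (∑-*ˡ Vs (χ y) (λ v → u v * 𝟙 ((x ▹ v) ≟V (y ▹ v)))))
                (∑-cong Vs (λ v → regroup (χ y) (u v) (𝟙 ((x ▹ v) ≟V (y ▹ v)))))) ⟩
      ∑ allMat (λ y → ∑ Vs (λ v → u v * (χ y * 𝟙 ((x ▹ v) ≟V (y ▹ v)))))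
        ≡⟨ ∑-swap allMat Vs _ ⟩
      ∑ Vs (λ v → ∑ allMat (λ y → u v * (χ y * 𝟙 ((x ▹ v) ≟V (y ▹ v)))))
        ≡⟨ ∑-cong Vs (λ v → trans (∑-*ˡ allMat (u v) (λ y → χ y * 𝟙 ((x ▹ v) ≟V (y ▹ v)))) (u-guard v (λ v≢0 → agree v v≢0))) ⟩
      ∑ Vs (λ v → u v * κ)
        ≡⟨ ∑-*ʳ Vs κ u ⟩
      ∑ Vs u * κ
        ≡⟨ cong (_* κ) ∑u ⟩
      (q * q - 1ℤ) * κ
        ≡⟨ n≡ ⟨
      n ∎
      where
      regroup : ∀ a b c → a * (b * c) ≡ b * (a * c)
      regroup = solve-∀
      agree : ∀ v → v ≢ 𝟘 → ∑ allMat (λ y → χ y * 𝟙 ((x ▹ v) ≟V (y ▹ v))) ≡ κ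
      agree v v≢0 = begin
        ∑ allMat (λ y → χ y * 𝟙 ((x ▹ v) ≟V (y ▹ v))) ≡⟨ ∑χ-column v v≢0 (λ w → 𝟙 ((x ▹ v) ≟V w)) ⟩
        κ * ∑ Vs (λ w → u w * 𝟙 ((x ▹ v) ≟V w)) ≡⟨ cong (κ *_) (∑-cong Vs (λ w → ℤP.*-comm (u w) _)) ⟩
        κ * ∑ Vs (λ w → 𝟙 ((x ▹ v) ≟V w) * u w) ≡⟨ cong (κ *_) (Enum.sift′ EV (x ▹ v) u) ⟩
        κ * u (x ▹ v) ≡⟨ cong (κ *_) (u-nonzero (▹-≢𝟘 x v (P≢0 (det x) Px) v≢0)) ⟩
        κ * 1ℤ ≡⟨ ℤP.*-identityʳ κ ⟩
        κ ∎

    form : (Mat → ℤ) → (Mat → ℤ) → ℤ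
    form f g = ∑ allMat (λ x → ∑ allMat (λ y → f x * g y * T x y))

    form-sym : ∀ f g → form f g ≡ form g f
    form-sym f g = trans (∑-swap allMat allMat _) (∑-cong allMat (λ y → ∑-cong allMat (λ x →
      cong₂ _*_ (ℤP.*-comm (f x) (g y)) (T-sym x y))))

    form-linearˡ : ∀ a b f f' g → form (λ x → a * f x + b * f' x) g ≡ a * form f g + b * form f' g
    form-linearˡ a b f f' g = begin
      ∑ allMat (λ x → ∑ allMat (λ y → (a * f x + b * f' x) * g y * T x y))
        ≡⟨ ∑-cong allMat (λ x → trans (∑-cong allMat (λ y → distr a b (f x) (f' x) (g y) (T x y)))
             (trans (∑-+ allMat _ _) (cong₂ _+_ (∑-*ˡ allMat a (λ y → f x * g y * T x y)) (∑-*ˡ allMat b (λ y → f' x * g y * T x y))))) ⟩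
      ∑ allMat (λ x → a * ∑ allMat (λ y → f x * g y * T x y) + b * ∑ allMat (λ y → f' x * g y * T x y))
        ≡⟨ ∑-+ allMat _ _ ⟩
      ∑ allMat (λ x → a * ∑ allMat (λ y → f x * g y * T x y)) + ∑ allMat (λ x → b * ∑ allMat (λ y → f' x * g y * T x y))
        ≡⟨ cong₂ _+_ (∑-*ˡ allMat a (λ x → ∑ allMat (λ y → f x * g y * T x y))) (∑-*ˡ allMat b (λ x → ∑ allMat (λ y → f' x * g y * T x y))) ⟩
      a * form f g + b * form f' g ∎
      where
      distr : ∀ a b x x' y t → (a * x + b * x') * y * t ≡ a * (x * y * t) + b * (x' * y * t)
      distr = solve-∀

    form-linearʳ : ∀ a b f g g' → form f (λ x → a * g x + b * g' x) ≡ a * form f g + b * form f g'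
    form-linearʳ a b f g g' = trans (form-sym f _) (trans (form-linearˡ a b g g' f)
      (cong₂ (λ x y → a * x + b * y) (form-sym g f) (form-sym g' f)))

    Supp : (Mat → ℤ) → Set
    Supp f = ∀ x → f x ≡ χ x * f x

    form-χʳ : ∀ f → Supp f → form f χ ≡ n * ∑ allMat f
    form-χʳ f supp = begin
      ∑ allMat (λ x → ∑ allMat (λ y → f x * χ y * T x y))
        ≡⟨ ∑-cong allMat (λ x → trans (∑-cong allMat (λ y → ℤP.*-assoc (f x) (χ y) (T x y))) (∑-*ˡ allMat (f x) (λ y → χ y * T x y))) ⟩
      ∑ allMat (λ x → f x * ∑ allMat (λ y → χ y * T x y))
        ≡⟨ ∑-cong allMat (λ x → row x) ⟩
      ∑ allMat (λ x → n * f x)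
        ≡⟨ ∑-*ˡ allMat n f ⟩
      n * ∑ allMat f ∎
      where
      row : ∀ x → f x * ∑ allMat (λ y → χ y * T x y) ≡ n * f x
      row x = begin
        f x * S ≡⟨ cong (_* S) (supp x) ⟩
        χ x * f x * S ≡⟨ ℤP.*-assoc (χ x) (f x) S ⟩
        χ x * (f x * S) ≡⟨ 𝟙-guard (P? (det x)) (λ Px → cong (f x *_) (T-row x Px)) ⟩
        χ x * (f x * n) ≡⟨ ℤP.*-assoc (χ x) (f x) n ⟨
        χ x * f x * n ≡⟨ cong (_* n) (supp x) ⟨
        f x * n ≡⟨ ℤP.*-comm (f x) n ⟩
        n * f x ∎
        where S = ∑ allMat (λ y → χ y * T x y)

    χ-supp : Supp χ
    χ-supp x = sym (𝟙-idem (P? (det x)))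

    -- `T` is nonnegative and vanishes unless x and y agree on some nonzero vector, so an inequality
    -- valid on such pairs can be summed with weights `T`. On the right each term involves one
    -- variable only, and the other is summed out by the row sum n.
    form-≤ : ∀ α (f g φ ψ : Mat → ℤ) → Supp f → Supp g →
             (∀ x y v → P (det x) → P (det y) → v ≢ 𝟘 → x ▹ v ≡ y ▹ v → α * (f x * g y) ≤ φ x + ψ y) →
             α * form f g ≤ n * (∑ allMat (λ x → χ x * φ x) + ∑ allMat (λ x → χ x * ψ x))
    form-≤ α f g φ ψ sf sg local = ℤP.≤-trans (ℤP.≤-reflexive lhs≡) (ℤP.≤-trans bound (ℤP.≤-reflexive rhs≡))
      where
      weight : Mat → Mat → V → ℤ
      weight x y v = (χ x * χ y) * (u v * 𝟙 ((x ▹ v) ≟V (y ▹ v)))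

      lhs≡ : α * form f g ≡ ∑ allMat (λ x → ∑ allMat (λ y → ∑ Vs (λ v → weight x y v * (α * (f x * g y)))))
      lhs≡ = begin
        α * form f g
          ≡⟨ trans (sym (∑-*ˡ allMat α (λ x → ∑ allMat (λ y → f x * g y * T x y))))
                (∑-cong allMat (λ x → sym (∑-*ˡ allMat α (λ y → f x * g y * T x y)))) ⟩
        ∑ allMat (λ x → ∑ allMat (λ y → α * (f x * g y * T x y)))
          ≡⟨ ∑-cong allMat (λ x → ∑-cong allMat (λ y → trans (cong₂ (λ a b → α * (a * b * T x y)) (sf x) (sg y))
               (trans (regroup α (χ x) (f x) (χ y) (g y) (T x y))
               (trans (cong (λ z → z * (α * (f x * g y))) (sym (∑-*ˡ Vs (χ x * χ y) (λ v → u v * 𝟙 ((x ▹ v) ≟V (y ▹ v))))))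
                (sym (∑-*ʳ Vs (α * (f x * g y)) (weight x y))))))) ⟩
        ∑ allMat (λ x → ∑ allMat (λ y → ∑ Vs (λ v → weight x y v * (α * (f x * g y))))) ∎
        where
        regroup : ∀ α c x d y t → α * ((c * x) * (d * y) * t) ≡ ((c * d) * t) * (α * (x * y))
        regroup = solve-∀

      bound : ∑ allMat (λ x → ∑ allMat (λ y → ∑ Vs (λ v → weight x y v * (α * (f x * g y)))))
            ≤ ∑ allMat (λ x → ∑ allMat (λ y → ∑ Vs (λ v → weight x y v * (φ x + ψ y))))
      bound = ∑-mono allMat (λ x → ∑-mono allMat (λ y → ∑-mono Vs (λ v → pointwise x y v)))
        where
        pointwise : ∀ x y v → weight x y v * (α * (f x * g y)) ≤ weight x y v * (φ x + ψ y)
        pointwise x y v with P? (det x) | P? (det y) | v ≟V 𝟘 | (x ▹ v) ≟V (y ▹ v)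
        ... | no _   | _      | _      | _     = ℤP.≤-refl
        ... | yes _  | no _   | _      | _     = ℤP.≤-refl
        ... | yes _  | yes _  | yes _  | _     = ℤP.≤-refl
        ... | yes _  | yes _  | no _   | no _  = ℤP.≤-refl
        ... | yes px | yes py | no v≢0 | yes e = *-mono-≤-0≤ {1ℤ} (+≤+ ℕ.z≤n) (local x y v px py v≢0 e)

      rhs≡ : ∑ allMat (λ x → ∑ allMat (λ y → ∑ Vs (λ v → weight x y v * (φ x + ψ y))))
           ≡ n * (∑ allMat (λ x → χ x * φ x) + ∑ allMat (λ x → χ x * ψ x))
      rhs≡ = begin
        ∑ allMat (λ x → ∑ allMat (λ y → ∑ Vs (λ v → weight x y v * (φ x + ψ y))))
          ≡⟨ ∑-cong allMat (λ x → ∑-cong allMat (λ y → trans (∑-*ʳ Vs (φ x + ψ y) (weight x y))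
               (trans (cong (_* (φ x + ψ y)) (∑-*ˡ Vs (χ x * χ y) (λ v → u v * 𝟙 ((x ▹ v) ≟V (y ▹ v)))))
                (regroup (χ x) (χ y) (T x y) (φ x) (ψ y))))) ⟩
        ∑ allMat (λ x → ∑ allMat (λ y → (χ x * φ x) * χ y * T x y + χ x * (χ y * ψ y) * T x y))
          ≡⟨ trans (∑-cong allMat (λ x → ∑-+ allMat _ _)) (∑-+ allMat _ _) ⟩
        form (λ x → χ x * φ x) χ + form χ (λ x → χ x * ψ x)
          ≡⟨ cong₂ _+_ (form-χʳ _ (supp φ)) (trans (form-sym χ _) (form-χʳ _ (supp ψ))) ⟩
        n * ∑ allMat (λ x → χ x * φ x) + n * ∑ allMat (λ x → χ x * ψ x)
          ≡⟨ ℤP.*-distribˡ-+ n _ _ ⟨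
        n * (∑ allMat (λ x → χ x * φ x) + ∑ allMat (λ x → χ x * ψ x)) ∎
        where
        regroup : ∀ c d t a b → ((c * d) * t) * (a + b) ≡ (c * a) * d * t + c * (d * b) * t
        regroup = solve-∀
        supp : ∀ (φ : Mat → ℤ) → Supp (λ x → χ x * φ x)
        supp φ x = trans (cong (_* φ x) (χ-supp x)) (ℤP.*-assoc (χ x) (χ x) (φ x))

  -- Norm of the incidence operator on functions of sum zero

  module SpectralBound (F : FiniteField)
                (P : FiniteField.Carrier F → Set)
                (P? : (c : FiniteField.Carrier F) → Dec (P c))
                (P≢0 : (c : FiniteField.Carrier F) → P c → c ≢ FiniteField.0# F) where
    open Plane F
    open Radon F
    open Spectral F P P? P≢0
    open GL2 F using (Mat; allMat)
    open ≡-Reasoning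

    -- The sum of qκ, from parallel pairs (v , v'), and (q² - q)∣P∣, from independent ones. It is an
    -- upper bound, not a computed eigenvalue.
    λ₂ : ℤ
    λ₂ = κ * (2ℤ * q - 1ℤ)

    0≤κ : 0ℤ ≤ κ
    0≤κ = 0≤-* {q} (+≤+ ℕ.z≤n) (∑-nonneg elems (λ c → 0≤𝟙 (P? c)))

    -- The incidence operator of the relation x v = w. Its Gram kernel is `T` + 1, the 1 coming from
    -- v = 𝟘.
    transfer : (Mat → ℤ) → V → V → ℤ
    transfer k v w = ∑ allMat (λ x → 𝟙 ((x ▹ v) ≟V w) * k x)

    ∥_∥² : (V → V → ℤ) → ℤ
    ∥ a ∥² = ∑ Vs (λ v → ∑ Vs (λ w → a v w * a v w))

    module _ (k : Mat → ℤ) (supp : Supp k) (∑k≡0 : ∑ allMat k ≡ 0ℤ) where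
      private
        a : V → V → ℤ
        a = transfer k

        N : ℤ
        N = ∥ a ∥²

      transfer-𝟘 : ∀ w → a 𝟘 w ≡ 0ℤ
      transfer-𝟘 w = begin
        ∑ allMat (λ x → 𝟙 ((x ▹ 𝟘) ≟V w) * k x) ≡⟨ ∑-cong allMat (λ x → cong (λ z → 𝟙 (z ≟V w) * k x) (▹-𝟘 x)) ⟩
        ∑ allMat (λ x → 𝟙 (𝟘 ≟V w) * k x) ≡⟨ ∑-*ˡ allMat (𝟙 (𝟘 ≟V w)) k ⟩
        𝟙 (𝟘 ≟V w) * ∑ allMat k ≡⟨ cong (𝟙 (𝟘 ≟V w) *_) ∑k≡0 ⟩
        𝟙 (𝟘 ≟V w) * 0ℤ ≡⟨ ℤP.*-zeroʳ (𝟙 (𝟘 ≟V w)) ⟩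
        0ℤ ∎

      ∑-transferʳ : ∀ v → ∑ Vs (a v) ≡ 0ℤ
      ∑-transferʳ v = trans (∑-swap Vs allMat _)
        (trans (∑-cong allMat (λ x → Enum.sift′ EV (x ▹ v) (λ _ → k x))) ∑k≡0)

      -- k lives on invertible matrices, and such an x has exactly one v with x v = w. Both
      -- marginals of `a` must vanish because `radon` is applied in each variable.
      ∑-transferˡ : ∀ w → ∑ Vs (λ v → a v w) ≡ 0ℤ
      ∑-transferˡ w = trans (∑-swap Vs allMat _) (trans (∑-cong allMat unique) ∑k≡0)
        where
        unique : ∀ x → ∑ Vs (λ v → 𝟙 ((x ▹ v) ≟V w) * k x) ≡ k x
        unique x = begin
          ∑ Vs (λ v → 𝟙 ((x ▹ v) ≟V w) * k x) ≡⟨ ∑-*ʳ Vs (k x) (λ v → 𝟙 ((x ▹ v) ≟V w)) ⟩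
          S * k x ≡⟨ cong (S *_) (supp x) ⟩
          S * (χ x * k x) ≡⟨ regroup S (χ x) (k x) ⟩
          χ x * (S * k x) ≡⟨ 𝟙-guard (P? (det x)) (λ Px → cong (_* k x)
                (trans (∑-▹ x (P≢0 (det x) Px) (λ v → 𝟙 (v ≟V w))) (Enum.sift₁ EV w))) ⟩
          χ x * (1ℤ * k x) ≡⟨ cong (χ x *_) (ℤP.*-identityˡ (k x)) ⟩
          χ x * k x ≡⟨ supp x ⟨
          k x ∎
          where
          S = ∑ Vs (λ v → 𝟙 ((x ▹ v) ≟V w))
          regroup : ∀ s c y → s * (c * y) ≡ c * (s * y)
          regroup = solve-∀

      private
        -- The adjoint of `transfer` applied to `a`. The aim is to bound its squared norm by λ₂ N.
        b : Mat → ℤ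
        b x = ∑ Vs (λ v → a v (x ▹ v))

        ∑kb : ∑ allMat (λ x → k x * b x) ≡ N
        ∑kb = begin
          ∑ allMat (λ x → k x * b x)
            ≡⟨ ∑-cong allMat (λ x → trans (sym (∑-*ˡ Vs (k x) (λ v → a v (x ▹ v))))
                (∑-cong Vs (λ v → sym (Enum.sift′ EV (x ▹ v) (λ w → k x * a v w))))) ⟩
          ∑ allMat (λ x → ∑ Vs (λ v → ∑ Vs (λ w → 𝟙 ((x ▹ v) ≟V w) * (k x * a v w))))
            ≡⟨ trans (∑-swap allMat Vs _) (∑-cong Vs (λ v → ∑-swap allMat Vs _)) ⟩
          ∑ Vs (λ v → ∑ Vs (λ w → ∑ allMat (λ x → 𝟙 ((x ▹ v) ≟V w) * (k x * a v w))))
            ≡⟨ ∑-cong Vs (λ v → ∑-cong Vs (λ w → trans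
                (∑-cong allMat (λ x → sym (ℤP.*-assoc (𝟙 ((x ▹ v) ≟V w)) (k x) (a v w))))
                (∑-*ʳ allMat (a v w) (λ x → 𝟙 ((x ▹ v) ≟V w) * k x)))) ⟩
          N ∎

        -- `Q` is the (v , v') term of the squared norm of `b`; `W` is the form it takes as a sum
        -- over columns when v and v' are independent.
        Q W : V → V → ℤ
        Q v v' = ∑ allMat (λ x → χ x * (a v (x ▹ v) * a v' (x ▹ v')))
        W v v' = ∑ elems (λ c → μ c * ∑ Vs (λ w → ∑ Vs (λ w' → 𝟙 (wedge w w' ≟F (c ⊗ wedge v v')) * (a v w * a v' w'))))

        A : V → ℤ
        A v = Q v v

        z : V → V → ℤ
        z v v' = 𝟙 (wedge v v' ≟F 0#)

        nz : Carrier → ℤ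
        nz τ = 1ℤ - 𝟙 (τ ≟F 0#)

        ∑χbb : ∑ allMat (λ x → χ x * (b x * b x)) ≡ ∑ Vs (λ v → ∑ Vs (Q v))
        ∑χbb = begin
          ∑ allMat (λ x → χ x * (b x * b x))
            ≡⟨ ∑-cong allMat (λ x → trans (cong (χ x *_) (∑-*-∑ Vs Vs _ _))
                (trans (sym (∑-*ˡ Vs (χ x) (λ v → ∑ Vs (λ v' → a v (x ▹ v) * a v' (x ▹ v')))))
                (∑-cong Vs (λ v → sym (∑-*ˡ Vs (χ x) (λ v' → a v (x ▹ v) * a v' (x ▹ v'))))))) ⟩
          ∑ allMat (λ x → ∑ Vs (λ v → ∑ Vs (λ v' → χ x * (a v (x ▹ v) * a v' (x ▹ v')))))
            ≡⟨ trans (∑-swap allMat Vs _) (∑-cong Vs (λ v → ∑-swap allMat Vs _)) ⟩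
          ∑ Vs (λ v → ∑ Vs (Q v)) ∎

        -- Parallel pairs are few, so AM-GM is affordable there. Independent pairs are rewritten
        -- exactly, which keeps the cancellation in `W` available for Plancherel.
        Q-≤ : ∀ v v' → 2ℤ * Q v v' ≤ z v v' * (A v + A v') + nz (wedge v v') * (2ℤ * W v v')
        Q-≤ v v' with wedge v v' ≟F 0# in dec
        ... | yes _ = ℤP.≤-trans amgm (ℤP.≤-reflexive (tidy (A v + A v') (2ℤ * W v v')))
          where
          tidy : ∀ x y → x ≡ 1ℤ * x + 0ℤ * y
          tidy = solve-∀
          regroup : ∀ c y → + 2 * (c * y) ≡ c * (+ 2 * y)
          regroup = solve-∀
          amgm : 2ℤ * Q v v' ≤ A v + A v'
          amgm = ℤP.≤-trans (ℤP.≤-reflexive (trans (sym (∑-*ˡ allMat 2ℤ (λ x → χ x * (a v (x ▹ v) * a v' (x ▹ v')))))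
                (∑-cong allMat (λ x → regroup (χ x) (a v (x ▹ v) * a v' (x ▹ v'))))))
            (ℤP.≤-trans (∑-mono allMat (λ x → *-mono-≤-0≤ (0≤𝟙 (P? (det x))) (2xy≤x²+y² (a v (x ▹ v)) (a v' (x ▹ v')))))
            (ℤP.≤-reflexive (trans (∑-cong allMat (λ x → ℤP.*-distribˡ-+ (χ x) (a v (x ▹ v) * a v (x ▹ v)) (a v' (x ▹ v') * a v' (x ▹ v'))))
              (∑-+ allMat _ _))))
        ... | no δ≢0 = ℤP.≤-reflexive (trans (cong (2ℤ *_) (∑χ-columns v v' δ≢0 (λ w w' → a v w * a v' w')))
                (tidy (A v + A v') (2ℤ * W v v')))
          where
          tidy : ∀ x y → y ≡ 0ℤ * x + 1ℤ * y
          tidy = solve-∀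

        Nᵥ : V → ℤ
        Nᵥ v = ∑ Vs (λ w → a v w * a v w)

        A-𝟘 : A 𝟘 ≡ 0ℤ
        A-𝟘 = ∑-zero allMat (λ x → trans (cong (λ y → χ x * (y * y)) (transfer-𝟘 (x ▹ 𝟘))) (ℤP.*-zeroʳ (χ x)))

        A-≤ : ∀ v → A v ≤ κ * Nᵥ v
        A-≤ v with v ≟V 𝟘
        ... | yes refl = ℤP.≤-trans (ℤP.≤-reflexive A-𝟘) (0≤-* 0≤κ (∑-nonneg Vs (λ w → 0≤² (a 𝟘 w))))
        ... | no v≢0   = ℤP.≤-trans (ℤP.≤-reflexive (∑χ-column v v≢0 (λ w → a v w * a v w)))
                (*-mono-≤-0≤ 0≤κ (∑-mono Vs (λ w → drop w)))
          where
          drop : ∀ w → u w * (a v w * a v w) ≤ a v w * a v w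
          drop w with w ≟V 𝟘
          ... | yes _ = 0≤² (a v w)
          ... | no _  = ℤP.≤-reflexive (ℤP.*-identityˡ (a v w * a v w))

        -- A nonzero v is parallel to its q multiples only. For v = 𝟘 all q² vectors count, but then
        -- `A v` vanishes.
        ∑z : ∀ v → ∑ Vs (z v) * A v ≡ q * A v
        ∑z v with v ≟V 𝟘
        ... | yes refl = trans (cong (∑ Vs (z 𝟘) *_) A-𝟘) (trans (ℤP.*-zeroʳ (∑ Vs (z 𝟘)))
                (sym (trans (cong (q *_) A-𝟘) (ℤP.*-zeroʳ q))))
        ... | no v≢0   = cong (_* A v) (trans (∑-cong Vs (λ v' → cong (λ t → 𝟙 (t ≟F 0#)) (wedge-rot v' v))) (∑-line (rot v) 0# (rot-≢𝟘 v≢0)))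

        z-sym : ∀ v v' → z v v' ≡ z v' v
        z-sym v v' = 𝟙-⇔ (wedge v v' ≟F 0#) (wedge v' v ≟F 0#) (flip v v') (flip v' v)
          where
          open import Algebra.Properties.Ring R.ring using (-0#≈0#)
          flip : ∀ v v' → wedge v v' ≡ 0# → wedge v' v ≡ 0#
          flip (a , b) (c , d) e = trans (solve 4 (λ a b c d → (c :* b) :+ (:- (d :* a)) := :- ((a :* d) :+ (:- (b :* c)))) refl a b c d)
                (trans (cong ⊖_ e) -0#≈0#)

        ∑zA : ∑ Vs (λ v → ∑ Vs (λ v' → z v v' * (A v + A v'))) ≤ 2ℤ * (q * κ * N)
        ∑zA = ℤP.≤-trans (ℤP.≤-reflexive eq) (*-mono-≤-0≤ {2ℤ} (+≤+ ℕ.z≤n)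
                (ℤP.≤-trans (*-mono-≤-0≤ {q} (+≤+ ℕ.z≤n) (∑-mono Vs A-≤))
                (ℤP.≤-reflexive (trans (cong (q *_) (∑-*ˡ Vs κ Nᵥ)) (sym (ℤP.*-assoc q κ N))))))
          where
          half : ∑ Vs (λ v → ∑ Vs (λ v' → z v v' * A v)) ≡ q * ∑ Vs A
          half = trans (∑-cong Vs (λ v → trans (∑-*ʳ Vs (A v) (z v)) (∑z v))) (∑-*ˡ Vs q A)
          double : ∀ x → x + x ≡ + 2 * x
          double = solve-∀
          eq : ∑ Vs (λ v → ∑ Vs (λ v' → z v v' * (A v + A v'))) ≡ 2ℤ * (q * ∑ Vs A)
          eq = begin
            ∑ Vs (λ v → ∑ Vs (λ v' → z v v' * (A v + A v')))
              ≡⟨ trans (∑-cong Vs (λ v → trans (∑-cong Vs (λ v' → ℤP.*-distribˡ-+ (z v v') (A v) (A v'))) (∑-+ Vs _ _))) (∑-+ Vs _ _) ⟩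
            ∑ Vs (λ v → ∑ Vs (λ v' → z v v' * A v)) + ∑ Vs (λ v → ∑ Vs (λ v' → z v v' * A v'))
              ≡⟨ cong₂ _+_ half (trans (∑-swap Vs Vs _) (trans (∑-cong Vs (λ v' → ∑-cong Vs (λ v → cong (_* A v') (z-sym v v')))) half)) ⟩
            q * ∑ Vs A + q * ∑ Vs A
              ≡⟨ double (q * ∑ Vs A) ⟩
            2ℤ * (q * ∑ Vs A) ∎

        -- Radon transforms of `a` in its first and in its second variable.
        B C : V → V → Carrier → ℤ
        B v' w τ = ∑ Vs (λ v → 𝟙 (wedge v v' ≟F τ) * a v w)
        C v' w τ = ∑ Vs (λ w' → 𝟙 (wedge w w' ≟F τ) * a v' w')

        E : Carrier → Carrier → ℤ
        E c τ = ∑ Vs (λ v' → ∑ Vs (λ w → B v' w τ * C v' w (c ⊗ τ)))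

        E≡ : ∀ c τ → ∑ Vs (λ v → ∑ Vs (λ v' → 𝟙 (wedge v v' ≟F τ) * ∑ Vs (λ w → ∑ Vs (λ w' → 𝟙 (wedge w w' ≟F (c ⊗ τ)) * (a v w * a v' w'))))) ≡ E c τ
        E≡ c τ = begin
          ∑ Vs (λ v → ∑ Vs (λ v' → 𝟙 (wedge v v' ≟F τ) * ∑ Vs (λ w → ∑ Vs (λ w' → 𝟙 (wedge w w' ≟F (c ⊗ τ)) * (a v w * a v' w')))))
            ≡⟨ ∑-cong Vs (λ v → ∑-cong Vs (λ v' → trans (sym (∑-*ˡ Vs (𝟙 (wedge v v' ≟F τ)) (λ w → ∑ Vs (λ w' → 𝟙 (wedge w w' ≟F (c ⊗ τ)) * (a v w * a v' w')))))
                (∑-cong Vs (λ w → trans (sym (∑-*ˡ Vs (𝟙 (wedge v v' ≟F τ)) (λ w' → 𝟙 (wedge w w' ≟F (c ⊗ τ)) * (a v w * a v' w'))))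
                (∑-cong Vs (λ w' → regroup (𝟙 (wedge v v' ≟F τ)) (𝟙 (wedge w w' ≟F (c ⊗ τ))) (a v w) (a v' w'))))))) ⟩
          ∑ Vs (λ v → ∑ Vs (λ v' → ∑ Vs (λ w → ∑ Vs (λ w' → (𝟙 (wedge v v' ≟F τ) * a v w) * (𝟙 (wedge w w' ≟F (c ⊗ τ)) * a v' w')))))
            ≡⟨ trans (∑-swap Vs Vs _) (∑-cong Vs (λ v' → ∑-swap Vs Vs _)) ⟩
          ∑ Vs (λ v' → ∑ Vs (λ w → ∑ Vs (λ v → ∑ Vs (λ w' → (𝟙 (wedge v v' ≟F τ) * a v w) * (𝟙 (wedge w w' ≟F (c ⊗ τ)) * a v' w')))))
            ≡⟨ ∑-cong Vs (λ v' → ∑-cong Vs (λ w → ∑-*-∑ Vs Vs _ _)) ⟨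
          E c τ ∎
          where
          regroup : ∀ i k x y → i * (k * (x * y)) ≡ (i * x) * (k * y)
          regroup = solve-∀

        -- Sorting pairs by their area τ = wedge v v' decouples v from w': for fixed v', w and τ the
        -- inner sums become the product of a line sum over v and a line sum over w'.
        ∑W≡ : ∑ Vs (λ v → ∑ Vs (λ v' → nz (wedge v v') * W v v')) ≡ ∑ elems (λ c → μ c * ∑ elems (λ τ → nz τ * E c τ))
        ∑W≡ = begin
          ∑ Vs (λ v → ∑ Vs (λ v' → nz (wedge v v') * W v v'))
            ≡⟨ ∑-cong Vs (λ v → ∑-cong Vs (λ v' → trans (sym (∑-*ˡ elems (nz (wedge v v')) (λ c → μ c * G c v v' (wedge v v'))))
                (∑-cong elems (λ c → trans (regroup (nz (wedge v v')) (μ c) (G c v v' (wedge v v')))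
                (cong (μ c *_) (sym (Enum.sift′ EF (wedge v v') (λ τ → nz τ * G c v v' τ)))))))) ⟩
          ∑ Vs (λ v → ∑ Vs (λ v' → ∑ elems (λ c → μ c * ∑ elems (λ τ → 𝟙 (wedge v v' ≟F τ) * (nz τ * G c v v' τ)))))
            ≡⟨ trans (∑-cong Vs (λ v → ∑-swap Vs elems _)) (∑-swap Vs elems _) ⟩
          ∑ elems (λ c → ∑ Vs (λ v → ∑ Vs (λ v' → μ c * ∑ elems (λ τ → 𝟙 (wedge v v' ≟F τ) * (nz τ * G c v v' τ)))))
            ≡⟨ ∑-cong elems (λ c → trans (∑-cong Vs (λ v → ∑-*ˡ Vs (μ c) _)) (∑-*ˡ Vs (μ c) _)) ⟩
          ∑ elems (λ c → μ c * ∑ Vs (λ v → ∑ Vs (λ v' → ∑ elems (λ τ → 𝟙 (wedge v v' ≟F τ) * (nz τ * G c v v' τ)))))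
            ≡⟨ ∑-cong elems (λ c → cong (μ c *_) (trans (∑-cong Vs (λ v → ∑-swap Vs elems _)) (∑-swap Vs elems _))) ⟩
          ∑ elems (λ c → μ c * ∑ elems (λ τ → ∑ Vs (λ v → ∑ Vs (λ v' → 𝟙 (wedge v v' ≟F τ) * (nz τ * G c v v' τ)))))
            ≡⟨ ∑-cong elems (λ c → cong (μ c *_) (∑-cong elems (λ τ → trans
                (∑-cong Vs (λ v → trans (∑-cong Vs (λ v' → regroup (𝟙 (wedge v v' ≟F τ)) (nz τ) (G c v v' τ))) (∑-*ˡ Vs (nz τ) (λ v' → 𝟙 (wedge v v' ≟F τ) * G c v v' τ))))
                (trans (∑-*ˡ Vs (nz τ) (λ v → ∑ Vs (λ v' → 𝟙 (wedge v v' ≟F τ) * G c v v' τ))) (cong (nz τ *_) (E≡ c τ)))))) ⟩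
          ∑ elems (λ c → μ c * ∑ elems (λ τ → nz τ * E c τ)) ∎
          where
          regroup : ∀ i k x → i * (k * x) ≡ k * (i * x)
          regroup = solve-∀
          G : Carrier → V → V → Carrier → ℤ
          G c v v' τ = ∑ Vs (λ w → ∑ Vs (λ w' → 𝟙 (wedge w w' ≟F (c ⊗ τ)) * (a v w * a v' w')))

        square : (V → V → Carrier → ℤ) → Carrier → ℤ
        square X τ = ∑ Vs (λ v' → ∑ Vs (λ w → X v' w τ * X v' w τ))

        -- AM-GM separates the two transforms. At τ = 0 only nonnegativity of squares is used;
        -- keeping the squares there completes the sum to all τ, as Plancherel requires.
        nzE-≤ : ∀ c τ → 2ℤ * (nz τ * E c τ) ≤ square B τ + square C (c ⊗ τ)
        nzE-≤ c τ with τ ≟F 0#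
        ... | yes _ = ℤP.+-mono-≤ (square-nonneg B τ) (square-nonneg C (c ⊗ τ))
          where
          square-nonneg : ∀ X τ → 0ℤ ≤ square X τ
          square-nonneg X τ = ∑-nonneg Vs (λ v' → ∑-nonneg Vs (λ w → 0≤² (X v' w τ)))
        ... | no _  = ℤP.≤-trans (ℤP.≤-reflexive (trans (cong (2ℤ *_) (ℤP.*-identityˡ (E c τ)))
                (trans (sym (∑-*ˡ Vs 2ℤ _)) (∑-cong Vs (λ v' → sym (∑-*ˡ Vs 2ℤ (λ w → B v' w τ * C v' w (c ⊗ τ))))))))
                (ℤP.≤-trans (∑-mono Vs (λ v' → ∑-mono Vs (λ w → 2xy≤x²+y² (B v' w τ) (C v' w (c ⊗ τ)))))
                (ℤP.≤-reflexive (trans (∑-cong Vs (λ v' → ∑-+ Vs _ _)) (∑-+ Vs _ _))))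

        ∑B² : ∑ elems (square B) ≡ (q * q - q) * N
        ∑B² = begin
          ∑ elems (λ τ → ∑ Vs (λ v' → ∑ Vs (λ w → B v' w τ * B v' w τ)))
            ≡⟨ trans (∑-swap elems Vs _) (trans (∑-cong Vs (λ v' → ∑-swap elems Vs _)) (∑-swap Vs Vs _)) ⟩
          ∑ Vs (λ w → ∑ Vs (λ v' → ∑ elems (λ τ → B v' w τ * B v' w τ)))
            ≡⟨ ∑-cong Vs (λ w → radon (λ r v → wedge v r) rot wedge-rot rot-injective (λ v → a v w) (∑-transferˡ w)) ⟩
          ∑ Vs (λ w → (q * q - q) * ∑ Vs (λ v → a v w * a v w))
            ≡⟨ ∑-*ˡ Vs (q * q - q) (λ w → ∑ Vs (λ v → a v w * a v w)) ⟩
          (q * q - q) * ∑ Vs (λ w → ∑ Vs (λ v → a v w * a v w))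
            ≡⟨ cong ((q * q - q) *_) (∑-swap Vs Vs _) ⟩
          (q * q - q) * N ∎

        ∑C² : ∑ elems (square C) ≡ (q * q - q) * N
        ∑C² = begin
          ∑ elems (λ τ → ∑ Vs (λ v' → ∑ Vs (λ w → C v' w τ * C v' w τ)))
            ≡⟨ trans (∑-swap elems Vs _) (∑-cong Vs (λ v' → ∑-swap elems Vs _)) ⟩
          ∑ Vs (λ v' → ∑ Vs (λ w → ∑ elems (λ τ → C v' w τ * C v' w τ)))
            ≡⟨ ∑-cong Vs (λ v' → radon wedge rot′ wedge-rot′ rot′-injective (a v') (∑-transferʳ v')) ⟩
          ∑ Vs (λ v' → (q * q - q) * ∑ Vs (λ w' → a v' w' * a v' w'))
            ≡⟨ ∑-*ˡ Vs (q * q - q) (λ v' → ∑ Vs (λ w' → a v' w' * a v' w')) ⟩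
          (q * q - q) * N ∎

        ∑W : 2ℤ * ∑ Vs (λ v → ∑ Vs (λ v' → nz (wedge v v') * W v v')) ≤ 2ℤ * (∣P∣ * ((q * q - q) * N))
        ∑W = ℤP.≤-trans (ℤP.≤-reflexive (trans (cong (2ℤ *_) ∑W≡) (trans (sym (∑-*ˡ elems 2ℤ (λ c → μ c * ∑ elems (λ τ → nz τ * E c τ))))
                (∑-cong elems (λ c → trans (regroup (μ c) (∑ elems (λ τ → nz τ * E c τ))) (cong (μ c *_) (sym (∑-*ˡ elems 2ℤ (λ τ → nz τ * E c τ)))))))))
             (ℤP.≤-trans (∑-mono elems (λ c → *-mono-≤-0≤ (0≤𝟙 (P? c)) (∑-mono elems (nzE-≤ c))))
             (ℤP.≤-reflexive (trans (∑-cong elems (λ c → 𝟙-guard (P? c) (λ Pc →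
                -- Multiplication by c ∈ P permutes the field, so the shift from τ to c τ disappears
                -- after summation.
                trans (∑-+ elems _ _) (cong₂ _+_ ∑B² (trans (∑-scale c (P≢0 c Pc) (square C)) ∑C²)))))
               (trans (∑-*ʳ elems ((q * q - q) * N + (q * q - q) * N) μ) (double ∣P∣ ((q * q - q) * N))))))
          where
          regroup : ∀ c y → + 2 * (c * y) ≡ c * (+ 2 * y)
          regroup = solve-∀
          double : ∀ p x → p * (x + x) ≡ + 2 * (p * x)
          double = solve-∀

        ∑χbb-≤ : ∑ allMat (λ x → χ x * (b x * b x)) ≤ λ₂ * N
        ∑χbb-≤ = ℤP.*-cancelˡ-≤-pos _ _ 2ℤ (ℤP.≤-trans (ℤP.≤-reflexive (trans (cong (2ℤ *_) ∑χbb)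
                (trans (sym (∑-*ˡ Vs 2ℤ (λ v → ∑ Vs (Q v)))) (∑-cong Vs (λ v → sym (∑-*ˡ Vs 2ℤ (Q v)))))))
                (ℤP.≤-trans (∑-mono Vs (λ v → ∑-mono Vs (Q-≤ v)))
                (ℤP.≤-trans (ℤP.≤-reflexive (trans (∑-cong Vs (λ v → ∑-+ Vs _ _)) (trans (∑-+ Vs _ _) (cong (_+_ (∑ Vs (λ v → ∑ Vs (λ v' → z v v' * (A v + A v')))))
                (trans (∑-cong Vs (λ v → trans (∑-cong Vs (λ v' → regroup (nz (wedge v v')) (W v v'))) (∑-*ˡ Vs 2ℤ (λ v' → nz (wedge v v') * W v v')))) (∑-*ˡ Vs 2ℤ _))))))
                (ℤP.≤-trans (ℤP.+-mono-≤ ∑zA ∑W) (ℤP.≤-reflexive (tidy q ∣P∣ N))))))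
          where
          regroup : ∀ c y → c * (+ 2 * y) ≡ + 2 * (c * y)
          regroup = solve-∀
          tidy : ∀ q p N → + 2 * (q * (q * p) * N) + + 2 * (p * ((q * q - q) * N)) ≡ + 2 * (q * p * (+ 2 * q - 1ℤ) * N)
          tidy = solve-∀

      -- Since ⟨k , b⟩ = N and ‖b‖² ≤ λ₂ N, positivity of ‖λ₂ k - b‖² gives λ₂ N ≤ λ₂² ‖k‖². This
      -- passes from the adjoint to the operator itself without any eigenvalues.
      transfer-bound : 0ℤ < λ₂ → ∥ transfer k ∥² ≤ λ₂ * ∑ allMat (λ x → k x * k x)
      transfer-bound 0<λ = cancel (ℤP.0≤i-j⇒j≤i (ℤP.≤-trans nonneg (ℤP.≤-reflexive (tidy λ₂ K N))))
        where
        K = ∑ allMat (λ x → k x * k x)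
        cancel : λ₂ * N ≤ λ₂ * (λ₂ * K) → N ≤ λ₂ * K
        cancel = ℤP.*-cancelˡ-≤-pos N (λ₂ * K) λ₂ {{ℤ.positive 0<λ}}
        tidy : ∀ l K N → l * l * K + - (+ 2 * l) * N + l * N ≡ l * (l * K) - l * N
        tidy = solve-∀
        expand : ∀ x → χ x * ((λ₂ * k x - b x) * (λ₂ * k x - b x)) ≡ λ₂ * λ₂ * (k x * k x) + - (2ℤ * λ₂) * (k x * b x) + χ x * (b x * b x)
        expand x = begin
          χ x * ((λ₂ * k x - b x) * (λ₂ * k x - b x))
            ≡⟨ square-expand (χ x) λ₂ (k x) (b x) ⟩
          λ₂ * λ₂ * (χ x * k x * k x) + - (2ℤ * λ₂) * (χ x * k x * b x) + χ x * (b x * b x)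
            ≡⟨ cong (λ y → λ₂ * λ₂ * (y * k x) + - (2ℤ * λ₂) * (y * b x) + χ x * (b x * b x)) (supp x) ⟨
          λ₂ * λ₂ * (k x * k x) + - (2ℤ * λ₂) * (k x * b x) + χ x * (b x * b x) ∎
          where
          square-expand : ∀ c l k b → c * ((l * k - b) * (l * k - b)) ≡ l * l * (c * k * k) + - (+ 2 * l) * (c * k * b) + c * (b * b)
          square-expand = solve-∀
        nonneg : 0ℤ ≤ λ₂ * λ₂ * K + - (2ℤ * λ₂) * N + λ₂ * N
        nonneg = ℤP.≤-trans (∑-nonneg allMat (λ x → 0≤-* (0≤𝟙 (P? (det x))) (0≤² (λ₂ * k x - b x))))
          (ℤP.≤-trans (ℤP.≤-reflexive (trans (∑-cong allMat expand) (trans (∑-+ allMat _ _)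
              (cong (_+ ∑ allMat (λ x → χ x * (b x * b x))) (trans (∑-+ allMat _ _) (cong₂ _+_ (∑-*ˡ allMat (λ₂ * λ₂) (λ x → k x * k x))
                (trans (∑-*ˡ allMat (- (2ℤ * λ₂)) (λ x → k x * b x)) (cong (- (2ℤ * λ₂) *_) ∑kb))))))))
            (ℤP.+-monoʳ-≤ (λ₂ * λ₂ * K + - (2ℤ * λ₂) * N) ∑χbb-≤))

  -- From a quadratic form in two parameters to a bound on the product

  0<-* : ∀ {a b} → 0ℤ < a → 0ℤ < b → 0ℤ < a * b
  0<-* {a} {b} 0<a 0<b = subst (_< a * b) (ℤP.*-zeroʳ a) (ℤP.*-monoˡ-<-pos a {{ℤ.positive 0<a}} 0<b)

  -- The hypothesis is the nonnegativity of a binary quadratic form, whose discriminant gives (L -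
  -- 1)²στ ≤ (nL - σ)(nL - τ). If στ > n², then σ + τ ≥ 2n by AM-GM, the right side is at most n²L²
  -- - 2n²L + στ, and hence L(L - 2)(στ - n²) ≤ 0, which is false for L ≥ 3.
  cross-bound : ∀ n L σ τ → 0ℤ ≤ n → 0ℤ ≤ σ → 0ℤ ≤ τ → + 3 ≤ L →
                (∀ s t → 2ℤ * (s * t) * ((L - 1ℤ) * (σ * τ)) ≤ s * s * (σ * (n * L - σ)) + t * t * (τ * (n * L - τ))) →
                σ * τ ≤ n * n
  cross-bound n L σ τ 0≤n 0≤σ 0≤τ 3≤L H with σ * τ ℤ.≤? n * n
  ... | yes στ≤n² = στ≤n²
  ... | no  στ≰n² = ⊥-elim contra
    where
    A B C : ℤ
    A = σ * (n * L - σ)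
    B = τ * (n * L - τ)
    C = (L - 1ℤ) * (σ * τ)

    n²<στ : n * n < σ * τ
    n²<στ = ℤP.≰⇒> στ≰n²

    0<στ : 0ℤ < σ * τ
    0<στ = ℤP.≤-<-trans (0≤² n) n²<στ

    0≤L-3 : 0ℤ ≤ L - + 3
    0≤L-3 = ℤP.i≤j⇒0≤j-i 3≤L

    0<L-1 : 0ℤ < L - 1ℤ
    0<L-1 = ℤP.<-≤-trans (ℤ.+<+ (ℕ.s≤s ℕ.z≤n)) (ℤP.0≤i-j⇒j≤i {L - 1ℤ} {+ 2} (subst (0ℤ ≤_) (shift L) 0≤L-3))
      where
      shift : ∀ L → L - + 3 ≡ L - 1ℤ - + 2
      shift = solve-∀

    0<L : 0ℤ < L
    0<L = ℤP.<-≤-trans (ℤ.+<+ (ℕ.s≤s ℕ.z≤n)) 3≤L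

    0<L-2 : 0ℤ < L - 2ℤ
    0<L-2 = ℤP.<-≤-trans (ℤ.+<+ (ℕ.s≤s ℕ.z≤n)) (ℤP.0≤i-j⇒j≤i {L - 2ℤ} {1ℤ} (subst (0ℤ ≤_) (shift L) 0≤L-3))
      where
      shift : ∀ L → L - + 3 ≡ L - + 2 - 1ℤ
      shift = solve-∀

    0<C : 0ℤ < C
    0<C = 0<-* 0<L-1 0<στ

    -- With B ≤ 0 the quadratic form in (1 , t) would be bounded above although it contains the term 2Ct.
    0<B : 0ℤ < B
    0<B with B ℤ.≤? 0ℤ
    ... | no  B≰0 = ℤP.≰⇒> B≰0
    ... | yes B≤0 = ⊥-elim (ℤP.<-irrefl refl (ℤP.<-≤-trans 0<excess (*-mono-≤-0≤ {2ℤ} (+≤+ ℕ.z≤n) excess≤0)))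
      where
      -- Any t ≥ 0 with 2t > A would do; A² + 1 works whatever the sign of A.
      t : ℤ
      t = A * A + 1ℤ
      1≤C : 1ℤ ≤ C
      1≤C = ℤP.i<j⇒suc[i]≤j 0<C
      excess≤0 : 2ℤ * t - A ≤ 0ℤ
      excess≤0 = ℤP.0≤i-j⇒j≤i (subst (0ℤ ≤_) (sum t A B C)
        (ℤP.+-mono-≤ {0ℤ} {_} {0ℤ} (ℤP.i≤j⇒0≤j-i (H 1ℤ t)) (ℤP.+-mono-≤ {0ℤ} {_} {0ℤ} (0≤-* (0≤² t) (ℤP.i≤j⇒0≤j-i B≤0))
          (0≤-* (0≤-* {2ℤ} {t} (+≤+ ℕ.z≤n) (ℤP.+-mono-≤ {0ℤ} {A * A} {0ℤ} {1ℤ} (0≤² A) (+≤+ ℕ.z≤n))) (ℤP.i≤j⇒0≤j-i 1≤C)))))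
        where
        sum : ∀ t A B C → (1ℤ * 1ℤ * A + t * t * B - + 2 * (1ℤ * t) * C) + (t * t * (0ℤ - B) + + 2 * t * (C - 1ℤ)) ≡ 0ℤ - (+ 2 * t - A)
        sum = solve-∀
      0<excess : 0ℤ < 2ℤ * (2ℤ * t - A)
      0<excess = subst (0ℤ <_) (sum A) (ℤP.+-mono-≤-< {0ℤ} {+ 3 * (A * A)} {0ℤ} (0≤-* {+ 3} (+≤+ ℕ.z≤n) (0≤² A))
                (ℤP.+-mono-≤-< {0ℤ} {(A - 1ℤ) * (A - 1ℤ)} {0ℤ} {+ 3} (0≤² (A - 1ℤ)) (ℤ.+<+ (ℕ.s≤s ℕ.z≤n))))
        where
        sum : ∀ A → + 3 * (A * A) + ((A - 1ℤ) * (A - 1ℤ) + + 3) ≡ + 2 * (+ 2 * (A * A + 1ℤ) - A)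
        sum = solve-∀

    -- For fixed s the form is minimal at t = sC/B, which the choice s = B, t = C makes integral.
    -- The resulting common factor B is cancelled.
    C²≤AB : C * C ≤ A * B
    C²≤AB = ℤP.*-cancelˡ-≤-pos (C * C) (A * B) B {{ℤ.positive 0<B}} (ℤP.0≤i-j⇒j≤i (subst (0ℤ ≤_) (sum A B C) (ℤP.i≤j⇒0≤j-i (H B C))))
      where
      sum : ∀ A B C → B * B * A + C * C * B - + 2 * (B * C) * C ≡ B * (A * B) - B * (C * C)
      sum = solve-∀

    D : ℤ
    D = (n * L - σ) * (n * L - τ)

    cancelled : (L - 1ℤ) * (L - 1ℤ) * (σ * τ) ≤ D
    cancelled = ℤP.*-cancelˡ-≤-pos ((L - 1ℤ) * (L - 1ℤ) * (σ * τ)) D (σ * τ) {{ℤ.positive 0<στ}}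
      (subst₂ _≤_ (lhs (L - 1ℤ) (σ * τ)) (rhs σ τ (n * L)) C²≤AB)
      where
      lhs : ∀ l s → (l * s) * (l * s) ≡ s * (l * l * s)
      lhs = solve-∀
      rhs : ∀ σ τ N → (σ * (N - σ)) * (τ * (N - τ)) ≡ (σ * τ) * ((N - σ) * (N - τ))
      rhs = solve-∀

    2n≤σ+τ : 2ℤ * n ≤ σ + τ
    2n≤σ+τ with 2ℤ * n ℤ.≤? σ + τ
    ... | yes p = p
    ... | no ¬p = ⊥-elim (ℤP.<-irrefl refl (ℤP.<-≤-trans n²<στ (ℤP.*-cancelˡ-≤-pos (σ * τ) (n * n) (+ 4) (ℤP.0≤i-j⇒j≤i
        (subst (0ℤ ≤_) (sum n σ τ) (ℤP.+-mono-≤ {0ℤ} {(σ - τ) * (σ - τ)} {0ℤ} (0≤² (σ - τ))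
          (0≤-* (ℤP.i≤j⇒0≤j-i (ℤP.<⇒≤ (ℤP.≰⇒> ¬p)))
                (ℤP.+-mono-≤ {0ℤ} {2ℤ * n} {0ℤ} (0≤-* {2ℤ} (+≤+ ℕ.z≤n) 0≤n) (ℤP.+-mono-≤ {0ℤ} {σ} {0ℤ} 0≤σ 0≤τ)))))))))
      where
      sum : ∀ n σ τ → (σ - τ) * (σ - τ) + (+ 2 * n - (σ + τ)) * (+ 2 * n + (σ + τ)) ≡ + 4 * (n * n) - + 4 * (σ * τ)
      sum = solve-∀

    contra : ⊥
    contra = ℤP.<-irrefl refl (ℤP.<-≤-trans (0<-* (0<-* 0<L 0<L-2) 0<gap) gap≤0)
      where
      0<gap : 0ℤ < σ * τ - n * n
      0<gap = ℤP.<-≤-trans (ℤ.+<+ (ℕ.s≤s ℕ.z≤n)) (ℤP.0≤i-j⇒j≤i {j = 1ℤ} (subst (0ℤ ≤_) (shift (σ * τ) (n * n)) (ℤP.i≤j⇒0≤j-i (ℤP.i<j⇒suc[i]≤j n²<στ))))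
        where
        shift : ∀ a b → a - (1ℤ + b) ≡ a - b - 1ℤ
        shift = solve-∀
      gap≤0 : L * (L - 2ℤ) * (σ * τ - n * n) ≤ 0ℤ
      gap≤0 = ℤP.0≤i-j⇒j≤i (subst (0ℤ ≤_) (sum n L σ τ) (ℤP.+-mono-≤ {0ℤ} {_} {0ℤ} (ℤP.i≤j⇒0≤j-i cancelled)
                (0≤-* (0≤-* 0≤n (ℤP.<⇒≤ 0<L)) (ℤP.i≤j⇒0≤j-i 2n≤σ+τ))))
        where
        sum : ∀ n L σ τ → ((n * L - σ) * (n * L - τ) - (L - 1ℤ) * (L - 1ℤ) * (σ * τ)) + n * L * (σ + τ - + 2 * n) ≡ 0ℤ - L * (L - + 2) * (σ * τ - n * n)
        sum = solve-∀

  -- The Hoffman-type inequality for two functions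

  module CrossBound (F : FiniteField)
                (P : FiniteField.Carrier F → Set)
                (P? : (c : FiniteField.Carrier F) → Dec (P c))
                (P≢0 : (c : FiniteField.Carrier F) → P c → c ≢ FiniteField.0# F) where
    open Plane F
    open Spectral F P P? P≢0
    open SpectralBound F P P? P≢0
    open GL2 F using (Mat; allMat)
    open ≡-Reasoning

    -- On the right v = 𝟘 is counted as well, where all matrices agree. Its contribution is the
    -- product of the two total sums, which is zero.
    form-transfer : ∀ k k' → ∑ allMat k ≡ 0ℤ → form k k' ≡ ∑ Vs (λ v → ∑ Vs (λ w → transfer k v w * transfer k' v w))
    form-transfer k k' ∑k≡0 = sym (begin
      ∑ Vs (λ v → ∑ Vs (λ w → transfer k v w * transfer k' v w))
        ≡⟨ ∑-cong Vs (λ v → column v) ⟩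
      ∑ Vs (λ v → ∑ allMat (λ x → ∑ allMat (λ y → 𝟙 ((y ▹ v) ≟V (x ▹ v)) * (k x * k' y))))
        ≡⟨ trans (∑-swap Vs allMat _) (∑-cong allMat (λ x → ∑-swap Vs allMat _)) ⟩
      ∑ allMat (λ x → ∑ allMat (λ y → ∑ Vs (λ v → 𝟙 ((y ▹ v) ≟V (x ▹ v)) * (k x * k' y))))
        ≡⟨ ∑-cong allMat (λ x → ∑-cong allMat (λ y → trans (∑-*ʳ Vs (k x * k' y) (λ v → 𝟙 ((y ▹ v) ≟V (x ▹ v))))
             (trans (cong (_* (k x * k' y)) (trans (full y x) (cong (_+ 1ℤ) (T-sym y x)))) (distr (T x y) (k x) (k' y))))) ⟩
      ∑ allMat (λ x → ∑ allMat (λ y → k x * k' y * T x y + k x * k' y))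
        ≡⟨ trans (∑-cong allMat (λ x → ∑-+ allMat _ _)) (∑-+ allMat _ _) ⟩
      form k k' + ∑ allMat (λ x → ∑ allMat (λ y → k x * k' y))
        ≡⟨ cong (_+_ (form k k')) (trans (sym (∑-*-∑ allMat allMat k k')) (trans (cong (_* ∑ allMat k') ∑k≡0) refl)) ⟩
      form k k' + 0ℤ
        ≡⟨ ℤP.+-identityʳ (form k k') ⟩
      form k k' ∎)
      where
      distr : ∀ t x y → (t + 1ℤ) * (x * y) ≡ x * y * t + x * y
      distr = solve-∀
      regroup : ∀ i x k y → (i * x) * (k * y) ≡ i * (k * (x * y))
      regroup = solve-∀
      split : ∀ i e → e ≡ (1ℤ - i) * e + i * e
      split = solve-∀
      full : ∀ y x → ∑ Vs (λ v → 𝟙 ((y ▹ v) ≟V (x ▹ v))) ≡ T y x + 1ℤ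
      full y x = begin
        ∑ Vs (λ v → 𝟙 ((y ▹ v) ≟V (x ▹ v)))
          ≡⟨ ∑-cong Vs (λ v → split (𝟙 (v ≟V 𝟘)) (𝟙 ((y ▹ v) ≟V (x ▹ v)))) ⟩
        ∑ Vs (λ v → u v * 𝟙 ((y ▹ v) ≟V (x ▹ v)) + 𝟙 (v ≟V 𝟘) * 𝟙 ((y ▹ v) ≟V (x ▹ v)))
          ≡⟨ ∑-+ Vs _ _ ⟩
        T y x + ∑ Vs (λ v → 𝟙 (v ≟V 𝟘) * 𝟙 ((y ▹ v) ≟V (x ▹ v)))
          ≡⟨ cong (_+_ (T y x)) (trans (Enum.sift EV 𝟘 (λ v → 𝟙 ((y ▹ v) ≟V (x ▹ v)))) (𝟙-true ((y ▹ 𝟘) ≟V (x ▹ 𝟘)) (trans (▹-𝟘 y) (sym (▹-𝟘 x))))) ⟩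
        T y x + 1ℤ ∎
      column : ∀ v → ∑ Vs (λ w → transfer k v w * transfer k' v w) ≡ ∑ allMat (λ x → ∑ allMat (λ y → 𝟙 ((y ▹ v) ≟V (x ▹ v)) * (k x * k' y)))
      column v = begin
        ∑ Vs (λ w → transfer k v w * transfer k' v w)
          ≡⟨ ∑-cong Vs (λ w → trans (∑-*-∑ allMat allMat _ _) (∑-cong allMat (λ x → ∑-cong allMat (λ y →
               regroup (𝟙 ((x ▹ v) ≟V w)) (k x) (𝟙 ((y ▹ v) ≟V w)) (k' y))))) ⟩
        ∑ Vs (λ w → ∑ allMat (λ x → ∑ allMat (λ y → 𝟙 ((x ▹ v) ≟V w) * (𝟙 ((y ▹ v) ≟V w) * (k x * k' y)))))
          ≡⟨ trans (∑-swap Vs allMat _) (∑-cong allMat (λ x → ∑-swap Vs allMat _)) ⟩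
        ∑ allMat (λ x → ∑ allMat (λ y → ∑ Vs (λ w → 𝟙 ((x ▹ v) ≟V w) * (𝟙 ((y ▹ v) ≟V w) * (k x * k' y)))))
          ≡⟨ ∑-cong allMat (λ x → ∑-cong allMat (λ y → Enum.sift′ EV (x ▹ v) (λ w → 𝟙 ((y ▹ v) ≟V w) * (k x * k' y)))) ⟩
        ∑ allMat (λ x → ∑ allMat (λ y → 𝟙 ((y ▹ v) ≟V (x ▹ v)) * (k x * k' y))) ∎

    module _ (f : Mat → ℤ) (sf : Supp f) where
      Σ₁ Σ₂ : ℤ
      Σ₁ = ∑ allMat f
      Σ₂ = ∑ allMat (λ x → f x * f x)

      -- n times the projection of f orthogonal to `χ`, scaled so as to stay in ℤ.
      centred : Mat → ℤ
      centred x = n * f x + (- Σ₁) * χ x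

      centred-supp : Supp centred
      centred-supp x = begin
        n * f x + (- Σ₁) * χ x ≡⟨ cong₂ (λ a b → n * a + (- Σ₁) * b) (sf x) (χ-supp x) ⟩
        n * (χ x * f x) + (- Σ₁) * (χ x * χ x) ≡⟨ factor n Σ₁ (χ x) (f x) ⟩
        χ x * (n * f x + (- Σ₁) * χ x) ∎
        where
        factor : ∀ n s c y → n * (c * y) + (- s) * (c * c) ≡ c * (n * y + (- s) * c)
        factor = solve-∀

      ∑-centred : ∑ allMat centred ≡ 0ℤ
      ∑-centred = begin
        ∑ allMat centred ≡⟨ trans (∑-+ allMat _ _) (cong₂ _+_ (∑-*ˡ allMat n f) (∑-*ˡ allMat (- Σ₁) χ)) ⟩
        n * Σ₁ + (- Σ₁) * n ≡⟨ vanish n Σ₁ ⟩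
        0ℤ ∎
        where
        vanish : ∀ n s → n * s + (- s) * n ≡ 0ℤ
        vanish = solve-∀

      ∑-centred² : ∑ allMat (λ x → centred x * centred x) ≡ n * n * Σ₂ - n * (Σ₁ * Σ₁)
      ∑-centred² = begin
        ∑ allMat (λ x → centred x * centred x)
          ≡⟨ ∑-cong allMat expand ⟩
        ∑ allMat (λ x → n * n * (f x * f x) + (- (2ℤ * n * Σ₁) * f x + Σ₁ * Σ₁ * χ x))
          ≡⟨ trans (∑-+ allMat _ _) (cong₂ _+_ (∑-*ˡ allMat (n * n) (λ x → f x * f x))
               (trans (∑-+ allMat _ _) (cong₂ _+_ (∑-*ˡ allMat (- (2ℤ * n * Σ₁)) f) (∑-*ˡ allMat (Σ₁ * Σ₁) χ)))) ⟩
        n * n * Σ₂ + (- (2ℤ * n * Σ₁) * Σ₁ + Σ₁ * Σ₁ * n)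
          ≡⟨ tidy n Σ₁ Σ₂ ⟩
        n * n * Σ₂ - n * (Σ₁ * Σ₁) ∎
        where
        tidy : ∀ n s t → n * n * t + (- (+ 2 * n * s) * s + s * s * n) ≡ n * n * t - n * (s * s)
        tidy = solve-∀
        square : ∀ n s y c → (n * y + (- s) * c) * (n * y + (- s) * c) ≡ n * n * (y * y) + (- (+ 2 * n * s) * (c * y) + s * s * (c * c))
        square = solve-∀
        expand : ∀ x → centred x * centred x ≡ n * n * (f x * f x) + (- (2ℤ * n * Σ₁) * f x + Σ₁ * Σ₁ * χ x)
        expand x = trans (square n Σ₁ (f x) (χ x))
          (cong₂ (λ a b → n * n * (f x * f x) + (- (2ℤ * n * Σ₁) * a + Σ₁ * Σ₁ * b)) (sym (sf x)) (sym (χ-supp x)))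

    form-centred : ∀ f g (sf : Supp f) (sg : Supp g) →
                form (centred f sf) (centred g sg) ≡ n * n * form f g - n * n * (Σ₁ f sf * Σ₁ g sg)
    form-centred f g sf sg = begin
      form (centred f sf) (centred g sg)
        ≡⟨ form-linearˡ n (- σ) f χ (centred g sg) ⟩
      n * form f (centred g sg) + (- σ) * form χ (centred g sg)
        ≡⟨ cong₂ (λ a b → n * a + (- σ) * b)
             (trans (form-linearʳ n (- τ) f g χ) (cong (λ z → n * form f g + (- τ) * z) (form-χʳ f sf)))
             (trans (form-sym χ (centred g sg)) (trans (form-χʳ (centred g sg) (centred-supp g sg)) (cong (n *_) (∑-centred g sg)))) ⟩
      n * (n * form f g + (- τ) * (n * σ)) + (- σ) * (n * 0ℤ)
        ≡⟨ tidy n σ τ (form f g) ⟩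
      n * n * form f g - n * n * (σ * τ) ∎
      where
      σ = Σ₁ f sf
      τ = Σ₁ g sg
      tidy : ∀ n σ τ z → n * (n * z + (- τ) * (n * σ)) + (- σ) * (n * 0ℤ) ≡ n * n * z - n * n * (σ * τ)
      tidy = solve-∀

    module _ (L : ℤ) (3≤L : + 3 ≤ L) (0<λ₂ : 0ℤ < λ₂) (gap : (L - 1ℤ) * λ₂ ≤ n)
             (f g : Mat → ℤ) (sf : Supp f) (sg : Supp g) (0≤f : ∀ x → 0ℤ ≤ f x) (0≤g : ∀ x → 0ℤ ≤ g x)
             (local : ∀ s t x y v → P (det x) → P (det y) → v ≢ 𝟘 → x ▹ v ≡ y ▹ v →
                2ℤ * (s * t) * (L - 1ℤ) * (f x * g y) ≤ s * s * (L * f x - f x * f x) + t * t * (L * g y - g y * g y))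
             where
      private
        σ τ Φ Ψ Z : ℤ
        σ = Σ₁ f sf
        τ = Σ₁ g sg
        Φ = Σ₂ f sf
        Ψ = Σ₂ g sg
        Z = form f g

        0≤L-1 : 0ℤ ≤ L - 1ℤ
        0≤L-1 = ℤP.i≤j⇒0≤j-i (ℤP.≤-trans (+≤+ (ℕ.s≤s ℕ.z≤n)) 3≤L)

        0<n : 0ℤ < n
        0<n = ℤP.<-≤-trans (0<-* {L - 1ℤ} (ℤP.<-≤-trans (ℤ.+<+ (ℕ.s≤s ℕ.z≤n)) (ℤP.0≤i-j⇒j≤i {j = + 2} (subst (0ℤ ≤_) (shift L) (ℤP.i≤j⇒0≤j-i 3≤L)))) 0<λ₂) gap
          where
          shift : ∀ L → L - + 3 ≡ L - 1ℤ - + 2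
          shift = solve-∀

        ∑-local : ∀ s h (sh : Supp h) → ∑ allMat (λ x → χ x * (s * s * (L * h x - h x * h x))) ≡ s * s * (L * Σ₁ h sh - Σ₂ h sh)
        ∑-local s h sh = begin
          ∑ allMat (λ x → χ x * (s * s * (L * h x - h x * h x)))
            ≡⟨ ∑-cong allMat (λ x → trans (factor (χ x) s L (h x)) (cong (λ y → s * s * L * y + - (s * s) * (y * h x)) (sym (sh x)))) ⟩
          ∑ allMat (λ x → s * s * L * h x + - (s * s) * (h x * h x))
            ≡⟨ trans (∑-+ allMat _ _) (cong₂ _+_ (∑-*ˡ allMat (s * s * L) h) (∑-*ˡ allMat (- (s * s)) (λ x → h x * h x))) ⟩
          s * s * L * Σ₁ h sh + - (s * s) * Σ₂ h sh
            ≡⟨ tidy s L (Σ₁ h sh) (Σ₂ h sh) ⟩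
          s * s * (L * Σ₁ h sh - Σ₂ h sh) ∎
          where
          factor : ∀ c s L y → c * (s * s * (L * y - y * y)) ≡ s * s * L * (c * y) + - (s * s) * (c * y * y)
          factor = solve-∀
          tidy : ∀ s L a b → s * s * L * a + - (s * s) * b ≡ s * s * (L * a - b)
          tidy = solve-∀

        upper : ∀ s t → 2ℤ * (s * t) * (L - 1ℤ) * Z ≤ n * (s * s * (L * σ - Φ) + t * t * (L * τ - Ψ))
        upper s t = ℤP.≤-trans (form-≤ (2ℤ * (s * t) * (L - 1ℤ)) f g (λ x → s * s * (L * f x - f x * f x)) (λ x → t * t * (L * g x - g x * g x)) sf sg (local s t))
                (ℤP.≤-reflexive (cong (n *_) (cong₂ _+_ (∑-local s f sf) (∑-local t g sg))))

        -- AM-GM is applied to -s a and t a', the sign being chosen so that the norm bound limits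
        -- how far `Z` can fall below στ when st > 0.
        lower : ∀ s t → - (2ℤ * (s * t) * (n * n * Z - n * n * (σ * τ)))
                ≤ λ₂ * (s * s * (n * n * Φ - n * (σ * σ)) + t * t * (n * n * Ψ - n * (τ * τ)))
        lower s t = ℤP.≤-trans (ℤP.≤-reflexive (trans (cong (λ z → - (2ℤ * (s * t) * z)) (trans (sym (form-centred f g sf sg)) (form-transfer kf kg (∑-centred f sf))))
                (trans (outer s t (∑ Vs (λ v → ∑ Vs (λ w → a v w * a' v w))))
                (trans (sym (∑-*ˡ Vs (- (2ℤ * (s * t))) (λ v → ∑ Vs (λ w → a v w * a' v w))))
                (∑-cong Vs (λ v → trans (sym (∑-*ˡ Vs (- (2ℤ * (s * t))) (λ w → a v w * a' v w)))
                (∑-cong Vs (λ w → inner s t (a v w) (a' v w)))))))))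
                (ℤP.≤-trans (∑-mono Vs (λ v → ∑-mono Vs (λ w → 2xy≤x²+y² ((- s) * a v w) (t * a' v w))))
                (ℤP.≤-trans (ℤP.≤-reflexive (trans (∑-cong Vs (λ v → trans (∑-cong Vs (λ w → squares s t (a v w) (a' v w)))
                (trans (∑-+ Vs _ _) (cong₂ _+_ (∑-*ˡ Vs (s * s) (λ w → a v w * a v w)) (∑-*ˡ Vs (t * t) (λ w → a' v w * a' v w))))))
                (trans (∑-+ Vs _ _) (cong₂ _+_ (∑-*ˡ Vs (s * s) (λ v → ∑ Vs (λ w → a v w * a v w))) (∑-*ˡ Vs (t * t) (λ v → ∑ Vs (λ w → a' v w * a' v w)))))))
                (ℤP.≤-trans (ℤP.+-mono-≤ (*-mono-≤-0≤ (0≤² s) (transfer-bound kf (centred-supp f sf) (∑-centred f sf) 0<λ₂))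
                (*-mono-≤-0≤ (0≤² t) (transfer-bound kg (centred-supp g sg) (∑-centred g sg) 0<λ₂)))
                (ℤP.≤-reflexive (trans (cong₂ (λ x y → s * s * (λ₂ * x) + t * t * (λ₂ * y)) (∑-centred² f sf) (∑-centred² g sg))
                (collect s t λ₂ (n * n * Φ - n * (σ * σ)) (n * n * Ψ - n * (τ * τ))))))))
          where
          kf kg : Mat → ℤ
          kf = centred f sf
          kg = centred g sg
          a a' : V → V → ℤ
          a = transfer kf
          a' = transfer kg
          outer : ∀ s t z → - (+ 2 * (s * t) * z) ≡ - (+ 2 * (s * t)) * z
          outer = solve-∀
          inner : ∀ s t x y → - (+ 2 * (s * t)) * (x * y) ≡ + 2 * (((- s) * x) * (t * y))
          inner = solve-∀
          squares : ∀ s t x y → ((- s) * x) * ((- s) * x) + (t * y) * (t * y) ≡ s * s * (x * x) + t * t * (y * y)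
          squares = solve-∀
          collect : ∀ s t l x y → s * s * (l * x) + t * t * (l * y) ≡ l * (s * s * x + t * t * y)
          collect = solve-∀

        0≤variance : ∀ h (sh : Supp h) → 0ℤ ≤ n * n * Σ₂ h sh - n * (Σ₁ h sh * Σ₁ h sh)
        0≤variance h sh = ℤP.≤-trans (∑-nonneg allMat (λ x → 0≤² (centred h sh x))) (ℤP.≤-reflexive (∑-centred² h sh))

        -- n² times `upper` plus (L - 1) times `lower`. Adding the nonnegative variances with factor
        -- n - (L - 1)λ₂ raises (L - 1)λ₂ to n, after which `Z`, `Φ` and `Ψ` cancel and only the
        -- sums σ, τ remain.
        quadratic : ∀ s t → 2ℤ * (s * t) * ((L - 1ℤ) * (σ * τ)) ≤ s * s * (σ * (n * L - σ)) + t * t * (τ * (n * L - τ))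
        quadratic s t = ℤP.*-cancelˡ-≤-pos _ _ (n * n) {{ℤ.positive (0<-* 0<n 0<n)}} (ℤP.0≤i-j⇒j≤i (subst (0ℤ ≤_) (sum n L λ₂ σ τ Φ Ψ Z s t)
          (ℤP.+-mono-≤ {0ℤ} {_} {0ℤ} (0≤-* (0≤² n) (ℤP.i≤j⇒0≤j-i (upper s t)))
            (ℤP.+-mono-≤ {0ℤ} {_} {0ℤ} (0≤-* 0≤L-1 (ℤP.i≤j⇒0≤j-i (lower s t)))
              (0≤-* (ℤP.i≤j⇒0≤j-i gap) (ℤP.+-mono-≤ {0ℤ} {_} {0ℤ} (0≤-* (0≤² s) (0≤variance f sf)) (0≤-* (0≤² t) (0≤variance g sg))))))))
          where
          sum : ∀ n L l σ τ Φ Ψ Z s t →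
                n * n * (n * (s * s * (L * σ - Φ) + t * t * (L * τ - Ψ)) - + 2 * (s * t) * (L - 1ℤ) * Z)
                + ((L - 1ℤ) * (l * (s * s * (n * n * Φ - n * (σ * σ)) + t * t * (n * n * Ψ - n * (τ * τ))) - - (+ 2 * (s * t) * (n * n * Z - n * n * (σ * τ))))
                + (n - (L - 1ℤ) * l) * (s * s * (n * n * Φ - n * (σ * σ)) + t * t * (n * n * Ψ - n * (τ * τ))))
                ≡ n * n * (s * s * (σ * (n * L - σ)) + t * t * (τ * (n * L - τ))) - n * n * (+ 2 * (s * t) * ((L - 1ℤ) * (σ * τ)))
          sum = solve-∀

      sum-product-bound : ∑ allMat f * ∑ allMat g ≤ n * n
      sum-product-bound = cross-bound n L σ τ (ℤP.<⇒≤ 0<n) (∑-nonneg allMat 0≤f) (∑-nonneg allMat 0≤g) 3≤L quadratic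

  -- Powers and residues

  module Powers (R : CommutativeRing 0ℓ 0ℓ) where
    open CommutativeRing R renaming (_+_ to _⊕_; _*_ to _⊗_; refl to ≈-refl; sym to ≈-sym; trans to ≈-trans)
    open import Relation.Binary.Reasoning.Setoid setoid

    _^_ : Carrier → ℕ → Carrier
    _^_ = pow _⊗_ 1#

    ^-congˡ : ∀ {x y} n → x ≈ y → x ^ n ≈ y ^ n
    ^-congˡ zero    e = ≈-refl
    ^-congˡ (suc n) e = *-cong e (^-congˡ n e)

    ^-+ : ∀ x m n → x ^ (m ℕ.+ n) ≈ (x ^ m) ⊗ (x ^ n)
    ^-+ x zero    n = ≈-sym (*-identityˡ _)
    ^-+ x (suc m) n = ≈-trans (*-congˡ (^-+ x m n)) (≈-sym (*-assoc _ _ _))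

    1^ : ∀ n → 1# ^ n ≈ 1#
    1^ zero    = ≈-refl
    1^ (suc n) = ≈-trans (*-identityˡ _) (1^ n)

    ^-distrib : ∀ x y n → (x ⊗ y) ^ n ≈ (x ^ n) ⊗ (y ^ n)
    ^-distrib x y zero    = ≈-sym (*-identityˡ 1#)
    ^-distrib x y (suc n) = begin
      (x ⊗ y) ⊗ ((x ⊗ y) ^ n) ≈⟨ *-congˡ (^-distrib x y n) ⟩
      (x ⊗ y) ⊗ ((x ^ n) ⊗ (y ^ n)) ≈⟨ *-interchange x y (x ^ n) (y ^ n) ⟩
      (x ⊗ (x ^ n)) ⊗ (y ⊗ (y ^ n)) ∎
      where open import Algebra.Properties.CommutativeSemigroup *-commutativeSemigroup renaming (interchange to *-interchange)

    ^-* : ∀ x m n → x ^ (m ℕ.* n) ≈ (x ^ m) ^ n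
    ^-* x zero    n = ≈-sym (1^ n)
    ^-* x (suc m) n = begin
      x ^ (n ℕ.+ m ℕ.* n) ≈⟨ ^-+ x n (m ℕ.* n) ⟩
      (x ^ n) ⊗ (x ^ (m ℕ.* n)) ≈⟨ *-congˡ (^-* x m n) ⟩
      (x ^ n) ⊗ ((x ^ m) ^ n) ≈⟨ ^-distrib x (x ^ m) n ⟨
      (x ⊗ (x ^ m)) ^ n ∎

    ^-multiple : ∀ x {d n} → x ^ d ≈ 1# → d ∣ n → x ^ n ≈ 1#
    ^-multiple x {d} {n} e (divides k refl) = begin
      x ^ (k ℕ.* d) ≡⟨ cong (x ^_) (ℕP.*-comm k d) ⟩
      x ^ (d ℕ.* k) ≈⟨ ^-* x d k ⟩
      (x ^ d) ^ k ≈⟨ ^-congˡ k e ⟩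
      1# ^ k ≈⟨ 1^ k ⟩
      1# ∎

    ^-% : ∀ x d n .{{_ : NonZero d}} → x ^ d ≈ 1# → x ^ n ≈ x ^ (n % d)
    ^-% x d n e = begin
      x ^ n ≡⟨ cong (x ^_) (m≡m%n+[m/n]*n n d) ⟩
      x ^ (n % d ℕ.+ (n / d) ℕ.* d) ≈⟨ ^-+ x (n % d) ((n / d) ℕ.* d) ⟩
      (x ^ (n % d)) ⊗ (x ^ ((n / d) ℕ.* d)) ≈⟨ *-congˡ (^-multiple x e (divides (n / d) refl)) ⟩
      (x ^ (n % d)) ⊗ 1# ≈⟨ *-identityʳ _ ⟩
      x ^ (n % d) ∎

    ^-order : ∀ x d n .{{_ : NonZero d}} → x ^ d ≈ 1# → (∀ r → 0 ℕ.< r → r ℕ.< d → ¬ (x ^ r ≈ 1#)) → x ^ n ≈ 1# → d ∣ n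
    ^-order x d n e minimal eₙ with n % d in eq
    ... | zero  = m%n≡0⇒n∣m n d eq
    ... | suc r = ⊥-elim (minimal (suc r) (ℕ.s≤s ℕ.z≤n) (subst (ℕ._< d) eq (m%n<n n d))
                (≈-trans (≈-sym (subst (λ z → x ^ n ≈ x ^ z) eq (^-% x d n e))) eₙ))

  EFin : ∀ n → Enum (Fin n)
  EFin n = record { els = allFin n ; _≟_ = Fin._≟_ ; sift₁ = λ i → ∑-unique (allFin n) Fin._≟_ (allFin⁺ n) (∈-allFin i) }

  ∑Fin-const : ∀ n c → ∑ (allFin n) (λ _ → c) ≡ + n * c
  ∑Fin-const n c = trans (∑-const (allFin n) c) (cong (λ k → + k * c) (length-tabulate {n = n} (λ i → i)))

  module Residues (ℓ : ℕ) (ℓ-prime : Prime ℓ) (e : ℕ) (ℓ∤e : ¬ (ℓ ∣ e)) where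
    private instance
      ℓ≢0 : NonZero ℓ
      ℓ≢0 = prime⇒nonZero ℓ-prime

    private
      ordered : ∀ j a b → a ℕ.≤ b → b ℕ.< ℓ → ℓ ∣ (j ℕ.+ e ℕ.* b) ℕ.∸ (j ℕ.+ e ℕ.* a) → a ≡ b
      ordered j a b a≤b b<ℓ d with euclidsLemma e (b ℕ.∸ a) ℓ-prime (subst (ℓ ∣_) diff d)
        where
        diff : (j ℕ.+ e ℕ.* b) ℕ.∸ (j ℕ.+ e ℕ.* a) ≡ e ℕ.* (b ℕ.∸ a)
        diff = trans (ℕP.[m+n]∸[m+o]≡n∸o j (e ℕ.* b) (e ℕ.* a)) (sym (ℕP.*-distribˡ-∸ e b a))
      ... | inj₁ ℓ∣e = ⊥-elim (ℓ∤e ℓ∣e)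
      ... | inj₂ ℓ∣b∸a with b ℕ.∸ a in eq
      ...   | zero  = ℕP.≤-antisym a≤b (ℕP.m∸n≡0⇒m≤n eq)
      ...   | suc k = ⊥-elim (ℕP.<⇒≱ (ℕP.≤-<-trans (subst (ℕ._≤ b) eq (ℕP.m∸n≤m b a)) b<ℓ) (∣⇒≤ ℓ∣b∸a))

      %-∸ : ∀ a b → a % ℓ ≡ b % ℓ → ℓ ∣ b ℕ.∸ a
      %-∸ a b eq = divides (b / ℓ ℕ.∸ a / ℓ) (begin
        b ℕ.∸ a ≡⟨ cong₂ ℕ._∸_ (m≡m%n+[m/n]*n b ℓ) (m≡m%n+[m/n]*n a ℓ) ⟩
        (b % ℓ ℕ.+ (b / ℓ) ℕ.* ℓ) ℕ.∸ (a % ℓ ℕ.+ (a / ℓ) ℕ.* ℓ) ≡⟨ cong (λ r → (b % ℓ ℕ.+ (b / ℓ) ℕ.* ℓ) ℕ.∸ (r ℕ.+ (a / ℓ) ℕ.* ℓ)) eq ⟩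
        (b % ℓ ℕ.+ (b / ℓ) ℕ.* ℓ) ℕ.∸ (b % ℓ ℕ.+ (a / ℓ) ℕ.* ℓ) ≡⟨ ℕP.[m+n]∸[m+o]≡n∸o (b % ℓ) _ _ ⟩
        (b / ℓ) ℕ.* ℓ ℕ.∸ (a / ℓ) ℕ.* ℓ ≡⟨ ℕP.*-distribʳ-∸ ℓ (b / ℓ) (a / ℓ) ⟨
        (b / ℓ ℕ.∸ a / ℓ) ℕ.* ℓ ∎)
        where open ≡-Reasoning

    residue-injective : ∀ j (i i' : Fin ℓ) → (j ℕ.+ e ℕ.* toℕ i) % ℓ ≡ (j ℕ.+ e ℕ.* toℕ i') % ℓ → i ≡ i'
    residue-injective j i i' eq with ℕP.≤-total (toℕ i) (toℕ i')
    ... | inj₁ i≤i' = FinP.toℕ-injective (ordered j (toℕ i) (toℕ i') i≤i' (FinP.toℕ<n i') (%-∸ _ _ eq))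
    ... | inj₂ i'≤i = sym (FinP.toℕ-injective (ordered j (toℕ i') (toℕ i) i'≤i (FinP.toℕ<n i) (%-∸ (j ℕ.+ e ℕ.* toℕ i') _ (sym eq))))

    -- If no i reached the residue 0, then ℓ distinct residues would lie among the ℓ - 1 nonzero
    -- ones. Taking predecessors indexes the latter by `Fin (ℕ.pred ℓ)`.
    residue-hit : ∀ j → ∃ λ (i : Fin ℓ) → ℓ ∣ j ℕ.+ e ℕ.* toℕ i
    residue-hit j with FinP.any? (λ i → ℓ ∣? (j ℕ.+ e ℕ.* toℕ {ℓ} i))
    ... | yes hit = hit
    ... | no miss = ⊥-elim (ℕP.<⇒≱ (ℕP.≤-reflexive (ℕP.suc-pred ℓ)) (FinP.injective⇒≤ {f = r} r-injective))
      where
      r-nonzero : ∀ i → NonZero ((j ℕ.+ e ℕ.* toℕ i) % ℓ)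
      r-nonzero i = ℕ.≢-nonZero (λ z → miss (i , m%n≡0⇒n∣m _ ℓ z))
      bound : ∀ i → ℕ.pred ((j ℕ.+ e ℕ.* toℕ i) % ℓ) ℕ.< ℕ.pred ℓ
      bound i = ℕP.pred-mono-< {{r-nonzero i}} (m%n<n (j ℕ.+ e ℕ.* toℕ i) ℓ)
      r : Fin ℓ → Fin (ℕ.pred ℓ)
      r i = fromℕ< (bound i)
      r-injective : ∀ {i i'} → r i ≡ r i' → i ≡ i'
      r-injective {i} {i'} eq = residue-injective j i i' (ℕP.pred-injective {{r-nonzero i}} {{r-nonzero i'}}
        (trans (sym (FinP.toℕ-fromℕ< (bound i))) (trans (cong toℕ eq) (FinP.toℕ-fromℕ< (bound i')))))

    ∑-residue : ∀ j → ∑ (allFin ℓ) (λ i → 𝟙 (ℓ ∣? (j ℕ.+ e ℕ.* toℕ i))) ≡ 1ℤ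
    ∑-residue j with residue-hit j
    ... | i₀ , hit = trans (∑-cong (allFin ℓ) (λ i → 𝟙-⇔ (ℓ ∣? (j ℕ.+ e ℕ.* toℕ i)) (i Fin.≟ i₀)
                (λ d → residue-injective j i i₀ (trans (n∣m⇒m%n≡0 _ ℓ d) (sym (n∣m⇒m%n≡0 _ ℓ hit))))
                (λ { refl → hit })))
                (Enum.sift₁ (EFin ℓ) i₀)

  -- Orders in the multiplicative and additive groups of the field

  collision : {A : Set} (xs : List A) → (∀ x → x ∈ xs) → (f : ℕ → A) →
              ∃ λ i → ∃ λ j → i ℕ.< j × j ℕ.≤ length xs × f i ≡ f j
  collision xs complete f with FinP.pigeonhole (ℕP.n<1+n (length xs)) (λ i → Any.index (complete (f (toℕ i))))
  ... | i , j , i<j , eq = toℕ i , toℕ j , i<j , ℕP.≤-pred (FinP.toℕ<n j) ,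
    trans (lookup-index (complete (f (toℕ i)))) (trans (cong (lookup xs) eq) (sym (lookup-index (complete (f (toℕ j))))))

  module Cyclic (F : FiniteField) (ε : FiniteField.Carrier F) (gen : FiniteField.IsGenerator F ε)
                (Q : ℕ) (order≡ : FiniteField.order F ≡ suc Q) where
    open Plane F
    open GL2 F using (CRing)
    open Powers CRing

    1≢0 : 1# ≢ 0#
    1≢0 e = 0≢1 (sym e)

    ^-≢0 : ∀ {x} n → x ≢ 0# → x ^ n ≢ 0#
    ^-≢0 zero    x≢0 = 1≢0
    ^-≢0 (suc n) x≢0 = ⊗-≢0 x≢0 (^-≢0 n x≢0)

    ^-difference : ∀ {x} i j → x ≢ 0# → i ℕ.≤ j → x ^ i ≡ x ^ j → x ^ (j ℕ.∸ i) ≡ 1#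
    ^-difference {x} i j x≢0 i≤j eq = sym (⊗-cancelʳ 1# (x ^ (j ℕ.∸ i)) (x ^ i) (^-≢0 i x≢0) (begin
      1# ⊗ (x ^ i) ≡⟨ R.*-identityˡ _ ⟩
      x ^ i ≡⟨ eq ⟩
      x ^ j ≡⟨ cong (x ^_) (ℕP.m∸n+n≡m i≤j) ⟨
      x ^ (j ℕ.∸ i ℕ.+ i) ≡⟨ ^-+ x (j ℕ.∸ i) i ⟩
      (x ^ (j ℕ.∸ i)) ⊗ (x ^ i) ∎))
      where open ≡-Reasoning

    ε≢0 : ε ≢ 0#
    ε≢0 = proj₁ gen

    log : ∀ x → x ≢ 0# → ℕ
    log x x≢0 = proj₁ (proj₂ gen x x≢0)

    ε^log : ∀ x (x≢0 : x ≢ 0#) → ε ^ log x x≢0 ≡ x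
    ε^log x x≢0 = proj₂ (proj₂ gen x x≢0)

    ∑-nonzero : ∑ elems (λ c → 1ℤ + - 𝟙 (c ≟F 0#)) ≡ + Q
    ∑-nonzero = begin
      ∑ elems (λ c → 1ℤ + - 𝟙 (c ≟F 0#))
        ≡⟨ ∑-+ elems (λ _ → 1ℤ) (λ c → - 𝟙 (c ≟F 0#)) ⟩
      ∑ elems (λ _ → 1ℤ) + ∑ elems (λ c → - 𝟙 (c ≟F 0#))
        ≡⟨ cong₂ _+_ (trans (∑-const elems 1ℤ) (ℤP.*-identityʳ (+ order)))
                (trans (∑-neg elems (λ c → 𝟙 (c ≟F 0#))) (cong -_ (Enum.sift₁ EF 0#))) ⟩
      + order + - 1ℤ
        ≡⟨ cong (λ k → + k + - 1ℤ) order≡ ⟩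
      + Q ∎
      where open ≡-Reasoning

    -- If ε ^ r = 1, the r powers with exponent below r already exhaust the `Q` nonzero elements.
    period-≥ : ∀ r → 0 ℕ.< r → ε ^ r ≡ 1# → Q ℕ.≤ r
    period-≥ r@(suc _) _ e = ℤP.drop‿+≤+ (ℤP.≤-trans (ℤP.≤-reflexive (sym ∑-nonzero)) (ℤP.≤-trans (∑-mono elems hit) (ℤP.≤-reflexive total)))
      where
      open ≡-Reasoning
      total : ∑ elems (λ c → ∑ (allFin r) (λ i → 𝟙 (c ≟F (ε ^ toℕ i)))) ≡ + r
      total = begin
        ∑ elems (λ c → ∑ (allFin r) (λ i → 𝟙 (c ≟F (ε ^ toℕ i)))) ≡⟨ ∑-swap elems (allFin r) _ ⟩
        ∑ (allFin r) (λ i → ∑ elems (λ c → 𝟙 (c ≟F (ε ^ toℕ i)))) ≡⟨ ∑-cong (allFin r) (λ i → Enum.sift₁ EF (ε ^ toℕ i)) ⟩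
        ∑ (allFin r) (λ _ → 1ℤ) ≡⟨ ∑Fin-const r 1ℤ ⟩
        + r * 1ℤ ≡⟨ ℤP.*-identityʳ (+ r) ⟩
        + r ∎
      hit : ∀ c → 1ℤ + - 𝟙 (c ≟F 0#) ≤ ∑ (allFin r) (λ i → 𝟙 (c ≟F (ε ^ toℕ i)))
      hit c with c ≟F 0#
      ... | yes _  = ∑-nonneg (allFin r) (λ i → 0≤𝟙 (c ≟F (ε ^ toℕ i)))
      ... | no c≢0 = ℤP.≤-trans (ℤP.≤-reflexive (sym (Enum.sift₁ (EFin r) i₀))) (∑-mono (allFin r) imp)
        where
        i₀ : Fin r
        i₀ = fromℕ< (m%n<n (log c c≢0) r)
        c≡ : c ≡ ε ^ toℕ i₀
        c≡ = trans (sym (ε^log c c≢0)) (trans (^-% ε r (log c c≢0) e) (cong (ε ^_) (sym (FinP.toℕ-fromℕ< (m%n<n (log c c≢0) r)))))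
        imp : ∀ i → 𝟙 (i Fin.≟ i₀) ≤ 𝟙 (c ≟F (ε ^ toℕ i))
        imp i with i Fin.≟ i₀
        ... | yes refl = ℤP.≤-reflexive (sym (𝟙-true (c ≟F (ε ^ toℕ i₀)) c≡))
        ... | no _     = 0≤𝟙 (c ≟F (ε ^ toℕ i))

    period : ε ^ Q ≡ 1# × 0 ℕ.< Q
    period with collision elems elems-complete f
      where
      -- Putting 0# first forces the repetition to occur among ε ^ 0, ..., ε ^ Q; the powers alone
      -- would give a period bounded only by Q + 1.
      f : ℕ → Carrier
      f zero    = 0#
      f (suc i) = ε ^ i
    ... | zero  , suc j , _         , _   , eq = ⊥-elim (^-≢0 j ε≢0 (sym eq))
    ... | suc i , suc j , ℕ.s≤s i<j , j≤q , eq = subst (λ d → ε ^ d ≡ 1#) (ℕP.≤-antisym d≤Q (period-≥ d 0<d εᵈ≡1)) εᵈ≡1 , ℕP.<-≤-trans 0<d d≤Q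
      where
      d = j ℕ.∸ i
      0<d : 0 ℕ.< d
      0<d = ℕP.m<n⇒0<n∸m i<j
      d≤Q : d ℕ.≤ Q
      d≤Q = ℕP.≤-trans (ℕP.m∸n≤m j i) (ℕP.≤-pred (subst (suc j ℕ.≤_) order≡ j≤q))
      εᵈ≡1 : ε ^ d ≡ 1#
      εᵈ≡1 = ^-difference i j ε≢0 (ℕP.<⇒≤ i<j) eq

    instance
      Q-nonZero : NonZero Q
      Q-nonZero = ℕ.>-nonZero (proj₂ period)

    order∣ : ∀ n → ε ^ n ≡ 1# → Q ∣ n
    order∣ n = ^-order ε Q n (proj₁ period) (λ r 0<r r<Q e → ℕP.<⇒≱ r<Q (period-≥ r 0<r e))

    open import Algebra.Properties.Semiring.Mult R.semiring using () renaming (_×_ to _•_)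

    -- Translation by x permutes the field, so the sum s of all elements satisfies q x + s = s.
    order-• : ∀ x → order • x ≡ 0#
    order-• x = ∙-cancelʳ s (order • x) 0# (begin
      (order • x) ⊕ s ≡⟨ shift elems ⟨
      foldr _⊕_ 0# (map (x ⊕_) elems) ≡⟨ foldr-commMonoid R.setoid R.+-isCommutativeMonoid (↭⇒↭ₛ translate) ⟩
      s ≡⟨ R.+-identityˡ s ⟨
      0# ⊕ s ∎)
      where
      open ≡-Reasoning
      open import Algebra.Properties.AbelianGroup R.+-abelianGroup using (∙-cancelˡ; ∙-cancelʳ)
      s = foldr _⊕_ 0# elems
      shift : ∀ ys → foldr _⊕_ 0# (map (x ⊕_) ys) ≡ (length ys • x) ⊕ foldr _⊕_ 0# ys
      shift []       = sym (R.+-identityˡ 0#)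
      shift (y ∷ ys) = trans (cong ((x ⊕ y) ⊕_) (shift ys)) (solve 4 (λ x y l s → (x :+ y) :+ (l :+ s) := (x :+ l) :+ (y :+ s)) refl x y (length ys • x) (foldr _⊕_ 0# ys))
      translate : map (x ⊕_) elems ↭ elems
      translate = ∼bag⇒↭ (unique∧set⇒bag (map⁺ (∙-cancelˡ x _ _) elems-unique) elems-unique
        (λ {y} → mk⇔ (λ _ → elems-complete y)
          (λ _ → subst (_∈ map (x ⊕_) elems) (solve 2 (λ x y → x :+ (y :+ (:- x)) := y) refl x y) (∈-map⁺ (x ⊕_) (elems-complete (y ⊕ (⊖ x)))))))

    -- The geometric series 1 + δ + ... + δ^(k - 1), kept as a recursion because δ = 1 must be
    -- allowed.
    geo : Carrier → ℕ → Carrier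
    geo δ zero    = 0#
    geo δ (suc k) = 1# ⊕ (δ ⊗ geo δ k)

    geo-+ : ∀ δ j k → geo δ (j ℕ.+ k) ≡ geo δ j ⊕ ((δ ^ j) ⊗ geo δ k)
    geo-+ δ zero    k = sym (trans (R.+-identityˡ _) (R.*-identityˡ _))
    geo-+ δ (suc j) k = trans (cong (λ z → 1# ⊕ (δ ⊗ z)) (geo-+ δ j k))
      (solve 4 (λ d g p h → :1 :+ (d :* (g :+ (p :* h))) := (:1 :+ (d :* g)) :+ ((d :* p) :* h)) refl δ (geo δ j) (δ ^ j) (geo δ k))

    -- The series has period m, so its first q m terms add up to q times the sum of one period, and
    -- q kills the additive group.
    geo-vanishes : ∀ δ m → δ ^ m ≡ 1# → geo δ (order ℕ.* m) ≡ 0#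
    geo-vanishes δ m e = trans (multiple order) (order-• (geo δ m))
      where
      multiple : ∀ t → geo δ (t ℕ.* m) ≡ t • geo δ m
      multiple zero    = refl
      multiple (suc t) = trans (geo-+ δ m (t ℕ.* m)) (cong (geo δ m ⊕_)
        (trans (cong (_⊗ geo δ (t ℕ.* m)) e) (trans (R.*-identityˡ _) (multiple t))))

  -- The group GL₂

  module MatrixGroup (F : FiniteField) where
    open Plane F
    open GL2 F using (CRing; Mat; mat; a; b; c; d; GL; _·M_; _·_; allMat)
    open Powers CRing using (_^_)
    open ≡-Reasoning

    mat-≡ : ∀ {x x' y y' z z' w w'} → x ≡ x' → y ≡ y' → z ≡ z' → w ≡ w' → mat x y z w ≡ mat x' y' z' w'
    mat-≡ refl refl refl refl = refl

    GL-≡ : {g h : GL} → proj₁ g ≡ proj₁ h → g ≡ h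
    GL-≡ {M , p} {.M , p'} refl = cong (M ,_) (T-irrelevant p p')

    det≢0 : (g : GL) → det (proj₁ g) ≢ 0#
    det≢0 (M , p) e = toWitnessFalse p (x∙y⁻¹≈ε⇒x≈y _ _ e)
      where open import Algebra.Properties.AbelianGroup R.+-abelianGroup using (x∙y⁻¹≈ε⇒x≈y)

    ad≢bc : ∀ M → det M ≢ 0# → (a M ⊗ d M) ≢ (b M ⊗ c M)
    ad≢bc M δ≢0 e = δ≢0 (trans (cong (_⊕ (⊖ (b M ⊗ c M))) e) (R.-‿inverseʳ _))

    toGL′ : (M : Mat) → det M ≢ 0# → GL
    toGL′ M δ≢0 = M , fromWitnessFalse (ad≢bc M δ≢0)

    det-·M : ∀ M N → det (M ·M N) ≡ det M ⊗ det N
    det-·M (mat a b c d) (mat a' b' c' d') = solve 8 (λ a b c d a' b' c' d' →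
      (((a :* a') :+ (b :* c')) :* ((c :* b') :+ (d :* d'))) :+ (:- (((a :* b') :+ (b :* d')) :* ((c :* a') :+ (d :* c'))))
      := ((a :* d) :+ (:- (b :* c))) :* ((a' :* d') :+ (:- (b' :* c')))) refl a b c d a' b' c' d'

    private
      entry-assoc : ∀ x y a b c d z w → (((x ⊗ a) ⊕ (y ⊗ c)) ⊗ z) ⊕ (((x ⊗ b) ⊕ (y ⊗ d)) ⊗ w)
                ≡ (x ⊗ ((a ⊗ z) ⊕ (b ⊗ w))) ⊕ (y ⊗ ((c ⊗ z) ⊕ (d ⊗ w)))
      entry-assoc = solve 8 (λ x y a b c d z w → (((x :* a) :+ (y :* c)) :* z) :+ (((x :* b) :+ (y :* d)) :* w)
                := (x :* ((a :* z) :+ (b :* w))) :+ (y :* ((c :* z) :+ (d :* w)))) refl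

    ·M-assoc : ∀ L M N → (L ·M M) ·M N ≡ L ·M (M ·M N)
    ·M-assoc (mat x y z w) (mat a b c d) (mat a' b' c' d') = mat-≡
      (entry-assoc x y a b c d a' c') (entry-assoc x y a b c d b' d') (entry-assoc z w a b c d a' c') (entry-assoc z w a b c d b' d')

    ▹-·M : ∀ M N v → (M ·M N) ▹ v ≡ M ▹ (N ▹ v)
    ▹-·M (mat x y z w) (mat a b c d) (v , v₂) = cong₂ _,_ (entry-assoc x y a b c d v v₂) (entry-assoc z w a b c d v v₂)

    scale : Carrier → Mat → Mat
    scale k (mat a b c d) = mat (k ⊗ a) (k ⊗ b) (k ⊗ c) (k ⊗ d)

    scale-scale : ∀ {k k'} M → k ⊗ k' ≡ 1# → scale k (scale k' M) ≡ M
    scale-scale {k} {k'} (mat a b c d) e = mat-≡ (entry a) (entry b) (entry c) (entry d)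
      where
      entry : ∀ x → k ⊗ (k' ⊗ x) ≡ x
      entry x = trans (sym (R.*-assoc k k' x)) (unit-cancel x e)

    det-scale : ∀ k M → det (scale k M) ≡ (k ⊗ k) ⊗ det M
    det-scale k (mat a b c d) = solve 5 (λ k a b c d → ((k :* a) :* (k :* d)) :+ (:- ((k :* b) :* (k :* c)))
      := (k :* k) :* ((a :* d) :+ (:- (b :* c)))) refl k a b c d

    ·M-scale : ∀ k M N → M ·M scale k N ≡ scale k (M ·M N)
    ·M-scale k (mat x y z w) (mat a b c d) = mat-≡ (entry x y a c) (entry x y b d) (entry z w a c) (entry z w b d)
      where
      entry : ∀ x y a c → (x ⊗ (k ⊗ a)) ⊕ (y ⊗ (k ⊗ c)) ≡ k ⊗ ((x ⊗ a) ⊕ (y ⊗ c))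
      entry x y a c = solve 5 (λ k x y a c → (x :* (k :* a)) :+ (y :* (k :* c)) := k :* ((x :* a) :+ (y :* c))) refl k x y a c

    scalarM : Carrier → Mat
    scalarM k = mat k 0# 0# k

    private
      :0 : ∀ {n} → Polynomial n
      :0 = con (0 , 0)

    scalarM-· : ∀ k M → scalarM k ·M M ≡ scale k M
    scalarM-· k (mat a b c d) = mat-≡ (left a c) (left b d) (right a c) (right b d)
      where
      left : ∀ x y → (k ⊗ x) ⊕ (0# ⊗ y) ≡ k ⊗ x
      left x y = solve 3 (λ k x y → (k :* x) :+ (:0 :* y) := k :* x) refl k x y
      right : ∀ x y → (0# ⊗ x) ⊕ (k ⊗ y) ≡ k ⊗ y
      right x y = solve 3 (λ k x y → (:0 :* x) :+ (k :* y) := k :* y) refl k x y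

    det-scalarM : ∀ k → det (scalarM k) ≡ k ⊗ k
    det-scalarM k = solve 1 (λ k → (k :* k) :+ (:- (:0 :* :0)) := k :* k) refl k

    scalar : (k : Carrier) → k ≢ 0# → GL
    scalar k k≢0 = toGL′ (scalarM k) (λ e → ⊗-≢0 k≢0 k≢0 (trans (sym (det-scalarM k)) e))

    IM : Mat
    IM = scalarM 1#

    ·M-identityˡ : ∀ M → IM ·M M ≡ M
    ·M-identityˡ M@(mat a b c d) = trans (scalarM-· 1# M) (mat-≡ (R.*-identityˡ a) (R.*-identityˡ b) (R.*-identityˡ c) (R.*-identityˡ d))

    ·M-identityʳ : ∀ M → M ·M IM ≡ M
    ·M-identityʳ (mat a b c d) = mat-≡ (left a b) (right a b) (left c d) (right c d)
      where
      left : ∀ x y → (x ⊗ 1#) ⊕ (y ⊗ 0#) ≡ x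
      left x y = solve 2 (λ x y → (x :* :1) :+ (y :* :0) := x) refl x y
      right : ∀ x y → (x ⊗ 0#) ⊕ (y ⊗ 1#) ≡ y
      right x y = solve 2 (λ x y → (x :* :0) :+ (y :* :1) := y) refl x y

    IM-▹ : ∀ v → IM ▹ v ≡ v
    IM-▹ (x , y) = cong₂ _,_ (solve 2 (λ x y → (:1 :* x) :+ (:0 :* y) := x) refl x y) (solve 2 (λ x y → (:0 :* x) :+ (:1 :* y) := y) refl x y)

    I : GL
    I = scalar 1# (λ e → 0≢1 (sym e))

    ·-assoc : ∀ g h k → (g · h) · k ≡ g · (h · k)
    ·-assoc g h k = GL-≡ (·M-assoc (proj₁ g) (proj₁ h) (proj₁ k))

    ·-identityˡ : ∀ g → I · g ≡ g
    ·-identityˡ g = GL-≡ (·M-identityˡ (proj₁ g))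

    ·-identityʳ : ∀ g → g · I ≡ g
    ·-identityʳ g = GL-≡ (·M-identityʳ (proj₁ g))

    private
      adjM : Carrier → Mat → Mat
      adjM k (mat a b c d) = mat (k ⊗ d) (k ⊗ (⊖ b)) (k ⊗ (⊖ c)) (k ⊗ a)

      adj-inverseˡ : ∀ k M → adjM k M ·M M ≡ scalarM (det M ⊗ k)
      adj-inverseˡ k (mat a b c d) = mat-≡
        (solve 5 (λ k a b c d → ((k :* d) :* a) :+ ((k :* (:- b)) :* c) := ((a :* d) :+ (:- (b :* c))) :* k) refl k a b c d)
        (solve 5 (λ k a b c d → ((k :* d) :* b) :+ ((k :* (:- b)) :* d) := :0) refl k a b c d)
        (solve 5 (λ k a b c d → ((k :* (:- c)) :* a) :+ ((k :* a) :* c) := :0) refl k a b c d)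
        (solve 5 (λ k a b c d → ((k :* (:- c)) :* b) :+ ((k :* a) :* d) := ((a :* d) :+ (:- (b :* c))) :* k) refl k a b c d)

      adj-inverseʳ : ∀ k M → M ·M adjM k M ≡ scalarM (det M ⊗ k)
      adj-inverseʳ k (mat a b c d) = mat-≡
        (solve 5 (λ k a b c d → (a :* (k :* d)) :+ (b :* (k :* (:- c))) := ((a :* d) :+ (:- (b :* c))) :* k) refl k a b c d)
        (solve 5 (λ k a b c d → (a :* (k :* (:- b))) :+ (b :* (k :* a)) := :0) refl k a b c d)
        (solve 5 (λ k a b c d → (c :* (k :* d)) :+ (d :* (k :* (:- c))) := :0) refl k a b c d)
        (solve 5 (λ k a b c d → (c :* (k :* (:- b))) :+ (d :* (k :* a)) := ((a :* d) :+ (:- (b :* c))) :* k) refl k a b c d)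

    det-I : det IM ≡ 1#
    det-I = trans (det-scalarM 1#) (R.*-identityˡ 1#)

    inverseM : (g : GL) → ∃ λ N → (N ·M proj₁ g ≡ IM) × (proj₁ g ·M N ≡ IM)
    inverseM g@(M , _) with inverse (det M) (det≢0 g)
    ... | k , δk≡1 = adjM k M , trans (adj-inverseˡ k M) (cong scalarM δk≡1) , trans (adj-inverseʳ k M) (cong scalarM δk≡1)

    _⁻¹ : GL → GL
    g ⁻¹ = toGL′ (proj₁ (inverseM g)) (λ e → 0≢1 (begin
      0# ≡⟨ R.zeroˡ (det (proj₁ g)) ⟨
      0# ⊗ det (proj₁ g) ≡⟨ cong (_⊗ det (proj₁ g)) e ⟨
      det (proj₁ (inverseM g)) ⊗ det (proj₁ g) ≡⟨ det-·M (proj₁ (inverseM g)) (proj₁ g) ⟨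
      det (proj₁ (inverseM g) ·M proj₁ g) ≡⟨ cong det (proj₁ (proj₂ (inverseM g))) ⟩
      det IM ≡⟨ det-I ⟩
      1# ∎))

    inverseˡ : ∀ g → (g ⁻¹) · g ≡ I
    inverseˡ g = GL-≡ (proj₁ (proj₂ (inverseM g)))

    inverseʳ : ∀ g → g · (g ⁻¹) ≡ I
    inverseʳ g = GL-≡ (proj₂ (proj₂ (inverseM g)))

    cancel-middle : ∀ x g h → (x · g) · ((g ⁻¹) · h) ≡ x · h
    cancel-middle x g h = begin
      (x · g) · ((g ⁻¹) · h) ≡⟨ ·-assoc x g ((g ⁻¹) · h) ⟩
      x · (g · ((g ⁻¹) · h)) ≡⟨ cong (x ·_) (·-assoc g (g ⁻¹) h) ⟨
      x · ((g · (g ⁻¹)) · h) ≡⟨ cong (λ z → x · (z · h)) (inverseʳ g) ⟩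
      x · (I · h) ≡⟨ cong (x ·_) (·-identityˡ h) ⟩
      x · h ∎

    _^ᴳ_ : GL → ℕ → GL
    g ^ᴳ zero  = I
    g ^ᴳ suc k = (g ^ᴳ k) · g

    ^ᴳ-comm : ∀ g k → g · (g ^ᴳ k) ≡ (g ^ᴳ k) · g
    ^ᴳ-comm g zero    = trans (·-identityʳ g) (sym (·-identityˡ g))
    ^ᴳ-comm g (suc k) = trans (sym (·-assoc g (g ^ᴳ k) g)) (cong (_· g) (^ᴳ-comm g k))

    ^ᴳ-+ : ∀ g j k → g ^ᴳ (j ℕ.+ k) ≡ (g ^ᴳ j) · (g ^ᴳ k)
    ^ᴳ-+ g j zero    = trans (cong (g ^ᴳ_) (ℕP.+-identityʳ j)) (sym (·-identityʳ (g ^ᴳ j)))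
    ^ᴳ-+ g j (suc k) = trans (cong (g ^ᴳ_) (ℕP.+-suc j k)) (trans (cong (_· g) (^ᴳ-+ g j k)) (·-assoc (g ^ᴳ j) (g ^ᴳ k) g))

    det-^ᴳ : ∀ g k → det (proj₁ (g ^ᴳ k)) ≡ det (proj₁ g) ^ k
    det-^ᴳ g zero    = det-I
    det-^ᴳ g (suc k) = trans (det-·M (proj₁ (g ^ᴳ k)) (proj₁ g)) (trans (cong (_⊗ det (proj₁ g)) (det-^ᴳ g k)) (R.*-comm _ _))

    mats-complete : ∀ M → M ∈ allMat
    mats-complete (mat x y z w) =
      ∈-concatMap⁺ _ (Any.map (λ { refl →
      ∈-concatMap⁺ _ (Any.map (λ { refl →
      ∈-concatMap⁺ _ (Any.map (λ { refl → ∈-map⁺ _ (elems-complete w) }) (elems-complete z)) }) (elems-complete y)) }) (elems-complete x))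

    ^ᴳ-collision : ∀ g i d → g ^ᴳ i ≡ g ^ᴳ (i ℕ.+ d) → g ^ᴳ d ≡ I
    ^ᴳ-collision g i d eq = begin
      y ≡⟨ ·-identityˡ y ⟨
      I · y ≡⟨ cong (_· y) (inverseˡ x) ⟨
      ((x ⁻¹) · x) · y ≡⟨ ·-assoc (x ⁻¹) x y ⟩
      (x ⁻¹) · (x · y) ≡⟨ cong ((x ⁻¹) ·_) (trans (sym (^ᴳ-+ g i d)) (sym eq)) ⟩
      (x ⁻¹) · x ≡⟨ inverseˡ x ⟩
      I ∎
      where
      x = g ^ᴳ i
      y = g ^ᴳ d

    finite-order : ∀ g → ∃ λ N → g ^ᴳ suc N ≡ I
    finite-order g = fromCollision (collision allMat mats-complete (λ k → proj₁ (g ^ᴳ k)))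
      where
      fromCollision : (∃ λ i → ∃ λ j → i ℕ.< j × j ℕ.≤ length allMat × proj₁ (g ^ᴳ i) ≡ proj₁ (g ^ᴳ j)) → ∃ λ N → g ^ᴳ suc N ≡ I
      fromCollision (i , j , i<j , _ , eq) = ℕ.pred e , trans (cong (g ^ᴳ_) (ℕP.suc-pred e {{ℕ.>-nonZero (ℕP.m<n⇒0<n∸m i<j)}}))
        (^ᴳ-collision g i e (trans (GL-≡ {g ^ᴳ i} {g ^ᴳ j} eq) (cong (g ^ᴳ_) (sym (ℕP.m+[n∸m]≡n (ℕP.<⇒≤ i<j))))))
        where e = j ℕ.∸ i

  -- Counting subsets along the cosets of the scalars ⟨η⟩

  module Extension (F : FiniteField) where
    open Plane F
    open GL2 F
    open MatrixGroup F using (GL-≡)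

    bit : Bool → ℤ
    bit true  = 1ℤ
    bit false = 0ℤ

    private
      -- Extending indicators by 0 to singular matrices lets sums run over all of `allMat`, that is,
      -- over arbitrary pairs of rows. The decision is an argument so that proofs can split on it.
      extDec : Subset → (M : Mat) → Dec ((a M ⊗ d M) ≡ (b M ⊗ c M)) → ℤ
      extDec S M (yes _) = 0ℤ
      extDec S M (no p)  = bit (S (M , fromWitnessFalse p))

    ext : Subset → Mat → ℤ
    ext S M = extDec S M ((a M ⊗ d M) ≟F (b M ⊗ c M))

    ∣∣≡∑ext : ∀ S → + ∣ S ∣ ≡ ∑ allMat (ext S)
    ∣∣≡∑ext S = go allMat
      where
      go : ∀ Ms → + countIn S (mapMaybe toGL Ms) ≡ ∑ Ms (ext S)
      go []       = refl
      go (M ∷ Ms) with (a M ⊗ d M) ≟F (b M ⊗ c M)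
      ... | yes _ = trans (go Ms) (sym (ℤP.+-identityˡ _))
      ... | no p with S (M , fromWitnessFalse p)
      ...   | true  = cong (_+_ 1ℤ) (go Ms)
      ...   | false = trans (go Ms) (sym (ℤP.+-identityˡ _))

    ext-bit : ∀ S (g : GL) → ext S (proj₁ g) ≡ bit (S g)
    ext-bit S (M , inv) = dec ((a M ⊗ d M) ≟F (b M ⊗ c M))
      where
      dec : ∀ D → extDec S M D ≡ bit (S (M , inv))
      dec (no p)  = cong (λ g → bit (S g)) (GL-≡ refl)
      dec (yes e) = ⊥-elim (toWitnessFalse inv e)

    ext-singular : ∀ S M → det M ≡ 0# → ext S M ≡ 0ℤ
    ext-singular S M e = dec ((a M ⊗ d M) ≟F (b M ⊗ c M))
      where
      open import Algebra.Properties.AbelianGroup R.+-abelianGroup using (x∙y⁻¹≈ε⇒x≈y)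
      dec : ∀ D → extDec S M D ≡ 0ℤ
      dec (yes _) = refl
      dec (no p)  = ⊥-elim (p (x∙y⁻¹≈ε⇒x≈y _ _ e))

    ext-01 : ∀ S M → (ext S M ≡ 0ℤ) ⊎ ((ext S M ≡ 1ℤ) × (∃ λ inv → S (M , inv) ≡ true))
    ext-01 S M = dec ((a M ⊗ d M) ≟F (b M ⊗ c M))
      where
      dec : ∀ D → (extDec S M D ≡ 0ℤ) ⊎ ((extDec S M D ≡ 1ℤ) × (∃ λ inv → S (M , inv) ≡ true))
      dec (yes _) = inj₁ refl
      dec (no p) with S (M , fromWitnessFalse p) in eq
      ... | true  = inj₂ (refl , fromWitnessFalse p , eq)
      ... | false = inj₁ refl

  module Counting (F : FiniteField) (ε : FiniteField.Carrier F) (gen : FiniteField.IsGenerator F ε)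
                (ℓ m : ℕ) (order≡ : FiniteField.order F ≡ suc (ℓ ℕ.* m))
                (ℓ-prime : Prime ℓ) (ℓ∤2 : ¬ (ℓ ∣ 2)) (ℓ∤m : ¬ (ℓ ∣ m)) where
    open Plane F
    open GL2 F using (CRing; Mat; allMat; Subset; ∣_∣; orderGL; allGL; countIn)
    open Powers CRing
    open Cyclic F ε gen (ℓ ℕ.* m) order≡
    open MatrixGroup F
    open Extension F public
    open ≡-Reasoning

    instance
      ℓ-nonZero : NonZero ℓ
      ℓ-nonZero = prime⇒nonZero ℓ-prime

      m-nonZero : NonZero m
      m-nonZero = ℕ.≢-nonZero (λ { refl → ℓ∤m (divides 0 refl) })

    P : Carrier → Set
    P k = k ^ m ≡ 1#

    P? : (k : Carrier) → Dec (P k)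
    P? k = (k ^ m) ≟F 1#

    P≢0 : (k : Carrier) → P k → k ≢ 0#
    P≢0 k Pk refl = 0≢1 (trans (sym (0^ m)) Pk)
      where
      0^ : ∀ n .{{_ : NonZero n}} → 0# ^ n ≡ 0#
      0^ (suc n) = R.zeroˡ _

    P-1 : P 1#
    P-1 = 1^ m

    P-⊗ : ∀ {x y} → P x → P y → P (x ⊗ y)
    P-⊗ {x} {y} Px Py = trans (^-distrib x y m) (trans (cong₂ _⊗_ Px Py) (R.*-identityˡ 1#))

    P-cancel : ∀ {x y} → P (x ⊗ y) → P y → P x
    P-cancel {x} {y} Pxy Py = begin
      x ^ m ≡⟨ R.*-identityʳ _ ⟨
      (x ^ m) ⊗ 1# ≡⟨ cong ((x ^ m) ⊗_) Py ⟨
      (x ^ m) ⊗ (y ^ m) ≡⟨ ^-distrib x y m ⟨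
      (x ⊗ y) ^ m ≡⟨ Pxy ⟩
      1# ∎

    P-ε⇒ : ∀ k → P (ε ^ k) → ℓ ∣ k
    P-ε⇒ k Pk = *-cancelʳ-∣ m (order∣ (k ℕ.* m) (trans (^-* ε k m) Pk))

    P-ε⇐ : ∀ k → ℓ ∣ k → P (ε ^ k)
    P-ε⇐ k ℓ∣k = trans (sym (^-* ε k m)) (^-multiple ε (proj₁ period) (*-monoˡ-∣ m ℓ∣k))

    ℓ∤1 : ¬ (ℓ ∣ 1)
    ℓ∤1 ℓ∣1 = ℕP.<⇒≱ (ℕ.nonTrivial⇒n>1 ℓ {{prime⇒nonTrivial ℓ-prime}}) (∣⇒≤ ℓ∣1)

    open Spectral F P P? P≢0

    -- Every nonzero k has exactly one translate ε ^ i ⊗ k with i < ℓ in the kernel of the m-th power map.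
    ∣P∣≡m : ∣P∣ ≡ + m
    ∣P∣≡m = ℤP.*-cancelˡ-≡ (+ ℓ) ∣P∣ (+ m) (begin
      + ℓ * ∣P∣
        ≡⟨ ∑Fin-const ℓ ∣P∣ ⟨
      ∑ (allFin ℓ) (λ _ → ∣P∣)
        ≡⟨ ∑-cong (allFin ℓ) (λ i → ∑-scale (ε ^ toℕ i) (^-≢0 (toℕ i) ε≢0) μ) ⟨
      ∑ (allFin ℓ) (λ i → ∑ elems (λ k → μ ((ε ^ toℕ i) ⊗ k)))
        ≡⟨ ∑-swap (allFin ℓ) elems _ ⟩
      ∑ elems (λ k → ∑ (allFin ℓ) (λ i → μ ((ε ^ toℕ i) ⊗ k)))
        ≡⟨ ∑-cong elems unique ⟩
      ∑ elems (λ k → 1ℤ + - 𝟙 (k ≟F 0#))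
        ≡⟨ ∑-nonzero ⟩
      + (ℓ ℕ.* m)
        ≡⟨ ℤP.pos-* ℓ m ⟩
      + ℓ * + m ∎)
      where
      open Residues ℓ ℓ-prime 1 ℓ∤1
      unique : ∀ k → ∑ (allFin ℓ) (λ i → μ ((ε ^ toℕ i) ⊗ k)) ≡ 1ℤ + - 𝟙 (k ≟F 0#)
      unique k with k ≟F 0#
      ... | yes refl = ∑-zero (allFin ℓ) (λ i → 𝟙-false (P? ((ε ^ toℕ i) ⊗ 0#)) (λ Pk → P≢0 _ Pk (R.zeroʳ _)))
      ... | no k≢0   = trans (∑-cong (allFin ℓ) (λ i → 𝟙-⇔ (P? ((ε ^ toℕ i) ⊗ k)) (ℓ ∣? (log k k≢0 ℕ.+ 1 ℕ.* toℕ i))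
                (λ Pk → P-ε⇒ _ (subst P (as-power i) Pk)) (λ ℓ∣ → subst P (sym (as-power i)) (P-ε⇐ _ ℓ∣))))
                (∑-residue (log k k≢0))
        where
        as-power : ∀ i → (ε ^ toℕ i) ⊗ k ≡ ε ^ (log k k≢0 ℕ.+ 1 ℕ.* toℕ i)
        as-power i = begin
          (ε ^ toℕ i) ⊗ k ≡⟨ R.*-comm _ _ ⟩
          k ⊗ (ε ^ toℕ i) ≡⟨ cong₂ (λ x j → x ⊗ (ε ^ j)) (ε^log k k≢0) (ℕP.*-identityˡ (toℕ i)) ⟨
          (ε ^ log k k≢0) ⊗ (ε ^ (1 ℕ.* toℕ i)) ≡⟨ ^-+ ε (log k k≢0) (1 ℕ.* toℕ i) ⟨
          ε ^ (log k k≢0 ℕ.+ 1 ℕ.* toℕ i) ∎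

    η θ : Carrier
    η = ε ^ m
    θ = ε ^ (m ℕ.* (ℓ ℕ.∸ 1))

    η^ : ∀ i → η ^ i ≡ ε ^ (m ℕ.* i)
    η^ i = sym (^-* ε m i)

    ηθ : η ⊗ θ ≡ 1#
    ηθ = begin
      η ⊗ θ ≡⟨ ^-+ ε m (m ℕ.* (ℓ ℕ.∸ 1)) ⟨
      ε ^ (m ℕ.+ m ℕ.* (ℓ ℕ.∸ 1)) ≡⟨ cong (ε ^_) (trans (sym (ℕP.*-suc m (ℓ ℕ.∸ 1))) (trans (cong (m ℕ.*_) (ℕP.suc-pred ℓ)) (ℕP.*-comm m ℓ))) ⟩
      ε ^ (ℓ ℕ.* m) ≡⟨ proj₁ period ⟩
      1# ∎

    η^θ^ : ∀ i → (η ^ i) ⊗ (θ ^ i) ≡ 1#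
    η^θ^ i = trans (sym (^-distrib η θ i)) (trans (^-congˡ i ηθ) (1^ i))

    θ^η^ : ∀ i → (θ ^ i) ⊗ (η ^ i) ≡ 1#
    θ^η^ i = trans (R.*-comm _ _) (η^θ^ i)

    η^≢0 : ∀ i → η ^ i ≢ 0#
    η^≢0 i = ^-≢0 i (^-≢0 m ε≢0)

    -- Scaling by θ ^ i adds e·i to the logarithm of the determinant, with e = 2m(ℓ - 1). As ℓ is
    -- odd and prime to m it does not divide e, so exactly one i < ℓ moves y into the subgroup det ∈
    -- P.
    ∑χ-scale : ∀ y → det y ≢ 0# → ∑ (allFin ℓ) (λ i → χ (scale (θ ^ toℕ i) y)) ≡ 1ℤ
    ∑χ-scale y det≢0 = trans (∑-cong (allFin ℓ) (λ i → 𝟙-⇔ (P? (det (scale (θ ^ toℕ i) y))) (ℓ ∣? (j ℕ.+ e ℕ.* toℕ i))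
        (λ Pk → P-ε⇒ _ (subst P (as-power i) Pk)) (λ ℓ∣ → subst P (sym (as-power i)) (P-ε⇐ _ ℓ∣))))
        (∑-residue j)
      where
      j = log (det y) det≢0
      e = 2 ℕ.* (m ℕ.* (ℓ ℕ.∸ 1))
      ℓ∤ℓ-1 : ¬ (ℓ ∣ ℓ ℕ.∸ 1)
      ℓ∤ℓ-1 ℓ∣ = ℕP.<⇒≱ (ℕP.≤-reflexive (ℕP.suc-pred ℓ)) (∣⇒≤ {{ℕ.>-nonZero (ℕP.m<n⇒0<n∸m (ℕ.nonTrivial⇒n>1 ℓ {{prime⇒nonTrivial ℓ-prime}}))}} ℓ∣)
      ℓ∤e : ¬ (ℓ ∣ e)
      ℓ∤e ℓ∣e with euclidsLemma 2 _ ℓ-prime ℓ∣e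
      ... | inj₁ ℓ∣2 = ℓ∤2 ℓ∣2
      ... | inj₂ ℓ∣r with euclidsLemma m _ ℓ-prime ℓ∣r
      ...   | inj₁ ℓ∣m   = ℓ∤m ℓ∣m
      ...   | inj₂ ℓ∣ℓ-1 = ℓ∤ℓ-1 ℓ∣ℓ-1
      open Residues ℓ ℓ-prime e ℓ∤e
      exponent : ∀ t i → j ℕ.+ (2 ℕ.* t) ℕ.* i ≡ t ℕ.* i ℕ.+ t ℕ.* i ℕ.+ j
      exponent t i = S.solve 3 (λ j t i → j S.:+ (S.con 2 S.:* t) S.:* i S.:= t S.:* i S.:+ t S.:* i S.:+ j) refl j t i
        where module S = +-*-Solver
      as-power : ∀ i → det (scale (θ ^ toℕ i) y) ≡ ε ^ (j ℕ.+ e ℕ.* toℕ i)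
      as-power i = begin
        det (scale (θ ^ toℕ i) y) ≡⟨ det-scale (θ ^ toℕ i) y ⟩
        ((θ ^ toℕ i) ⊗ (θ ^ toℕ i)) ⊗ det y ≡⟨ cong₂ (λ x z → (x ⊗ x) ⊗ z) (^-* ε t (toℕ i)) (ε^log (det y) det≢0) ⟨
        ((ε ^ (t ℕ.* toℕ i)) ⊗ (ε ^ (t ℕ.* toℕ i))) ⊗ (ε ^ j) ≡⟨ cong (_⊗ (ε ^ j)) (^-+ ε (t ℕ.* toℕ i) (t ℕ.* toℕ i)) ⟨
        (ε ^ (t ℕ.* toℕ i ℕ.+ t ℕ.* toℕ i)) ⊗ (ε ^ j) ≡⟨ ^-+ ε (t ℕ.* toℕ i ℕ.+ t ℕ.* toℕ i) j ⟨
        ε ^ (t ℕ.* toℕ i ℕ.+ t ℕ.* toℕ i ℕ.+ j) ≡⟨ cong (ε ^_) (exponent t (toℕ i)) ⟨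
        ε ^ (j ℕ.+ e ℕ.* toℕ i) ∎
        where t = m ℕ.* (ℓ ℕ.∸ 1)

    fibre : Subset → Mat → Fin ℓ → ℤ
    fibre S x i = ext S (scale (η ^ toℕ i) x)

    fibreSum : Subset → Mat → ℤ
    fibreSum S x = χ x * ∑ (allFin ℓ) (fibre S x)

    -- Each invertible y is η ^ i x for exactly one i < ℓ and one x with det x ∈ P. Substituting y
    -- for η ^ i x moves the determinant condition to θ ^ i y, where `∑χ-scale` counts it once.
    ∑-fibreSum : ∀ S → ∑ allMat (fibreSum S) ≡ + ∣ S ∣
    ∑-fibreSum S = begin
      ∑ allMat (fibreSum S)
        ≡⟨ ∑-cong allMat (λ x → ∑-*ˡ (allFin ℓ) (χ x) (fibre S x)) ⟨
      ∑ allMat (λ x → ∑ (allFin ℓ) (λ i → χ x * ext S (scale (η ^ toℕ i) x)))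
        ≡⟨ ∑-swap allMat (allFin ℓ) _ ⟩
      ∑ (allFin ℓ) (λ i → ∑ allMat (λ x → χ x * ext S (scale (η ^ toℕ i) x)))
        ≡⟨ ∑-cong (allFin ℓ) (λ i → translate (toℕ i)) ⟩
      ∑ (allFin ℓ) (λ i → ∑ allMat (λ y → χ (scale (θ ^ toℕ i) y) * ext S y))
        ≡⟨ ∑-swap (allFin ℓ) allMat _ ⟩
      ∑ allMat (λ y → ∑ (allFin ℓ) (λ i → χ (scale (θ ^ toℕ i) y) * ext S y))
        ≡⟨ ∑-cong allMat (λ y → trans (∑-*ʳ (allFin ℓ) (ext S y) (λ i → χ (scale (θ ^ toℕ i) y))) (once y)) ⟩
      ∑ allMat (ext S)
        ≡⟨ ∣∣≡∑ext S ⟨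
      + ∣ S ∣ ∎
      where
      translate : ∀ i → ∑ allMat (λ x → χ x * ext S (scale (η ^ i) x)) ≡ ∑ allMat (λ y → χ (scale (θ ^ i) y) * ext S y)
      translate i = trans
        (∑-cong allMat (λ x → cong (λ z → χ z * ext S (scale (η ^ i) x)) (sym (scale-scale x (θ^η^ i)))))
        (∑-bijection EM EM (scale (η ^ i)) (scale (θ ^ i)) (λ x → scale-scale x (θ^η^ i)) (λ y → scale-scale y (η^θ^ i))
          (λ y → χ (scale (θ ^ i) y) * ext S y))
      once : ∀ y → ∑ (allFin ℓ) (λ i → χ (scale (θ ^ toℕ i) y)) * ext S y ≡ ext S y
      once y = dec (det y ≟F 0#)
        where
        T′ = ∑ (allFin ℓ) (λ i → χ (scale (θ ^ toℕ i) y))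
        dec : Dec (det y ≡ 0#) → T′ * ext S y ≡ ext S y
        dec (yes e)    = trans (cong (T′ *_) (ext-singular S y e)) (trans (ℤP.*-zeroʳ T′) (sym (ext-singular S y e)))
        dec (no det≢0) = trans (cong (_* ext S y) (∑χ-scale y det≢0)) (ℤP.*-identityˡ (ext S y))

    -- This is `∑-fibreSum` for the whole group, whose fibres over the subgroup all have ℓ elements.
    orderGL≡ : + orderGL ≡ + ℓ * n
    orderGL≡ = begin
      + orderGL
        ≡⟨ cong +_ (everything allGL) ⟨
      + ∣ S ∣
        ≡⟨ ∑-fibreSum S ⟨
      ∑ allMat (fibreSum S)
        ≡⟨ ∑-cong allMat (λ x → trans (𝟙-guard (P? (det x)) (full x)) (ℤP.*-comm (χ x) (+ ℓ))) ⟩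
      ∑ allMat (λ x → + ℓ * χ x)
        ≡⟨ ∑-*ˡ allMat (+ ℓ) χ ⟩
      + ℓ * n ∎
      where
      S : Subset
      S _ = true
      everything : ∀ gs → countIn S gs ≡ length gs
      everything []       = refl
      everything (g ∷ gs) = cong suc (everything gs)
      full : ∀ x → P (det x) → ∑ (allFin ℓ) (fibre S x) ≡ + ℓ
      full x Px = trans (∑-cong (allFin ℓ) (λ i → ext-bit S (toGL′ (scale (η ^ toℕ i) x) (λ e →
          ⊗-≢0 (⊗-≢0 (η^≢0 (toℕ i)) (η^≢0 (toℕ i))) (P≢0 (det x) Px) (trans (sym (det-scale (η ^ toℕ i) x)) e)))))
        (trans (∑Fin-const ℓ 1ℤ) (ℤP.*-identityʳ (+ ℓ)))

    kernel : Subset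
    kernel g = isYes (P? (det (proj₁ g)))

    ∣kernel∣ : + ∣ kernel ∣ ≡ n
    ∣kernel∣ = trans (∣∣≡∑ext kernel) (∑-cong allMat (λ x → dec x (det x ≟F 0#)))
      where
      bit-isYes : {A : Set} (D : Dec A) → bit (isYes D) ≡ 𝟙 D
      bit-isYes (yes _) = refl
      bit-isYes (no _)  = refl
      dec : ∀ x → Dec (det x ≡ 0#) → ext kernel x ≡ χ x
      dec x (yes e)    = trans (ext-singular kernel x e) (sym (𝟙-false (P? (det x)) (λ Px → P≢0 (det x) Px e)))
      dec x (no det≢0) = trans (ext-bit kernel (toGL′ x det≢0)) (bit-isYes (P? (det x)))

  -- The representation

  module FixedVector (F : FiniteField) (ε : FiniteField.Carrier F) (gen : FiniteField.IsGenerator F ε)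
                (Q : ℕ) (order≡ : FiniteField.order F ≡ suc Q) where
    open Plane F
    open GL2 F using (CRing; Mat; mat; _·M_)
    open Powers CRing
    open Cyclic F ε gen Q order≡
    open MatrixGroup F
    open ≡-Reasoning

    private
      minusI : Mat → Mat
      minusI (mat a b c d) = mat (a ⊕ (⊖ 1#)) b c (d ⊕ (⊖ 1#))

      affine : Carrier → Mat → Mat
      affine S (mat a b c d) = mat (1# ⊕ (S ⊗ (a ⊕ (⊖ 1#)))) (S ⊗ b) (S ⊗ c) (1# ⊕ (S ⊗ (d ⊕ (⊖ 1#))))

      det-minusI : ∀ M v → v ≢ 𝟘 → M ▹ v ≡ v → det (minusI M) ≡ 0#
      det-minusI M@(mat a b c d) v@(v₁ , v₂) v≢0 fixed with det (minusI M) ≟F 0#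
      ... | yes e = e
      ... | no ne = ⊥-elim (▹-≢𝟘 (minusI M) v ne v≢0 (cong₂ _,_
          (trans (solve 4 (λ a b x y → ((a :+ (:- :1)) :* x) :+ (b :* y) := ((a :* x) :+ (b :* y)) :+ (:- x)) refl a b v₁ v₂)
                (trans (cong (_⊕ (⊖ v₁)) (cong proj₁ fixed)) (R.-‿inverseʳ v₁)))
          (trans (solve 4 (λ c d x y → (c :* x) :+ ((d :+ (:- :1)) :* y) := ((c :* x) :+ (d :* y)) :+ (:- y)) refl c d v₁ v₂)
                (trans (cong (_⊕ (⊖ v₂)) (cong proj₂ fixed)) (R.-‿inverseʳ v₂)))))

      -- By Cayley–Hamilton (g − 1)(g − δ) = − det (g − 1) g for δ = det g.
      affine-step : ∀ S M → det (minusI M) ≡ 0# → affine S M ·M M ≡ affine (1# ⊕ (det M ⊗ S)) M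
      affine-step S (mat a b c d) E≡0 = mat-≡
        (trans (solve 5 (λ S a b c d → ((:1 :+ (S :* (a :+ (:- :1)))) :* a) :+ ((S :* b) :* c)
            := (:1 :+ ((:1 :+ (((a :* d) :+ (:- (b :* c))) :* S)) :* (a :+ (:- :1)))) :+ (:- ((S :* a) :* (((a :+ (:- :1)) :* (d :+ (:- :1))) :+ (:- (b :* c)))))) refl S a b c d)
          (vanish (S ⊗ a)))
        (trans (solve 5 (λ S a b c d → ((:1 :+ (S :* (a :+ (:- :1)))) :* b) :+ ((S :* b) :* d)
            := ((:1 :+ (((a :* d) :+ (:- (b :* c))) :* S)) :* b) :+ (:- ((S :* b) :* (((a :+ (:- :1)) :* (d :+ (:- :1))) :+ (:- (b :* c)))))) refl S a b c d)
          (vanish (S ⊗ b)))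
        (trans (solve 5 (λ S a b c d → ((S :* c) :* a) :+ ((:1 :+ (S :* (d :+ (:- :1)))) :* c)
            := ((:1 :+ (((a :* d) :+ (:- (b :* c))) :* S)) :* c) :+ (:- ((S :* c) :* (((a :+ (:- :1)) :* (d :+ (:- :1))) :+ (:- (b :* c)))))) refl S a b c d)
          (vanish (S ⊗ c)))
        (trans (solve 5 (λ S a b c d → ((S :* c) :* b) :+ ((:1 :+ (S :* (d :+ (:- :1)))) :* d)
            := (:1 :+ ((:1 :+ (((a :* d) :+ (:- (b :* c))) :* S)) :* (d :+ (:- :1)))) :+ (:- ((S :* d) :* (((a :+ (:- :1)) :* (d :+ (:- :1))) :+ (:- (b :* c)))))) refl S a b c d)
          (vanish (S ⊗ d)))
        where
        open import Algebra.Properties.Ring R.ring using (-0#≈0#)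
        vanish : ∀ y {x} → x ⊕ (⊖ (y ⊗ det (minusI (mat a b c d)))) ≡ x
        vanish y {x} = trans (cong (λ E → x ⊕ (⊖ (y ⊗ E))) E≡0)
          (trans (cong (λ z → x ⊕ (⊖ z)) (R.zeroʳ y)) (trans (cong (x ⊕_) -0#≈0#) (R.+-identityʳ x)))

      affine-0 : ∀ M → affine 0# M ≡ IM
      affine-0 (mat a b c d) = mat-≡
        (trans (cong (1# ⊕_) (R.zeroˡ _)) (R.+-identityʳ 1#)) (R.zeroˡ b) (R.zeroˡ c)
        (trans (cong (1# ⊕_) (R.zeroˡ _)) (R.+-identityʳ 1#))

    -- g has the eigenvalues 1 and δ = det g, so g ^ k = 1 + (1 + δ + ... + δ^(k - 1))(g - 1), also
    -- in the unipotent case δ = 1. The series vanishes for k = q m.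
    fixes-power : ∀ g v → v ≢ 𝟘 → proj₁ g ▹ v ≡ v → ∀ m → det (proj₁ g) ^ m ≡ 1# → g ^ᴳ (order ℕ.* m) ≡ I
    fixes-power g v v≢0 fixed m δᵐ≡1 = GL-≡ (trans (powers (order ℕ.* m))
        (trans (cong (λ S → affine S (proj₁ g)) (geo-vanishes (det (proj₁ g)) m δᵐ≡1)) (affine-0 (proj₁ g))))
      where
      E≡0 = det-minusI (proj₁ g) v v≢0 fixed
      powers : ∀ k → proj₁ (g ^ᴳ k) ≡ affine (geo (det (proj₁ g)) k) (proj₁ g)
      powers zero    = sym (affine-0 (proj₁ g))
      powers (suc k) = trans (cong (_·M proj₁ g) (powers k)) (affine-step (geo (det (proj₁ g)) k) (proj₁ g) E≡0)

  module RootsOfUnity (K : CharZeroField) (ζ : CharZeroField.Carrier K) (Q : ℕ) .{{_ : NonZero Q}}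
                (ζ-prim : CharZeroField.IsPrimitiveRoot K ζ Q) where
    open CharZeroField K using (0≉1) renaming (inverse to inverseᴷ; isCommutativeRing to isCommutativeRingᴷ)

    KRing : CommutativeRing 0ℓ 0ℓ
    KRing = record { isCommutativeRing = isCommutativeRingᴷ }

    open CommutativeRing KRing renaming (refl to ≈-refl; sym to ≈-sym; trans to ≈-trans; _*_ to _⊛_; _+_ to _⊞_)
    open Powers KRing
    open import Relation.Binary.Reasoning.Setoid setoid

    ⊛-cancelʳ : ∀ x y z → ¬ (z ≈ 0#) → x ⊛ z ≈ y ⊛ z → x ≈ y
    ⊛-cancelʳ x y z z≉0 e with inverseᴷ z z≉0
    ... | z' , zz'≈1 = begin
      x ≈⟨ *-identityʳ x ⟨
      x ⊛ 1# ≈⟨ *-congˡ zz'≈1 ⟨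
      x ⊛ (z ⊛ z') ≈⟨ *-assoc x z z' ⟨
      (x ⊛ z) ⊛ z' ≈⟨ *-congʳ e ⟩
      (y ⊛ z) ⊛ z' ≈⟨ *-assoc y z z' ⟩
      y ⊛ (z ⊛ z') ≈⟨ *-congˡ zz'≈1 ⟩
      y ⊛ 1# ≈⟨ *-identityʳ y ⟩
      y ∎

    ζ-order∣ : ∀ n → ζ ^ n ≈ 1# → Q ∣ n
    ζ-order∣ n = ^-order ζ Q n (proj₁ ζ-prim) (proj₂ ζ-prim)

    ζ^≉0 : ∀ n → ¬ (ζ ^ n ≈ 0#)
    ζ^≉0 n e = 0≉1 (begin
      0# ≈⟨ 0^ Q ⟨
      0# ^ Q ≈⟨ ^-congˡ Q e ⟨
      (ζ ^ n) ^ Q ≈⟨ ^-* ζ n Q ⟨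
      ζ ^ (n ℕ.* Q) ≈⟨ ^-multiple ζ (proj₁ ζ-prim) (n∣m*n n) ⟩
      1# ∎)
      where
      0^ : ∀ n .{{_ : NonZero n}} → 0# ^ n ≈ 0#
      0^ (suc n) = zeroˡ _

    ζ-difference : ∀ i j → i ℕ.≤ j → ζ ^ i ≈ ζ ^ j → Q ∣ j ℕ.∸ i
    ζ-difference i j i≤j e = ζ-order∣ (j ℕ.∸ i) (≈-sym (⊛-cancelʳ 1# (ζ ^ (j ℕ.∸ i)) (ζ ^ i) (ζ^≉0 i) (begin
      1# ⊛ (ζ ^ i) ≈⟨ *-identityˡ _ ⟩
      ζ ^ i ≈⟨ e ⟩
      ζ ^ j ≡⟨ cong (ζ ^_) (ℕP.m∸n+n≡m i≤j) ⟨
      ζ ^ (j ℕ.∸ i ℕ.+ i) ≈⟨ ^-+ ζ (j ℕ.∸ i) i ⟩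
      (ζ ^ (j ℕ.∸ i)) ⊛ (ζ ^ i) ∎)))

  module Representation (F : FiniteField) (K : CharZeroField)
                (ε : FiniteField.Carrier F) (gen : FiniteField.IsGenerator F ε)
                (ℓ m : ℕ) (order≡ : FiniteField.order F ≡ suc (ℓ ℕ.* m))
                (ℓ-prime : Prime ℓ) (ℓ∤2 : ¬ (ℓ ∣ 2)) (ℓ∤m : ¬ (ℓ ∣ m))
                (ζ : CharZeroField.Carrier K) (ζ-prim : CharZeroField.IsPrimitiveRoot K ζ (ℓ ℕ.* m)) where
    open Plane F using (𝟘; _▹_; det; order)
    open GL2 F using (CRing; GL; _·M_; _·_)
    open Cyclic F ε gen (ℓ ℕ.* m) order≡ using (Q-nonZero)
    open MatrixGroup F
    open FixedVector F ε gen (ℓ ℕ.* m) order≡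
    open Counting F ε gen ℓ m order≡ ℓ-prime ℓ∤2 ℓ∤m
    open RootsOfUnity K ζ (ℓ ℕ.* m) ζ-prim public
    open PrincipalSeries F K ε ζ m using (InV; FixDim≥1)
    private
      module K = CommutativeRing KRing
    open K using (_≈_; 0#) renaming (_*_ to _⊛_)
    open Powers KRing
    open Powers CRing using () renaming (_^_ to _^F_)

    -- η ^ i is ε ^ (m i), and the character μ_m contributes the second factor m.
    character-scalar : ∀ φ → InV φ → ∀ i w → φ (scalar (η ^F i) (η^≢0 i) · w) ≈ (ζ ^ (m ℕ.* (m ℕ.* i))) ⊛ φ w
    character-scalar φ inV i w = inV (scalar (η ^F i) (η^≢0 i)) (m ℕ.* i) refl (η^ i) w

    private
      N : ℕ
      N = order ℕ.* m

      -- q = ℓ m + 1 leaves remainder 1 modulo ℓ.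
      ℓ∤N : ¬ (ℓ ∣ N)
      ℓ∤N ℓ∣N with euclidsLemma order m ℓ-prime ℓ∣N
      ... | inj₂ ℓ∣m = ℓ∤m ℓ∣m
      ... | inj₁ ℓ∣q = ℓ∤1 (∣m+n∣m⇒∣n (subst (ℓ ∣_) (trans order≡ (ℕP.+-comm 1 (ℓ ℕ.* m))) ℓ∣q) (m∣m*n m))

      -- The exponents differ by m²(i' - i)N, a multiple of the order ℓ m of ζ, so ℓ divides m(i' -
      -- i)N. Only the factor i' - i < ℓ can absorb it, and it must then be 0.
      exponents : ∀ i i' → i ℕ.≤ i' → i' ℕ.< ℓ → ζ ^ (m ℕ.* (m ℕ.* i) ℕ.* N) ≈ ζ ^ (m ℕ.* (m ℕ.* i') ℕ.* N) → i ≡ i'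
      exponents i i' i≤i' i'<ℓ e with euclidsLemma (m ℕ.* (i' ℕ.∸ i)) N ℓ-prime
          (*-cancelʳ-∣ m (subst (ℓ ℕ.* m ∣_) difference (ζ-difference _ _ (ℕP.*-monoˡ-≤ N (ℕP.*-monoʳ-≤ m (ℕP.*-monoʳ-≤ m i≤i'))) e)))
        where
        open ≡-Reasoning
        difference : m ℕ.* (m ℕ.* i') ℕ.* N ℕ.∸ m ℕ.* (m ℕ.* i) ℕ.* N ≡ m ℕ.* (i' ℕ.∸ i) ℕ.* N ℕ.* m
        difference = begin
          m ℕ.* (m ℕ.* i') ℕ.* N ℕ.∸ m ℕ.* (m ℕ.* i) ℕ.* N ≡⟨ ℕP.*-distribʳ-∸ N (m ℕ.* (m ℕ.* i')) (m ℕ.* (m ℕ.* i)) ⟨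
          (m ℕ.* (m ℕ.* i') ℕ.∸ m ℕ.* (m ℕ.* i)) ℕ.* N ≡⟨ cong (ℕ._* N) (ℕP.*-distribˡ-∸ m (m ℕ.* i') (m ℕ.* i)) ⟨
          m ℕ.* (m ℕ.* i' ℕ.∸ m ℕ.* i) ℕ.* N ≡⟨ cong (λ z → m ℕ.* z ℕ.* N) (ℕP.*-distribˡ-∸ m i' i) ⟨
          m ℕ.* (m ℕ.* (i' ℕ.∸ i)) ℕ.* N ≡⟨ S.solve 3 (λ m k N → m S.:* (m S.:* k) S.:* N S.:= m S.:* k S.:* N S.:* m) refl m (i' ℕ.∸ i) N ⟩
          m ℕ.* (i' ℕ.∸ i) ℕ.* N ℕ.* m ∎
          where module S = +-*-Solver
      ... | inj₂ ℓ∣N = ⊥-elim (ℓ∤N ℓ∣N)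
      ... | inj₁ ℓ∣mk with euclidsLemma m (i' ℕ.∸ i) ℓ-prime ℓ∣mk
      ...   | inj₁ ℓ∣m = ⊥-elim (ℓ∤m ℓ∣m)
      ...   | inj₂ ℓ∣k with i' ℕ.∸ i in eq
      ...     | zero  = ℕP.≤-antisym i≤i' (ℕP.m∸n≡0⇒m≤n eq)
      ...     | suc k = ⊥-elim (ℕP.<⇒≱ (ℕP.≤-<-trans (subst (ℕ._≤ i') eq (ℕP.m∸n≤m i' i)) i'<ℓ) (∣⇒≤ ℓ∣k))

    -- β(g) φ = θ φ with θ an ℓ-th root of unity and g of order prime to ℓ forces θ = 1.
    twisted-fixed : ∀ φ → (∃ λ x → ¬ (φ x ≈ 0#)) → ∀ g (i i' : ℕ) →
      (∀ w → (ζ ^ (m ℕ.* (m ℕ.* i))) ⊛ φ w ≈ (ζ ^ (m ℕ.* (m ℕ.* i'))) ⊛ φ (w · g)) →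
      g ^ᴳ (order ℕ.* m) ≡ I → i ℕ.< ℓ → i' ℕ.< ℓ → i ≡ i'
    twisted-fixed φ (w₀ , φw₀≉0) g i i' eigen gᴺ≡I i<ℓ i'<ℓ = conclude (ℕP.≤-total i i')
      where
      open import Relation.Binary.Reasoning.Setoid K.setoid
      open import Algebra.Properties.CommutativeSemigroup K.*-commutativeSemigroup using (x∙yz≈y∙xz)
      A = m ℕ.* (m ℕ.* i)
      B = m ℕ.* (m ℕ.* i')
      α = ζ ^ A
      β = ζ ^ B
      iterate : ∀ k w → (α ^ k) ⊛ φ w ≈ (β ^ k) ⊛ φ (w · (g ^ᴳ k))
      iterate zero    w = K.*-congˡ (K.reflexive (cong φ (sym (·-identityʳ w))))
      iterate (suc k) w = begin
        (α ⊛ (α ^ k)) ⊛ φ w ≈⟨ K.*-assoc α (α ^ k) (φ w) ⟩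
        α ⊛ ((α ^ k) ⊛ φ w) ≈⟨ K.*-congˡ (iterate k w) ⟩
        α ⊛ ((β ^ k) ⊛ φ (w · (g ^ᴳ k))) ≈⟨ x∙yz≈y∙xz α (β ^ k) _ ⟩
        (β ^ k) ⊛ (α ⊛ φ (w · (g ^ᴳ k))) ≈⟨ K.*-congˡ (eigen (w · (g ^ᴳ k))) ⟩
        (β ^ k) ⊛ (β ⊛ φ ((w · (g ^ᴳ k)) · g)) ≈⟨ x∙yz≈y∙xz (β ^ k) β _ ⟩
        β ⊛ ((β ^ k) ⊛ φ ((w · (g ^ᴳ k)) · g)) ≈⟨ K.*-assoc β (β ^ k) _ ⟨
        (β ⊛ (β ^ k)) ⊛ φ ((w · (g ^ᴳ k)) · g) ≡⟨ cong (λ z → (β ⊛ (β ^ k)) ⊛ φ z) (·-assoc w (g ^ᴳ k) g) ⟩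
        (β ⊛ (β ^ k)) ⊛ φ (w · ((g ^ᴳ k) · g)) ∎
      equal-powers : ζ ^ (A ℕ.* N) ≈ ζ ^ (B ℕ.* N)
      equal-powers = begin
        ζ ^ (A ℕ.* N) ≈⟨ ^-* ζ A N ⟩
        α ^ N ≈⟨ ⊛-cancelʳ (α ^ N) (β ^ N) (φ w₀) φw₀≉0 (K.trans (iterate N w₀)
                (K.*-congˡ (K.reflexive (cong φ (trans (cong (w₀ ·_) gᴺ≡I) (·-identityʳ w₀)))))) ⟩
        β ^ N ≈⟨ ^-* ζ B N ⟨
        ζ ^ (B ℕ.* N) ∎
      conclude : (i ℕ.≤ i') ⊎ (i' ℕ.≤ i) → i ≡ i'
      conclude (inj₁ i≤i') = exponents i i' i≤i' i'<ℓ equal-powers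
      conclude (inj₂ i'≤i) = sym (exponents i' i i'≤i i<ℓ (K.sym equal-powers))

    -- The scalars η ^ i and η ^ i' act on φ through the character. Evaluating the fixed-vector
    -- equation at z = w x⁻¹ therefore gives an eigenvector equation for g = x⁻¹ y, and g fixes v,
    -- so its order is prime to ℓ.
    intersecting-fibres : ∀ (x y : GL) v → P (det (proj₁ x)) → P (det (proj₁ y)) → v ≢ 𝟘 → proj₁ x ▹ v ≡ proj₁ y ▹ v →
      ∀ (i i' : ℕ) g₁ g₂ → proj₁ g₁ ≡ scale (η ^F i) (proj₁ x) → proj₁ g₂ ≡ scale (η ^F i') (proj₁ y) →
      FixDim≥1 g₁ g₂ → i ℕ.< ℓ → i' ℕ.< ℓ → i ≡ i'
    intersecting-fibres x y v Px Py v≢0 agree i i' g₁ g₂ eq₁ eq₂ (φ , inV , nonzero , fixed) =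
      twisted-fixed φ nonzero g i i' eigen (fixes-power g v v≢0 g-fixes m Pg)
      where
      g : GL
      g = (x ⁻¹) · y
      g-fixes : proj₁ g ▹ v ≡ v
      g-fixes = begin
        proj₁ g ▹ v ≡⟨ ▹-·M (proj₁ (x ⁻¹)) (proj₁ y) v ⟩
        proj₁ (x ⁻¹) ▹ (proj₁ y ▹ v) ≡⟨ cong (proj₁ (x ⁻¹) ▹_) agree ⟨
        proj₁ (x ⁻¹) ▹ (proj₁ x ▹ v) ≡⟨ ▹-·M (proj₁ (x ⁻¹)) (proj₁ x) v ⟨
        proj₁ ((x ⁻¹) · x) ▹ v ≡⟨ cong (λ h → proj₁ h ▹ v) (inverseˡ x) ⟩
        IM ▹ v ≡⟨ IM-▹ v ⟩
        v ∎
        where open ≡-Reasoning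
      Pg : P (det (proj₁ g))
      Pg = subst P (sym (det-·M (proj₁ (x ⁻¹)) (proj₁ y))) (P-⊗ (P-cancel {det (proj₁ (x ⁻¹))} {det (proj₁ x)}
             (subst P (trans (sym det-I) (trans (cong (λ h → det (proj₁ h)) (sym (inverseˡ x))) (det-·M (proj₁ (x ⁻¹)) (proj₁ x)))) P-1) Px) Py)
      scaled : ∀ k z h h′ → proj₁ h′ ≡ scale (η ^F k) (proj₁ h) → z · h′ ≡ scalar (η ^F k) (η^≢0 k) · (z · h)
      scaled k z h h′ e = GL-≡ (trans (cong (proj₁ z ·M_) e) (trans (·M-scale (η ^F k) (proj₁ z) (proj₁ h)) (sym (scalarM-· (η ^F k) (proj₁ z ·M proj₁ h)))))
      eigen : ∀ w → (ζ ^ (m ℕ.* (m ℕ.* i))) ⊛ φ w ≈ (ζ ^ (m ℕ.* (m ℕ.* i'))) ⊛ φ (w · g)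
      eigen w = begin
        (ζ ^ (m ℕ.* (m ℕ.* i))) ⊛ φ w ≈⟨ character-scalar φ inV i w ⟨
        φ (scalar (η ^F i) (η^≢0 i) · w) ≡⟨ cong (λ h → φ (scalar (η ^F i) (η^≢0 i) · h)) z·x≡w ⟨
        φ (scalar (η ^F i) (η^≢0 i) · (z · x)) ≡⟨ cong φ (scaled i z x g₁ eq₁) ⟨
        φ (z · g₁) ≈⟨ fixed z ⟩
        φ (z · g₂) ≡⟨ cong φ (scaled i' z y g₂ eq₂) ⟩
        φ (scalar (η ^F i') (η^≢0 i') · (z · y)) ≈⟨ character-scalar φ inV i' (z · y) ⟩
        (ζ ^ (m ℕ.* (m ℕ.* i'))) ⊛ φ (z · y) ≡⟨ cong (λ h → (ζ ^ (m ℕ.* (m ℕ.* i'))) ⊛ φ h) (·-assoc w (x ⁻¹) y) ⟩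
        (ζ ^ (m ℕ.* (m ℕ.* i'))) ⊛ φ (w · g) ∎
        where
        open import Relation.Binary.Reasoning.Setoid K.setoid
        z : GL
        z = w · (x ⁻¹)
        z·x≡w : z · x ≡ w
        z·x≡w = trans (·-assoc w (x ⁻¹) x) (trans (cong (w ·_) (inverseˡ x)) (·-identityʳ w))

  -- The local inequality for fibre counts

  module _ {n : ℕ} (f h : Fin n → ℤ) (f-01 : ∀ i → (f i ≡ 0ℤ) ⊎ (f i ≡ 1ℤ)) (h-01 : ∀ i → (h i ≡ 0ℤ) ⊎ (h i ≡ 1ℤ))
           (same : ∀ i i' → f i ≡ 1ℤ → h i' ≡ 1ℤ → i ≡ i') where

    private
      absent : (k : Fin n → ℤ) → (∀ i → (k i ≡ 0ℤ) ⊎ (k i ≡ 1ℤ)) → ¬ (∃ λ i → k i ≡ 1ℤ) → ∑ (allFin n) k ≡ 0ℤ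
      absent k k-01 none = ∑-zero (allFin n) (λ i → zero-at i (k-01 i))
        where
        zero-at : ∀ i → (k i ≡ 0ℤ) ⊎ (k i ≡ 1ℤ) → k i ≡ 0ℤ
        zero-at i (inj₁ e) = e
        zero-at i (inj₂ e) = ⊥-elim (none (i , e))

      single : (k : Fin n → ℤ) → (∀ i → (k i ≡ 0ℤ) ⊎ (k i ≡ 1ℤ)) → ∀ i₀ → k i₀ ≡ 1ℤ → (∀ i → k i ≡ 1ℤ → i ≡ i₀) → ∑ (allFin n) k ≡ 1ℤ
      single k k-01 i₀ e₀ only = trans (∑-cong (allFin n) (λ i → at i (k-01 i))) (Enum.sift₁ (EFin n) i₀)
        where
        at : ∀ i → (k i ≡ 0ℤ) ⊎ (k i ≡ 1ℤ) → k i ≡ 𝟙 (i Fin.≟ i₀)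
        at i (inj₂ e) = trans e (sym (𝟙-true (i Fin.≟ i₀) (only i e)))
        at i (inj₁ e) = trans e (sym (𝟙-false (i Fin.≟ i₀) (λ { refl → 0≢1ℤ (trans (sym e) e₀) })))
          where
          0≢1ℤ : 0ℤ ≢ 1ℤ
          0≢1ℤ ()

    -- If both supports are nonempty, `same` identifies every index of one with every index of the
    -- other, so they are the same singleton.
    ∑-01 : (∑ (allFin n) f ≡ 0ℤ) ⊎ (∑ (allFin n) h ≡ 0ℤ) ⊎ ((∑ (allFin n) f ≡ 1ℤ) × (∑ (allFin n) h ≡ 1ℤ))
    ∑-01 with FinP.any? (λ i → f i ℤ.≟ 1ℤ) | FinP.any? (λ i → h i ℤ.≟ 1ℤ)
    ... | no none       | _              = inj₁ (absent f f-01 none)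
    ... | yes _         | no none        = inj₂ (inj₁ (absent h h-01 none))
    ... | yes (i₀ , e₀) | yes (i₁ , e₁)  = inj₂ (inj₂ (single f f-01 i₀ e₀ (λ i e → trans (same i i₁ e e₁) (sym (same i₀ i₁ e₀ e₁)))
                , single h h-01 i₁ e₁ (λ i e → trans (sym (same i₀ i e₀ e)) (same i₀ i₁ e₀ e₁))))

  0≤01 : ∀ {k} → (k ≡ 0ℤ) ⊎ (k ≡ 1ℤ) → 0ℤ ≤ k
  0≤01 (inj₁ refl) = +≤+ ℕ.z≤n
  0≤01 (inj₂ refl) = +≤+ ℕ.z≤n

  01≤1 : ∀ {k} → (k ≡ 0ℤ) ⊎ (k ≡ 1ℤ) → k ≤ 1ℤ
  01≤1 (inj₁ refl) = +≤+ ℕ.z≤n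
  01≤1 (inj₂ refl) = +≤+ (ℕ.s≤s ℕ.z≤n)

  -- If X or Y vanishes, the left side is 0 and 0 ≤ X, Y ≤ L makes the right side nonnegative. At X
  -- = Y = 1 the difference is (L - 1)(s - t)².
  local-bound : ∀ L X Y s t → 0ℤ ≤ X → X ≤ L → 0ℤ ≤ Y → Y ≤ L → 1ℤ ≤ L →
                (X ≡ 0ℤ) ⊎ (Y ≡ 0ℤ) ⊎ ((X ≡ 1ℤ) × (Y ≡ 1ℤ)) →
                2ℤ * (s * t) * (L - 1ℤ) * (X * Y) ≤ s * s * (L * X - X * X) + t * t * (L * Y - Y * Y)
  local-bound L X Y s t 0≤X X≤L 0≤Y Y≤L 1≤L = cases
    where
    lhs₀ : ∀ s t L Y → + 2 * (s * t) * (L - 1ℤ) * (0ℤ * Y) ≡ 0ℤ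
    lhs₀ = solve-∀
    lhs₀′ : ∀ s t L X → + 2 * (s * t) * (L - 1ℤ) * (X * 0ℤ) ≡ 0ℤ
    lhs₀′ = solve-∀
    factor : ∀ L X → X * (L - X) ≡ L * X - X * X
    factor = solve-∀
    0≤part : ∀ s X → 0ℤ ≤ X → X ≤ L → 0ℤ ≤ s * s * (L * X - X * X)
    0≤part s X 0≤X X≤L = 0≤-* (0≤² s) (subst (0ℤ ≤_) (factor L X) (0≤-* 0≤X (ℤP.i≤j⇒0≤j-i X≤L)))
    0≤rhs : 0ℤ ≤ s * s * (L * X - X * X) + t * t * (L * Y - Y * Y)
    0≤rhs = ℤP.+-mono-≤ {0ℤ} {_} {0ℤ} (0≤part s X 0≤X X≤L) (0≤part t Y 0≤Y Y≤L)
    ones : ∀ s t L → (L - 1ℤ) * ((s * s + t * t) - + 2 * (s * t)) ≡ (s * s * (L * 1ℤ - 1ℤ * 1ℤ) + t * t * (L * 1ℤ - 1ℤ * 1ℤ)) - + 2 * (s * t) * (L - 1ℤ) * (1ℤ * 1ℤ)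
    ones = solve-∀
    cases : (X ≡ 0ℤ) ⊎ (Y ≡ 0ℤ) ⊎ ((X ≡ 1ℤ) × (Y ≡ 1ℤ)) →
            2ℤ * (s * t) * (L - 1ℤ) * (X * Y) ≤ s * s * (L * X - X * X) + t * t * (L * Y - Y * Y)
    cases (inj₁ refl)               = ℤP.≤-trans (ℤP.≤-reflexive (lhs₀ s t L Y)) 0≤rhs
    cases (inj₂ (inj₁ refl))        = ℤP.≤-trans (ℤP.≤-reflexive (lhs₀′ s t L X)) 0≤rhs
    cases (inj₂ (inj₂ (refl , refl))) = ℤP.0≤i-j⇒j≤i (subst (0ℤ ≤_) (ones s t L) (0≤-* (ℤP.i≤j⇒0≤j-i 1≤L) (ℤP.i≤j⇒0≤j-i (2xy≤x²+y² s t))))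

  -- The upper bound for cross-intersecting pairs

  module UpperBound (F : FiniteField) (K : CharZeroField)
                (ε : FiniteField.Carrier F) (gen : FiniteField.IsGenerator F ε)
                (ℓ m : ℕ) (order≡ : FiniteField.order F ≡ suc (ℓ ℕ.* m))
                (ℓ-prime : Prime ℓ) (ℓ∤2 : ¬ (ℓ ∣ 2)) (ℓ∤m : ¬ (ℓ ∣ m)) (2≤m : 2 ℕ.≤ m)
                (ζ : CharZeroField.Carrier K) (ζ-prim : CharZeroField.IsPrimitiveRoot K ζ (ℓ ℕ.* m)) where
    open Plane F
    open GL2 F using (Mat; Subset; ∣_∣; orderGL)
    open PrincipalSeries F K ε ζ m using (CrossIntersecting)
    open MatrixGroup F
    open Counting F ε gen ℓ m order≡ ℓ-prime ℓ∤2 ℓ∤m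
    open Representation F K ε gen ℓ m order≡ ℓ-prime ℓ∤2 ℓ∤m ζ ζ-prim using (intersecting-fibres)
    open Spectral F P P? P≢0
    open SpectralBound F P P? P≢0
    open CrossBound F P P? P≢0
    open Powers (GL2.CRing F) using (_^_)

    3≤ℓ : + 3 ≤ + ℓ
    3≤ℓ = +≤+ (ℕP.≤∧≢⇒< (ℕ.nonTrivial⇒n>1 ℓ {{prime⇒nonTrivial ℓ-prime}}) (λ { refl → ℓ∤2 (divides 1 refl) }))

    private
      -- `r` is the excess in q = 1 + 2ℓ + r, nonnegative because m ≥ 2. Written in L and r, the
      -- differences behind `gap` and `0<λ₂` have only nonnegative coefficients.
      L r : ℤ
      L = + ℓ
      r = L * (+ m - 2ℤ)

      0≤L : 0ℤ ≤ L
      0≤L = +≤+ ℕ.z≤n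

      0≤r : 0ℤ ≤ r
      0≤r = 0≤-* 0≤L (ℤP.i≤j⇒0≤j-i (+≤+ 2≤m))

      q≡ : q ≡ 1ℤ + 2ℤ * L + r
      q≡ = trans (cong +_ order≡) (trans (cong (_+_ 1ℤ) (ℤP.pos-* ℓ m)) (split L (+ m)))
        where
        split : ∀ L m → 1ℤ + L * m ≡ 1ℤ + + 2 * L + L * (m - + 2)
        split = solve-∀

      gap : (L - 1ℤ) * λ₂ ≤ n
      gap = ℤP.0≤i-j⇒j≤i (subst (0ℤ ≤_) difference (0≤-* 0≤κ (0≤sum 0≤L 0≤r)))
        where
        open ≡-Reasoning
        0≤sum : 0ℤ ≤ L → 0ℤ ≤ r → 0ℤ ≤ + 7 * L + (2ℤ * (L * r) + (+ 4 * r + (r * r + 1ℤ)))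
        0≤sum l r = ℤP.+-mono-≤ {0ℤ} {_} {0ℤ} (0≤-* {+ 7} (+≤+ ℕ.z≤n) l) (ℤP.+-mono-≤ {0ℤ} {_} {0ℤ} (0≤-* {2ℤ} (+≤+ ℕ.z≤n) (0≤-* l r))
                (ℤP.+-mono-≤ {0ℤ} {_} {0ℤ} (0≤-* {+ 4} (+≤+ ℕ.z≤n) r) (ℤP.+-mono-≤ {0ℤ} {_} {0ℤ} (0≤-* r r) (+≤+ ℕ.z≤n))))
        identity : ∀ k L r → k * (+ 7 * L + (+ 2 * (L * r) + (+ 4 * r + (r * r + 1ℤ))))
                ≡ ((1ℤ + + 2 * L + r) * (1ℤ + + 2 * L + r) - 1ℤ) * k - (L - 1ℤ) * (k * (+ 2 * (1ℤ + + 2 * L + r) - 1ℤ))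
        identity = solve-∀
        difference : κ * (+ 7 * L + (2ℤ * (L * r) + (+ 4 * r + (r * r + 1ℤ)))) ≡ n - (L - 1ℤ) * λ₂
        difference = begin
          κ * (+ 7 * L + (2ℤ * (L * r) + (+ 4 * r + (r * r + 1ℤ)))) ≡⟨ identity κ L r ⟩
          ((1ℤ + 2ℤ * L + r) * (1ℤ + 2ℤ * L + r) - 1ℤ) * κ - (L - 1ℤ) * (κ * (2ℤ * (1ℤ + 2ℤ * L + r) - 1ℤ))
            ≡⟨ cong (λ x → (x * x - 1ℤ) * κ - (L - 1ℤ) * (κ * (2ℤ * x - 1ℤ))) q≡ ⟨
          (q * q - 1ℤ) * κ - (L - 1ℤ) * λ₂ ≡⟨ cong (λ x → x - (L - 1ℤ) * λ₂) n≡ ⟨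
          n - (L - 1ℤ) * λ₂ ∎

      0<λ₂ : 0ℤ < λ₂
      0<λ₂ = 0<-* {κ} (0<-* {q} 0<q (subst (0ℤ <_) (sym ∣P∣≡m) (ℤ.+<+ (ℕP.<-≤-trans (ℕ.s≤s ℕ.z≤n) 2≤m))))
        (subst (0ℤ <_) (trans (odd L r) (cong (λ x → 2ℤ * x - 1ℤ) (sym q≡)))
          (ℤP.+-mono-<-≤ {0ℤ} {1ℤ} {0ℤ} (ℤ.+<+ (ℕ.s≤s ℕ.z≤n)) (ℤP.+-mono-≤ {0ℤ} {_} {0ℤ} (0≤-* {+ 4} (+≤+ ℕ.z≤n) 0≤L) (0≤-* {2ℤ} (+≤+ ℕ.z≤n) 0≤r))))
        where
        odd : ∀ L r → 1ℤ + (+ 4 * L + + 2 * r) ≡ + 2 * (1ℤ + + 2 * L + r) - 1ℤ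
        odd = solve-∀
        0<q : 0ℤ < q
        0<q = subst (λ k → 0ℤ < + k) (sym order≡) (ℤ.+<+ (ℕ.s≤s ℕ.z≤n))

      fibre-01 : ∀ S x i → (fibre S x i ≡ 0ℤ) ⊎ (fibre S x i ≡ 1ℤ)
      fibre-01 S x i with ext-01 S (scale (η ^ toℕ i) x)
      ... | inj₁ e       = inj₁ e
      ... | inj₂ (e , _) = inj₂ e

      member : ∀ S x i → fibre S x i ≡ 1ℤ → ∃ λ inv → S (scale (η ^ toℕ i) x , inv) ≡ true
      member S x i e with ext-01 S (scale (η ^ toℕ i) x)
      ... | inj₁ e₀      = ⊥-elim (0≢1ℤ (trans (sym e₀) e))
        where
        0≢1ℤ : 0ℤ ≢ 1ℤ
        0≢1ℤ ()
      ... | inj₂ (_ , p) = p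

      total : Subset → Mat → ℤ
      total S x = ∑ (allFin ℓ) (fibre S x)

      0≤total : ∀ S x → 0ℤ ≤ total S x
      0≤total S x = ∑-nonneg (allFin ℓ) (λ i → 0≤01 (fibre-01 S x i))

      total≤L : ∀ S x → total S x ≤ L
      total≤L S x = ℤP.≤-trans (∑-mono (allFin ℓ) (λ i → 01≤1 (fibre-01 S x i)))
                (ℤP.≤-reflexive (trans (∑Fin-const ℓ 1ℤ) (ℤP.*-identityʳ L)))

      supp : ∀ S → Supp (fibreSum S)
      supp S x = trans (cong (_* total S x) (χ-supp x)) (ℤP.*-assoc (χ x) (χ x) (total S x))

      fibreSum≡ : ∀ S x → P (det x) → fibreSum S x ≡ total S x
      fibreSum≡ S x Px = trans (cong (_* total S x) (𝟙-true (P? (det x)) Px)) (ℤP.*-identityˡ (total S x))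

    upper-bound : ∀ S₁ S₂ → CrossIntersecting S₁ S₂ → (ℓ ℕ.* ℓ) ℕ.* (∣ S₁ ∣ ℕ.* ∣ S₂ ∣) ℕ.≤ orderGL ℕ.* orderGL
    upper-bound S₁ S₂ cross = ℤP.drop‿+≤+ (ℤP.≤-trans (ℤP.≤-reflexive lhs≡)
        (ℤP.≤-trans (*-mono-≤-0≤ (0≤² L) bound) (ℤP.≤-reflexive rhs≡)))
      where
      open ≡-Reasoning
      alternatives : ∀ x y v → P (det x) → P (det y) → v ≢ 𝟘 → x ▹ v ≡ y ▹ v →
                (total S₁ x ≡ 0ℤ) ⊎ (total S₂ y ≡ 0ℤ) ⊎ ((total S₁ x ≡ 1ℤ) × (total S₂ y ≡ 1ℤ))
      alternatives x y v Px Py v≢0 agree = ∑-01 (fibre S₁ x) (fibre S₂ y) (fibre-01 S₁ x) (fibre-01 S₂ y) (λ i i' e e' →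
        FinP.toℕ-injective (intersecting-fibres (toGL′ x (P≢0 (det x) Px)) (toGL′ y (P≢0 (det y) Py)) v Px Py v≢0 agree
          (toℕ i) (toℕ i') (scale (η ^ toℕ i) x , proj₁ (member S₁ x i e)) (scale (η ^ toℕ i') y , proj₁ (member S₂ y i' e')) refl refl
          (cross _ _ (proj₂ (member S₁ x i e)) (proj₂ (member S₂ y i' e')))
          (FinP.toℕ<n i) (FinP.toℕ<n i')))
      local : ∀ s t x y v → P (det x) → P (det y) → v ≢ 𝟘 → x ▹ v ≡ y ▹ v →
              2ℤ * (s * t) * (L - 1ℤ) * (fibreSum S₁ x * fibreSum S₂ y)
              ≤ s * s * (L * fibreSum S₁ x - fibreSum S₁ x * fibreSum S₁ x) + t * t * (L * fibreSum S₂ y - fibreSum S₂ y * fibreSum S₂ y)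
      local s t x y v Px Py v≢0 agree = subst₂
        (λ X Y → 2ℤ * (s * t) * (L - 1ℤ) * (X * Y) ≤ s * s * (L * X - X * X) + t * t * (L * Y - Y * Y))
        (sym (fibreSum≡ S₁ x Px)) (sym (fibreSum≡ S₂ y Py))
        (local-bound L (total S₁ x) (total S₂ y) s t (0≤total S₁ x) (total≤L S₁ x) (0≤total S₂ y) (total≤L S₂ y)
          (ℤP.≤-trans (+≤+ (ℕ.s≤s ℕ.z≤n)) 3≤ℓ) (alternatives x y v Px Py v≢0 agree))
      0≤fibreSum : ∀ S x → 0ℤ ≤ fibreSum S x
      0≤fibreSum S x = 0≤-* (0≤𝟙 (P? (det x))) (0≤total S x)
      bound : + ∣ S₁ ∣ * + ∣ S₂ ∣ ≤ n * n
      bound = subst₂ (λ x y → x * y ≤ n * n) (∑-fibreSum S₁) (∑-fibreSum S₂)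
        (sum-product-bound L 3≤ℓ 0<λ₂ gap (fibreSum S₁) (fibreSum S₂) (supp S₁) (supp S₂) (0≤fibreSum S₁) (0≤fibreSum S₂) local)
      lhs≡ : + ((ℓ ℕ.* ℓ) ℕ.* (∣ S₁ ∣ ℕ.* ∣ S₂ ∣)) ≡ L * L * (+ ∣ S₁ ∣ * + ∣ S₂ ∣)
      lhs≡ = trans (ℤP.pos-* (ℓ ℕ.* ℓ) (∣ S₁ ∣ ℕ.* ∣ S₂ ∣)) (cong₂ _*_ (ℤP.pos-* ℓ ℓ) (ℤP.pos-* ∣ S₁ ∣ ∣ S₂ ∣))
      rhs≡ : L * L * (n * n) ≡ + (orderGL ℕ.* orderGL)
      rhs≡ = trans (regroup L n) (trans (sym (cong₂ _*_ orderGL≡ orderGL≡)) (sym (ℤP.pos-* orderGL orderGL)))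
        where
        regroup : ∀ L n → L * L * (n * n) ≡ (L * n) * (L * n)
        regroup = solve-∀

  -- Conjugation and cyclic vectors

  module Conjugation (F : FiniteField) where
    open Plane F
    open GL2 F using (Mat; mat; a; b; c; d; GL; _·M_; _·_)
    open MatrixGroup F
    open ≡-Reasoning

    conj : GL → GL → GL
    conj x g = (x · g) · (x ⁻¹)

    conj-· : ∀ x g h → conj x g · conj x h ≡ conj x (g · h)
    conj-· x g h = begin
      ((x · g) · (x ⁻¹)) · ((x · h) · (x ⁻¹)) ≡⟨ ·-assoc ((x · g) · (x ⁻¹)) (x · h) (x ⁻¹) ⟨
      (((x · g) · (x ⁻¹)) · (x · h)) · (x ⁻¹) ≡⟨ cong (_· (x ⁻¹)) (·-assoc (x · g) (x ⁻¹) (x · h)) ⟩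
      ((x · g) · ((x ⁻¹) · (x · h))) · (x ⁻¹) ≡⟨ cong (λ z → ((x · g) · z) · (x ⁻¹)) (·-assoc (x ⁻¹) x h) ⟨
      ((x · g) · (((x ⁻¹) · x) · h)) · (x ⁻¹) ≡⟨ cong (λ z → ((x · g) · (z · h)) · (x ⁻¹)) (inverseˡ x) ⟩
      ((x · g) · (I · h)) · (x ⁻¹) ≡⟨ cong (λ z → ((x · g) · z) · (x ⁻¹)) (·-identityˡ h) ⟩
      ((x · g) · h) · (x ⁻¹) ≡⟨ cong (_· (x ⁻¹)) (·-assoc x g h) ⟩
      (x · (g · h)) · (x ⁻¹) ∎

    conj-^ᴳ : ∀ x g k → conj x (g ^ᴳ k) ≡ conj x g ^ᴳ k
    conj-^ᴳ x g zero    = trans (cong (_· (x ⁻¹)) (·-identityʳ x)) (inverseʳ x)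
    conj-^ᴳ x g (suc k) = trans (sym (conj-· x (g ^ᴳ k) g)) (cong (_· conj x g) (conj-^ᴳ x g k))

    conj-relation : ∀ x g → conj x g · x ≡ x · g
    conj-relation x g = trans (·-assoc (x · g) (x ⁻¹) x) (trans (cong ((x · g) ·_) (inverseˡ x)) (·-identityʳ (x · g)))

    det-conj : ∀ x g → det (proj₁ (conj x g)) ≡ det (proj₁ g)
    det-conj x g = begin
      det (proj₁ (conj x g)) ≡⟨ det-·M (proj₁ (x · g)) (proj₁ (x ⁻¹)) ⟩
      det (proj₁ (x · g)) ⊗ det (proj₁ (x ⁻¹)) ≡⟨ cong (_⊗ det (proj₁ (x ⁻¹))) (det-·M (proj₁ x) (proj₁ g)) ⟩
      (det (proj₁ x) ⊗ det (proj₁ g)) ⊗ det (proj₁ (x ⁻¹)) ≡⟨ solve 3 (λ x g y → (x :* g) :* y := (x :* y) :* g) refl (det (proj₁ x)) (det (proj₁ g)) (det (proj₁ (x ⁻¹))) ⟩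
      (det (proj₁ x) ⊗ det (proj₁ (x ⁻¹))) ⊗ det (proj₁ g) ≡⟨ unit-cancel (det (proj₁ g)) (trans (sym (det-·M (proj₁ x) (proj₁ (x ⁻¹)))) (trans (cong (λ z → det (proj₁ z)) (inverseʳ x)) det-I)) ⟩
      det (proj₁ g) ∎

    IsScalar : GL → Set
    IsScalar g = ∃ λ s → proj₁ g ≡ scalarM s

    private
      conj-I : ∀ g → conj I g ≡ g
      conj-I g = trans (sym (·-identityʳ (conj I g))) (trans (conj-relation I g) (·-identityˡ g))

      :0 : ∀ {n} → Polynomial n
      :0 = con (0 , 0)

      swapM shearM : Mat
      swapM  = mat 0# 1# 1# 0#
      shearM = mat 1# 0# 1# 1#

      swap shear : GL
      swap  = toGL′ swapM (λ e → 0≢1 (trans (sym -0#≈0#) (trans (cong ⊖_ (sym e)) (solve 0 ((:- ((:0 :* :0) :+ (:- (:1 :* :1)))) := :1) refl))))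
        where open import Algebra.Properties.Ring R.ring using (-0#≈0#)
      shear = toGL′ shearM (λ e → 0≢1 (trans (sym e) (solve 0 (((:1 :* :1) :+ (:- (:0 :* :1))) := :1) refl)))

      -- Here and for `shear` the entry is obtained by comparing entries in `conj-relation`, which
      -- avoids computing an inverse matrix.
      conj-swap : ∀ g → c (proj₁ (conj swap g)) ≡ b (proj₁ g)
      conj-swap g = begin
        c h ≡⟨ solve 2 (λ s t → s := (s :* :1) :+ (t :* :0)) refl (c h) (d h) ⟩
        (c h ⊗ 1#) ⊕ (d h ⊗ 0#) ≡⟨ cong (λ z → d (proj₁ z)) (conj-relation swap g) ⟩
        (1# ⊗ b M) ⊕ (0# ⊗ d M) ≡⟨ solve 2 (λ b d → (:1 :* b) :+ (:0 :* d) := b) refl (b M) (d M) ⟩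
        b M ∎
        where
        M = proj₁ g
        h = proj₁ (conj swap g)

      conj-shear : ∀ g → b (proj₁ g) ≡ 0# → c (proj₁ g) ≡ 0# → c (proj₁ (conj shear g)) ≡ a (proj₁ g) ⊕ (⊖ d (proj₁ g))
      conj-shear g b≡0 c≡0 = begin
        c h
          ≡⟨ solve 2 (λ s t → s := ((s :* :1) :+ (t :* :1)) :+ (:- ((s :* :0) :+ (t :* :1)))) refl (c h) (d h) ⟩
        ((c h ⊗ 1#) ⊕ (d h ⊗ 1#)) ⊕ (⊖ ((c h ⊗ 0#) ⊕ (d h ⊗ 1#)))
          ≡⟨ cong (λ z → c (proj₁ z) ⊕ (⊖ d (proj₁ z))) (conj-relation shear g) ⟩
        ((1# ⊗ a M) ⊕ (1# ⊗ c M)) ⊕ (⊖ ((1# ⊗ b M) ⊕ (1# ⊗ d M)))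
          ≡⟨ cong₂ (λ x y → ((1# ⊗ a M) ⊕ (1# ⊗ x)) ⊕ (⊖ ((1# ⊗ y) ⊕ (1# ⊗ d M)))) c≡0 b≡0 ⟩
        ((1# ⊗ a M) ⊕ (1# ⊗ 0#)) ⊕ (⊖ ((1# ⊗ 0#) ⊕ (1# ⊗ d M)))
          ≡⟨ solve 2 (λ a d → ((:1 :* a) :+ (:1 :* :0)) :+ (:- ((:1 :* :0) :+ (:1 :* d))) := a :+ (:- d)) refl (a M) (d M) ⟩
        a M ⊕ (⊖ d M) ∎
        where
        M = proj₁ g
        h = proj₁ (conj shear g)

    -- A non-scalar matrix has a cyclic vector, which can be taken to be e₁, e₂ or e₁ + e₂.
    cyclic-or-scalar : ∀ g → ∃ λ x → (c (proj₁ (conj x g)) ≢ 0#) ⊎ IsScalar (conj x g)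
    cyclic-or-scalar g@(mat p r s t , _) = cases (s ≟F 0#) (r ≟F 0#) (p ≟F t)
      where
      open import Algebra.Properties.AbelianGroup R.+-abelianGroup using (x∙y⁻¹≈ε⇒x≈y)
      cases : Dec (s ≡ 0#) → Dec (r ≡ 0#) → Dec (p ≡ t) → ∃ λ x → (c (proj₁ (conj x g)) ≢ 0#) ⊎ IsScalar (conj x g)
      cases (no s≢0)  _         _         = I , inj₁ (λ e → s≢0 (trans (sym (cong (λ z → c (proj₁ z)) (conj-I g))) e))
      cases (yes _)   (no r≢0)  _         = swap , inj₁ (λ e → r≢0 (trans (sym (conj-swap g)) e))
      cases (yes s≡0) (yes r≡0) (no p≢t)  = shear , inj₁ (λ e → p≢t (x∙y⁻¹≈ε⇒x≈y p t (trans (sym (conj-shear g r≡0 s≡0)) e)))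
      cases (yes s≡0) (yes r≡0) (yes p≡t) = I , inj₂ (p , trans (cong proj₁ (conj-I g)) (mat-≡ refl r≡0 s≡0 (sym p≡t)))

    -- X = h ^ k commutes with h. With c X = 0 the lower left entries of h X = X h give c h · a X =
    -- d X · c h, and c h ≠ 0 cancels. Powers of a scalar matrix are scalar anyway.
    triangular-power : ∀ h → (c (proj₁ h) ≢ 0#) ⊎ IsScalar h → ∀ k → c (proj₁ (h ^ᴳ k)) ≡ 0# → a (proj₁ (h ^ᴳ k)) ≡ d (proj₁ (h ^ᴳ k))
    triangular-power h (inj₁ s≢0) k γ≡0 = sym (⊗-cancelʳ (d X) (a X) (c H) s≢0 (begin
      d X ⊗ c H ≡⟨ solve 2 (λ dc a → dc := (:0 :* a) :+ dc) refl (d X ⊗ c H) (a H) ⟩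
      (0# ⊗ a H) ⊕ (d X ⊗ c H) ≡⟨ cong (λ z → (z ⊗ a H) ⊕ (d X ⊗ c H)) γ≡0 ⟨
      (c X ⊗ a H) ⊕ (d X ⊗ c H) ≡⟨ cong (λ z → c (proj₁ z)) (^ᴳ-comm h k) ⟨
      (c H ⊗ a X) ⊕ (d H ⊗ c X) ≡⟨ cong (λ z → (c H ⊗ a X) ⊕ (d H ⊗ z)) γ≡0 ⟩
      (c H ⊗ a X) ⊕ (d H ⊗ 0#) ≡⟨ solve 3 (λ c a d → (c :* a) :+ (d :* :0) := a :* c) refl (c H) (a X) (d H) ⟩
      a X ⊗ c H ∎))
      where
      H = proj₁ h
      X = proj₁ (h ^ᴳ k)
    triangular-power h (inj₂ (s , h≡)) k γ≡0 = trans (cong a (proj₂ (powers k))) (sym (cong d (proj₂ (powers k))))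
      where
      powers : ∀ k → IsScalar (h ^ᴳ k)
      powers zero    = 1# , refl
      powers (suc k) = (proj₁ (powers k) ⊗ s) , trans (cong₂ _·M_ (proj₂ (powers k)) h≡)
        (trans (scalarM-· (proj₁ (powers k)) (scalarM s)) (mat-≡ refl (R.zeroʳ _) (R.zeroʳ _) refl))

  -- Invariant functions, and a pair attaining the bound

  module LowerBound (F : FiniteField) (K : CharZeroField)
                (ε : FiniteField.Carrier F) (gen : FiniteField.IsGenerator F ε)
                (ℓ m : ℕ) (order≡ : FiniteField.order F ≡ suc (ℓ ℕ.* m))
                (ℓ-prime : Prime ℓ) (ℓ∤2 : ¬ (ℓ ∣ 2)) (ℓ∤m : ¬ (ℓ ∣ m))
                (ζ : CharZeroField.Carrier K) (ζ-prim : CharZeroField.IsPrimitiveRoot K ζ (ℓ ℕ.* m)) where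
    open Plane F
    open GL2 F using (CRing; a; b; c; d; GL; _·_; ∣_∣; orderGL)
    open PrincipalSeries F K ε ζ m using (InV; FixDim≥1; CrossIntersecting)
    open Cyclic F ε gen (ℓ ℕ.* m) order≡
    open MatrixGroup F
    open Conjugation F
    open Counting F ε gen ℓ m order≡ ℓ-prime ℓ∤2 ℓ∤m
    open RootsOfUnity K ζ (ℓ ℕ.* m) ζ-prim
    module K = CommutativeRing KRing
    open K using (_≈_) renaming (_*_ to _⊛_; _+_ to _⊞_; 0# to 0ᴷ; 1# to 1ᴷ)
    module Pow = Powers KRing
    open Pow using () renaming (_^_ to _^ᴷ_)
    open Powers CRing using (_^_; ^-+)
    open import Relation.Binary.Reasoning.Setoid K.setoid

    -- Exponents of ε are determined modulo ℓ m, and ζ ^ (ℓ m) = 1, so the choice made by `log` does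
    -- not matter.
    μ-wellDefined : ∀ i j → ε ^ i ≡ ε ^ j → ζ ^ᴷ (m ℕ.* i) ≈ ζ ^ᴷ (m ℕ.* j)
    μ-wellDefined i j e = conclude (ℕP.≤-total i j)
      where
      ordered : ∀ i j → i ℕ.≤ j → ε ^ i ≡ ε ^ j → ζ ^ᴷ (m ℕ.* i) ≈ ζ ^ᴷ (m ℕ.* j)
      ordered i j i≤j e = begin
        ζ ^ᴷ (m ℕ.* i) ≈⟨ K.*-identityˡ _ ⟨
        1ᴷ ⊛ (ζ ^ᴷ (m ℕ.* i)) ≈⟨ K.*-congʳ (Pow.^-multiple ζ (proj₁ ζ-prim) (∣n⇒∣m*n m (order∣ (j ℕ.∸ i) (^-difference i j ε≢0 i≤j e)))) ⟨
        (ζ ^ᴷ (m ℕ.* (j ℕ.∸ i))) ⊛ (ζ ^ᴷ (m ℕ.* i)) ≈⟨ Pow.^-+ ζ (m ℕ.* (j ℕ.∸ i)) (m ℕ.* i) ⟨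
        ζ ^ᴷ (m ℕ.* (j ℕ.∸ i) ℕ.+ m ℕ.* i) ≡⟨ cong (ζ ^ᴷ_) (trans (sym (ℕP.*-distribˡ-+ m (j ℕ.∸ i) i)) (cong (m ℕ.*_) (ℕP.m∸n+n≡m i≤j))) ⟩
        ζ ^ᴷ (m ℕ.* j) ∎
      conclude : (i ℕ.≤ j) ⊎ (j ℕ.≤ i) → ζ ^ᴷ (m ℕ.* i) ≈ ζ ^ᴷ (m ℕ.* j)
      conclude (inj₁ i≤j) = ordered i j i≤j e
      conclude (inj₂ j≤i) = K.sym (ordered j i j≤i (sym e))

    private
      μDec : (x : Carrier) → Dec (x ≡ 0#) → K.Carrier
      μDec x (yes _)  = 0ᴷ
      μDec x (no x≢0) = ζ ^ᴷ (m ℕ.* log x x≢0)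

    -- The character μ_m, extended by zero.
    μᴷ : Carrier → K.Carrier
    μᴷ x = μDec x (x ≟F 0#)

    μᴷ-ε : ∀ x j → x ≡ ε ^ j → μᴷ x ≈ ζ ^ᴷ (m ℕ.* j)
    μᴷ-ε x j e = dec (x ≟F 0#)
      where
      dec : ∀ D → μDec x D ≈ ζ ^ᴷ (m ℕ.* j)
      dec (yes x≡0) = ⊥-elim (^-≢0 j ε≢0 (trans (sym e) x≡0))
      dec (no x≢0)  = μ-wellDefined (log x x≢0) j (trans (ε^log x x≢0) e)

    μᴷ-⊗ : ∀ y j x → y ≡ ε ^ j → x ≢ 0# → μᴷ (y ⊗ x) ≈ (ζ ^ᴷ (m ℕ.* j)) ⊛ μᴷ x
    μᴷ-⊗ y j x e x≢0 = begin
      μᴷ (y ⊗ x) ≈⟨ μᴷ-ε (y ⊗ x) (j ℕ.+ k) (trans (cong₂ _⊗_ e (sym (ε^log x x≢0))) (sym (^-+ ε j k))) ⟩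
      ζ ^ᴷ (m ℕ.* (j ℕ.+ k)) ≡⟨ cong (ζ ^ᴷ_) (ℕP.*-distribˡ-+ m j k) ⟩
      ζ ^ᴷ (m ℕ.* j ℕ.+ m ℕ.* k) ≈⟨ Pow.^-+ ζ (m ℕ.* j) (m ℕ.* k) ⟩
      (ζ ^ᴷ (m ℕ.* j)) ⊛ (ζ ^ᴷ (m ℕ.* k)) ≈⟨ K.*-congˡ (μᴷ-ε x k (sym (ε^log x x≢0))) ⟨
      (ζ ^ᴷ (m ℕ.* j)) ⊛ μᴷ x ∎
      where k = log x x≢0

    -- x² ∈ P means that ℓ divides 2 log x, hence log x because ℓ is odd; μ_m is trivial on ε ^ k as
    -- soon as ℓ divides k.
    μᴷ-square : ∀ x → x ≢ 0# → P (x ⊗ x) → μᴷ x ≈ 1ᴷ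
    μᴷ-square x x≢0 Pxx = K.trans (μᴷ-ε x k (sym (ε^log x x≢0))) (Pow.^-multiple ζ (proj₁ ζ-prim) (subst (ℓ ℕ.* m ∣_) (ℕP.*-comm k m) (*-monoˡ-∣ m ℓ∣k)))
      where
      k = log x x≢0
      ℓ∣2k : ℓ ∣ 2 ℕ.* k
      ℓ∣2k = subst (ℓ ∣_) (cong (k ℕ.+_) (sym (ℕP.+-identityʳ k))) (P-ε⇒ (k ℕ.+ k) (subst P (trans (cong₂ _⊗_ (sym (ε^log x x≢0)) (sym (ε^log x x≢0))) (sym (^-+ ε k k))) Pxx))
      ℓ∣k : ℓ ∣ k
      ℓ∣k with euclidsLemma 2 k ℓ-prime ℓ∣2k
      ... | inj₁ ℓ∣2 = ⊥-elim (ℓ∤2 ℓ∣2)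
      ... | inj₂ ℓ∣k = ℓ∣k

    private
      δDec : (z : GL) → Dec (c (proj₁ z) ≡ 0#) → K.Carrier
      δDec z (yes _) = μᴷ (a (proj₁ z))
      δDec z (no _)  = 0ᴷ

    -- The element of V_{m,0} supported on the upper triangular matrices.
    δ : GL → K.Carrier
    δ z = δDec z (c (proj₁ z) ≟F 0#)

    δ-InV : InV δ
    δ-InV u j γ≡0 α≡ z = dec (c Z ≟F 0#) (c UZ ≟F 0#)
      where
      U = proj₁ u
      Z = proj₁ z
      UZ = proj₁ (u · z)
      c≡ : c UZ ≡ d U ⊗ c Z
      c≡ = trans (cong (λ y → (y ⊗ a Z) ⊕ (d U ⊗ c Z)) γ≡0) (trans (cong (_⊕ (d U ⊗ c Z)) (R.zeroˡ (a Z))) (R.+-identityˡ _))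
      d≢0 : d U ≢ 0#
      d≢0 e = det≢0 u (trans (cong₂ (λ x y → (a U ⊗ x) ⊕ (⊖ (b U ⊗ y))) e γ≡0)
                (trans (cong₂ (λ x y → x ⊕ (⊖ y)) (R.zeroʳ (a U)) (R.zeroʳ (b U))) (R.-‿inverseʳ 0#)))
      dec : ∀ D D′ → δDec (u · z) D′ ≈ (ζ ^ᴷ (m ℕ.* j)) ⊛ δDec z D
      dec (no _)    (no _)     = K.sym (K.zeroʳ _)
      dec (no c≢0)  (yes cuz)  = ⊥-elim (⊗-≢0 d≢0 c≢0 (trans (sym c≡) cuz))
      dec (yes cz)  (no cuz≢0) = ⊥-elim (cuz≢0 (trans c≡ (trans (cong (d U ⊗_) cz) (R.zeroʳ (d U)))))
      dec (yes cz)  (yes _)    = K.trans (K.reflexive (cong μᴷ a≡)) (μᴷ-⊗ (a U) j (a Z) α≡ a≢0)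
        where
        a≡ : a UZ ≡ a U ⊗ a Z
        a≡ = trans (cong (λ y → (a U ⊗ a Z) ⊕ (b U ⊗ y)) cz) (trans (cong ((a U ⊗ a Z) ⊕_) (R.zeroʳ (b U))) (R.+-identityʳ _))
        a≢0 : a Z ≢ 0#
        a≢0 e = det≢0 z (trans (cong₂ (λ x y → (x ⊗ d Z) ⊕ (⊖ (b Z ⊗ y))) e cz)
                (trans (cong₂ (λ x y → x ⊕ (⊖ y)) (R.zeroˡ (d Z)) (R.zeroʳ (b Z))) (R.-‿inverseʳ 0#)))

    -- An upper triangular z with equal diagonal entries has determinant a², so `μᴷ-square` applies.
    δ-01 : ∀ z → P (det (proj₁ z)) → (c (proj₁ z) ≡ 0# → a (proj₁ z) ≡ d (proj₁ z)) → (δ z ≈ 0ᴷ) ⊎ (δ z ≈ 1ᴷ)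
    δ-01 z Pz a≡d = dec (c Z ≟F 0#)
      where
      open import Algebra.Properties.Ring R.ring using (-0#≈0#)
      Z = proj₁ z
      dec : ∀ D → (δDec z D ≈ 0ᴷ) ⊎ (δDec z D ≈ 1ᴷ)
      dec (no _)    = inj₁ K.refl
      dec (yes cz)  = inj₂ (μᴷ-square (a Z) a≢0 (subst P det≡ Pz))
        where
        det≡ : det Z ≡ a Z ⊗ a Z
        det≡ = trans (cong₂ (λ x y → (a Z ⊗ x) ⊕ (⊖ (b Z ⊗ y))) (sym (a≡d cz)) cz)
          (trans (cong (λ y → (a Z ⊗ a Z) ⊕ (⊖ y)) (R.zeroʳ (b Z))) (trans (cong ((a Z ⊗ a Z) ⊕_) -0#≈0#) (R.+-identityʳ _)))
        a≢0 : a Z ≢ 0#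
        a≢0 e = det≢0 z (trans det≡ (trans (cong (_⊗ a Z) e) (R.zeroˡ _)))

    δ-I : δ I ≈ 1ᴷ
    δ-I = dec (c (proj₁ I) ≟F 0#)
      where
      dec : ∀ D → δDec I D ≈ 1ᴷ
      dec (yes _) = K.trans (μᴷ-ε 1# 0 refl) (K.reflexive (cong (ζ ^ᴷ_) (ℕP.*-zeroʳ m)))
      dec (no ne) = ⊥-elim (ne refl)

    sumᴷ : ℕ → (ℕ → K.Carrier) → K.Carrier
    sumᴷ zero    h = 0ᴷ
    sumᴷ (suc k) h = h k ⊞ sumᴷ k h

    sumᴷ-cong : ∀ k {h h′} → (∀ i → h i ≈ h′ i) → sumᴷ k h ≈ sumᴷ k h′
    sumᴷ-cong zero    e = K.refl
    sumᴷ-cong (suc k) e = K.+-cong (e k) (sumᴷ-cong k e)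

    sumᴷ-*ˡ : ∀ k x h → sumᴷ k (λ i → x ⊛ h i) ≈ x ⊛ sumᴷ k h
    sumᴷ-*ˡ zero    x h = K.sym (K.zeroʳ x)
    sumᴷ-*ˡ (suc k) x h = K.trans (K.+-congˡ (sumᴷ-*ˡ k x h)) (K.sym (K.distribˡ x (h k) (sumᴷ k h)))

    sumᴷ-shift : ∀ k h → h k ≈ h 0 → sumᴷ k (λ i → h (suc i)) ≈ sumᴷ k h
    sumᴷ-shift k h hk≈h0 = ∙-cancelʳ (h 0) _ _ (K.trans (telescope k) (K.+-congˡ hk≈h0))
      where
      open import Algebra.Properties.AbelianGroup K.+-abelianGroup using (∙-cancelʳ)
      telescope : ∀ k → sumᴷ k (λ i → h (suc i)) ⊞ h 0 ≈ sumᴷ k h ⊞ h k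
      telescope zero    = K.refl
      telescope (suc k) = begin
        (h (suc k) ⊞ sumᴷ k (λ i → h (suc i))) ⊞ h 0 ≈⟨ K.+-assoc _ _ _ ⟩
        h (suc k) ⊞ (sumᴷ k (λ i → h (suc i)) ⊞ h 0) ≈⟨ K.+-congˡ (telescope k) ⟩
        h (suc k) ⊞ (sumᴷ k h ⊞ h k) ≈⟨ K.+-comm _ _ ⟩
        (sumᴷ k h ⊞ h k) ⊞ h (suc k) ≈⟨ K.+-congʳ (K.+-comm _ _) ⟩
        (h k ⊞ sumᴷ k h) ⊞ h (suc k) ∎

    -- The sum is recorded as a positive natural number, the form in which characteristic zero
    -- excludes 0.
    sumᴷ-01 : ∀ h → h 0 ≈ 1ᴷ → (∀ i → (h i ≈ 0ᴷ) ⊎ (h i ≈ 1ᴷ)) → ∀ k → ∃ λ t → sumᴷ (suc k) h ≈ natToRing _⊞_ 0ᴷ 1ᴷ (suc t)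
    sumᴷ-01 h h0 h-01 zero    = 0 , K.+-congʳ h0
    sumᴷ-01 h h0 h-01 (suc k) with sumᴷ-01 h h0 h-01 k | h-01 (suc k)
    ... | t , e | inj₁ z = t , K.trans (K.+-cong z e) (K.+-identityˡ _)
    ... | t , e | inj₂ o = suc t , K.+-cong o e

    invariant-vector : ∀ g → P (det (proj₁ g)) →
      ∃ λ f → InV f × (∃ λ x → ¬ (f x ≈ 0ᴷ)) × (∀ x → f (x · g) ≈ f x)
    invariant-vector g Pg = f , f-InV , (x₀ , f-nonzero) , f-invariant
      where
      N-1 = proj₁ (finite-order g)
      gᴺ≡I : g ^ᴳ suc N-1 ≡ I
      gᴺ≡I = proj₂ (finite-order g)
      x₀ : GL
      x₀ = proj₁ (cyclic-or-scalar g)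

      -- Translating δ by x₀⁻¹ makes its values at x₀ equal to δ (x₀ g ^ k x₀⁻¹), where
      -- `triangular-power` applies. The exponent `suc N-1` need not be minimal: it only has to give
      -- g ^ suc N-1 = I for the cyclic shift.
      term : GL → ℕ → K.Carrier
      term x k = δ ((x · (g ^ᴳ k)) · (x₀ ⁻¹))

      f : GL → K.Carrier
      f x = sumᴷ (suc N-1) (term x)

      f-InV : InV f
      f-InV u j γ≡0 α≡ x = K.trans (sumᴷ-cong (suc N-1) (λ k → K.trans
          (K.reflexive (cong δ (trans (cong (_· (x₀ ⁻¹)) (·-assoc u x (g ^ᴳ k))) (·-assoc u (x · (g ^ᴳ k)) (x₀ ⁻¹)))))
          (δ-InV u j γ≡0 α≡ ((x · (g ^ᴳ k)) · (x₀ ⁻¹)))))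
        (sumᴷ-*ˡ (suc N-1) (ζ ^ᴷ (m ℕ.* j)) (term x))

      f-invariant : ∀ x → f (x · g) ≈ f x
      f-invariant x = K.trans (sumᴷ-cong (suc N-1) (λ k → K.reflexive (cong (λ z → δ (z · (x₀ ⁻¹)))
          (trans (·-assoc x g (g ^ᴳ k)) (cong (x ·_) (^ᴳ-comm g k))))))
        (sumᴷ-shift (suc N-1) (term x) (K.reflexive (cong (λ z → δ ((x · z) · (x₀ ⁻¹))) gᴺ≡I)))

      P-power : ∀ k → P (det (proj₁ g) ^ k)
      P-power zero    = P-1
      P-power (suc k) = P-⊗ Pg (P-power k)

      term-01 : ∀ k → (term x₀ k ≈ 0ᴷ) ⊎ (term x₀ k ≈ 1ᴷ)
      term-01 k = δ-01 (conj x₀ (g ^ᴳ k))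
        (subst P (sym (trans (det-conj x₀ (g ^ᴳ k)) (det-^ᴳ g k))) (P-power k))
        (subst (λ z → c (proj₁ z) ≡ 0# → a (proj₁ z) ≡ d (proj₁ z)) (sym (conj-^ᴳ x₀ g k))
          (triangular-power (conj x₀ g) (proj₂ (cyclic-or-scalar g)) k))

      f-nonzero : ¬ (f x₀ ≈ 0ᴷ)
      f-nonzero e = CharZeroField.charZero K (proj₁ positive) (K.trans (K.sym (proj₂ positive)) e)
        where
        positive : ∃ λ t → f x₀ ≈ natToRing _⊞_ 0ᴷ 1ᴷ (suc t)
        positive = sumᴷ-01 (term x₀) (K.trans (K.reflexive (cong δ (conj-^ᴳ x₀ g 0))) δ-I) term-01 N-1

    kernel-cross-intersecting : CrossIntersecting kernel kernel
    kernel-cross-intersecting g₁ g₂ in₁ in₂ = extract (invariant-vector g Pg)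
      where
      member : ∀ h → kernel h ≡ true → P (det (proj₁ h))
      member h e with P? (det (proj₁ h))
      ... | yes Ph = Ph
      -- Invariance under g₂⁻¹ g₁, read at x g₂, is the required equality f (x g₁) = f (x g₂).
      g : GL
      g = (g₂ ⁻¹) · g₁
      Pg : P (det (proj₁ g))
      Pg = subst P (sym (det-·M (proj₁ (g₂ ⁻¹)) (proj₁ g₁))) (P-⊗ (P-cancel {det (proj₁ (g₂ ⁻¹))} {det (proj₁ g₂)}
             (subst P (trans (sym det-I) (trans (cong (λ h → det (proj₁ h)) (sym (inverseˡ g₂))) (det-·M (proj₁ (g₂ ⁻¹)) (proj₁ g₂)))) P-1)
             (member g₂ in₂)) (member g₁ in₁))
      extract : (∃ λ f → InV f × (∃ λ x → ¬ (f x ≈ 0ᴷ)) × (∀ x → f (x · g) ≈ f x)) → FixDim≥1 g₁ g₂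
      extract (f , inV , nonzero , invariant) = f , inV , nonzero ,
        λ x → K.trans (K.reflexive (cong f (sym (cancel-middle x g₂ g₁)))) (invariant (x · g₂))

    kernel-attains : (ℓ ℕ.* ℓ) ℕ.* (∣ kernel ∣ ℕ.* ∣ kernel ∣) ≡ orderGL ℕ.* orderGL
    kernel-attains = trans (S.solve 2 (λ l s → (l S.:* l) S.:* (s S.:* s) S.:= (l S.:* s) S.:* (l S.:* s)) refl ℓ ∣ kernel ∣) (cong₂ ℕ._*_ index index)
      where
      module S = +-*-Solver
      index : ℓ ℕ.* ∣ kernel ∣ ≡ orderGL
      index = ℤP.+-injective (trans (ℤP.pos-* ℓ ∣ kernel ∣) (trans (cong (+ ℓ *_) ∣kernel∣) (sym orderGL≡)))

  -- Consequences of parity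

  odd-prime∤2 : ∀ ℓ → Prime ℓ → ℓ % 2 ≡ 1 → ¬ (ℓ ∣ 2)
  odd-prime∤2 ℓ ℓ-prime odd ℓ∣2 with ℕP.≤-antisym (∣⇒≤ ℓ∣2) (ℕ.nonTrivial⇒n>1 ℓ {{prime⇒nonTrivial ℓ-prime}})
  odd-prime∤2 .2 ℓ-prime () ℓ∣2 | refl

  -- q - 1 = ℓ m is even and ℓ is odd, so m is even; it is nonzero because ℓ does not divide it.
  even-cofactor : ∀ ℓ m → suc (ℓ ℕ.* m) % 2 ≡ 1 → ℓ % 2 ≡ 1 → ¬ (ℓ ∣ m) → 2 ℕ.≤ m
  even-cofactor ℓ m q-odd ℓ-odd ℓ∤m with euclidsLemma ℓ m prime[2] 2∣ℓm
    where
    2∣ℓm : 2 ∣ ℓ ℕ.* m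
    2∣ℓm = divides (suc (ℓ ℕ.* m) / 2) (ℕP.suc-injective (trans (m≡m%n+[m/n]*n (suc (ℓ ℕ.* m)) 2) (cong (ℕ._+ (suc (ℓ ℕ.* m) / 2) ℕ.* 2) q-odd)))
  ... | inj₁ 2∣ℓ = ⊥-elim (ℕP.1+n≢0 (trans (sym ℓ-odd) (n∣m⇒m%n≡0 ℓ 2 2∣ℓ)))
  ... | inj₂ 2∣m = ∣⇒≤ {{ℕ.≢-nonZero (λ { refl → ℓ∤m (divides 0 refl) })}} 2∣m

open import Data.Nat using (ℕ; _∸_; _^_; _%_; _≤_; zero; suc) renaming (_*_ to _*ℕ_)
open import Data.Nat.Divisibility using (_∣_)
open import Data.Nat.Primality using (Prime)
open import Data.Bool using (Bool)
open import Data.Product using (Σ; ∃; _×_; _,_)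
open import Relation.Nullary using (¬_)
open import Relation.Binary.PropositionalEquality using (_≡_; refl)
open CrossIntersection using (odd-prime∤2; even-cofactor; module UpperBound; module LowerBound; module Counting)

theorem1p1 : (F : FiniteField) (K : CharZeroField) (q ℓ m : ℕ)
    (ε : FiniteField.Carrier F) (ζ : CharZeroField.Carrier K) →
    FiniteField.order F ≡ q →
    (∃ λ p → ∃ λ k → Prime p × q ≡ p ^ k) →
    q % 2 ≡ 1 →
    q ∸ 1 ≡ ℓ *ℕ m →
    Prime ℓ → ℓ % 2 ≡ 1 → ¬ (ℓ ∣ m) →
    FiniteField.IsGenerator F ε →
    CharZeroField.IsPrimitiveRoot K ζ (q ∸ 1) →
    let open PrincipalSeries F K ε ζ m in
    ((S₁ S₂ : Subset) → CrossIntersecting S₁ S₂ →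
    (ℓ *ℕ ℓ) *ℕ (∣ S₁ ∣ *ℕ ∣ S₂ ∣) ≤ orderGL *ℕ orderGL)
    × (Σ Subset λ S₁ → Σ Subset λ S₂ → CrossIntersecting S₁ S₂
    × (ℓ *ℕ ℓ) *ℕ (∣ S₁ ∣ *ℕ ∣ S₂ ∣) ≡ orderGL *ℕ orderGL)
-- q = 0 is excluded by its parity, so q - 1 below is a true predecessor.
theorem1p1 F K zero ℓ m ε ζ order≡q _ () q-1≡ℓm ℓ-prime ℓ-odd ℓ∤m gen ζ-prim
theorem1p1 F K (suc q-1) ℓ m ε ζ order≡q _ q-odd refl ℓ-prime ℓ-odd ℓ∤m gen ζ-prim =
  upper-bound , kernel , kernel , kernel-cross-intersecting , kernel-attains
  where
  ℓ∤2 = odd-prime∤2 ℓ ℓ-prime ℓ-odd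
  open UpperBound F K ε gen ℓ m order≡q ℓ-prime ℓ∤2 ℓ∤m (even-cofactor ℓ m q-odd ℓ-odd ℓ∤m) ζ ζ-prim using (upper-bound)
  open LowerBound F K ε gen ℓ m order≡q ℓ-prime ℓ∤2 ℓ∤m ζ ζ-prim using (kernel-cross-intersecting; kernel-attains)
  open Counting F ε gen ℓ m order≡q ℓ-prime ℓ∤2 ℓ∤m using (kernel)
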